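{- Let $m=m(n)$ be a function of $n$ with $m \le \frac{n}{3}$ and $m \Big/ \left(\frac{(\log\log n)^{3/2}}{(\log n)^{1/2}}\, n\right) \to \infty$ as $n\to\infty$. Then \[ \mathbf{RT}(n,K_4,m) \ge \frac{n^2}{8} + \left(\frac13 - o(1)\right) m n, \] where $o(1)$ denotes a quantity tending to $0$ as $n\to\infty$.
   Context: For a graph $H$ and positive integers $n,m$, the Ramsey–Turán number $\mathbf{RT}(n,H,m)$ is the maximum number of edges in a graph on $n$ vertices with independence number less than $m$ that contains no copy of $H$ as a subgraph. Logarithms are natural. -}

module Defs where

open import Data.Nat using (ℕ; zero; suc; _+_; _*_; _^_; _≤_; _<_; _<ᵇ_)
open import Data.Nat.Logarithm using (⌊log₂_⌋)
open import Data.Bool using (Bool; true; false; _∧_; if_then_else_)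
open import Data.Fin using (Fin; toℕ)
open import Data.Fin.Subset using (Subset; _∈_; ∣_∣)
open import Data.List using (List; map; allFin)
open import Data.Nat.ListAction using (sum)
open import Data.Product using (Σ; _×_; ∃-syntax)
open import Relation.Binary.PropositionalEquality using (_≡_; _≢_)
open import Relation.Nullary using (¬_)

record Graph (n : ℕ) : Set where
  field
    adj   : Fin n → Fin n → Bool
    sym   : ∀ i j → adj i j ≡ adj j i
    irrefl : ∀ i → adj i i ≡ false
open Graph public

edges : ∀ {n} → Graph n → ℕ
edges {n} G = sum (map (λ i → sum (map (λ j →
  if (toℕ i <ᵇ toℕ j) ∧ adj G i j then 1 else 0) (allFin n))) (allFin n))

Independent : ∀ {n} → Graph n → Subset n → Set
Independent G S = ∀ i j → i ∈ S → j ∈ S → adj G i j ≡ false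

IndepLess : ∀ {n} → Graph n → ℕ → Set
IndepLess {n} G m = (S : Subset n) → Independent G S → ∣ S ∣ < m

HasK4 : ∀ {n} → Graph n → Set
HasK4 {n} G = Σ (Fin n) λ a → Σ (Fin n) λ b → Σ (Fin n) λ c → Σ (Fin n) λ d →
  adj G a b ≡ true × adj G a c ≡ true × adj G a d ≡ true ×
  adj G b c ≡ true × adj G b d ≡ true × adj G c d ≡ true

RT-K4-≥ : ℕ → ℕ → ℕ → Set
RT-K4-≥ n m e = ∃[ G ] (¬ HasK4 {n} G × IndepLess G m × e ≤ edges G)

-- L n = ⌊log₂ n⌋,  LL n = ⌊log₂ ⌊log₂ n⌋⌋ (stand-ins for log n, log log n;
-- the hypothesis below is a ratio → ∞, which is invariant under the
-- asymptotically-constant factors introduced)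
L : ℕ → ℕ
L n = ⌊log₂ n ⌋

LL : ℕ → ℕ
LL n = ⌊log₂ ⌊log₂ n ⌋ ⌋

-- m(n) / (n (log log n)^{3/2} / (log n)^{1/2}) → ∞, squared and cleared of denominators:
-- for every K, eventually K² n² (LL n)³ ≤ m(n)² L(n)
RatioToInfinity : (ℕ → ℕ) → Set
RatioToInfinity m = ∀ K → ∃[ N ] ∀ n → N ≤ n →
  K * K * (n * n) * (LL n ^ 3) ≤ m n * m n * L n

{-# OPTIONS --safe #-}

-- The graph has two independent sets I and J of size m′ = (1 − o(1)) m and a Bollobás–Erdős graph
-- on parts X and Y of about n/2 − m′ vertices each; I–J, I–X and J–Y are complete.  A K₄ that is not
-- a rectangle between X and Y contains a triangle inside X or Y, and there are
--   m′² + m′ (n − 2m′) + (1/2 − o(1)) (n/2 − m′)²  ≥  n²/8 + m′n/2 − m′²/2 − o(mn)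
-- edges, which suffices because m ≤ n/3.
--
-- The sphere in the Bollobás–Erdős graph is replaced by ℤ^h with the product of centred binomial
-- measures of variance p ≥ h, and a point of weight w becomes ⌊N w / H⌋ vertices, where H is the
-- total mass; so (p + 1)^h ≤ √n suffices, that is, h may be of order log n / log log n.  Two points
-- of the same part are adjacent if they are nearly antipodal, |x + y|² ≤ D, and points of different
-- parts if ⟨x , y⟩ > D.  A K₄ with two points on each side is impossible as ⟨x + x′ , y + y′⟩ ≤ D,
-- and no part contains a triangle once points of small norm are made isolated.
--
-- Small independence number is Gaussian concentration: sets A and −A of measure δ contain points at
-- squared distance O(p log (1/δ)).  This is the infimum-convolution form of the inequality,
-- f x · g y ≤ ρ ^ (p |x − y|²) ⇒ ∫ f ∫ g ≲ 1, proved by integrating out one ±1 step at a time.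
-- The density of X–Y is 1/2 up to the measure of { |⟨x , y⟩| ≤ D }, which the Littlewood–Offord
-- theorem bounds, because most y have many coordinates of size at least √p / 4.
module Submission where

open import Defs
open import Data.Nat using (ℕ; suc; _+_; _*_; _≤_)
open import Data.Product using (∃-syntax; _×_)
open import Data.Bool using (Bool; true; false; _∧_; not; if_then_else_) renaming (T to IsTrue)
open import Data.Bool.Properties using (∧-comm)
open import Data.Empty using (⊥; ⊥-elim)
open import Data.Fin using (Fin; toℕ) renaming (zero to fzero; suc to fsuc)
open import Data.Fin.Properties as FinP using (any?)
open import Data.Fin.Subset using (Subset; _∈_; ∣_∣)
open import Data.Fin.Subset.Properties using (_∈?_)
import Data.Integer as ℤ
import Data.Integer.Properties as ℤP
import Data.Integer.Tactic.RingSolver as ℤSolver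
open ℤ using (ℤ; 0ℤ; 1ℤ)
open import Data.List using (List; []; _∷_; _++_; map; length; replicate; lookup; allFin; tabulate)
open import Data.List.Properties using (map-++; length-++; length-map; length-replicate; map-tabulate; map-cong; map-∘)
open import Data.List.Relation.Unary.All as All using (All; []; _∷_)
import Data.List.Relation.Unary.All.Properties as AllP
open import Data.List.Relation.Unary.AllPairs as AllPairs using (AllPairs; []; _∷_)
import Data.List.Relation.Unary.AllPairs.Properties as AllPairsP
open import Data.Nat using (zero; _∸_; _^_; _<_; z≤n; s≤s; s≤s⁻¹; NonZero; >-nonZero; >-nonZero⁻¹; _≤?_; _/_; _%_; ⌈_/2⌉; ⌊_/2⌋; _<ᵇ_; _≤ᵇ_)
open import Data.Nat.Combinatorics using (_C_; nCk+nC[k+1]≡[n+1]C[k+1]; nCk≡nC[n∸k]; k>n⇒nCk≡0; nCn≡1)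
open import Data.Nat.DivMod using (m≡m%n+[m/n]*n; m%n<n; m/n*n≤m; m*n/n≡m; /-monoˡ-≤)
open import Data.Nat.ListAction using (sum)
open import Data.Nat.ListAction.Properties using (sum-++)
open import Data.Nat.Logarithm using (⌊log₂_⌋; ⌊log₂⌋-mono-≤; ⌊log₂[2^n]⌋≡n; ⌊log₂⌊n/2⌋⌋≡⌊log₂n⌋∸1)
open import Data.Nat.Properties hiding (_≟_)
open import Data.Nat.Tactic.RingSolver using (solve-∀)
open import Data.Product using (_,_; proj₁; proj₂; ∃)
open import Data.Product.Properties using () renaming (≡-dec to ×-≡-dec)
open import Data.Sum using (_⊎_; inj₁; inj₂)
open import Data.Unit using (tt)
open import Data.Vec as Vec using (Vec; []; _∷_)
open import Data.Vec.Properties using () renaming (≡-dec to Vec-≡-dec)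
open import Function using (_∘_; id; case_of_; mk⇔)
open import Relation.Binary.PropositionalEquality using (_≡_; refl; cong; cong₂; subst; subst₂; trans; module ≡-Reasoning) renaming (sym to ≡-sym)
open import Relation.Nullary using (¬_; Dec; yes; no; does)
open import Relation.Nullary.Decidable using (map′; does-⇔; _×-dec_; dec-true; dec-false)


-- The exponents in the hypothesis on m come from the strip |⟨x , y⟩| ≤ D. Write h = 2k and ℓ for
-- log log n. A set without nearly antipodal pairs has to have measure O(1/k), and concentration
-- gives this for D of order p log k, that is p ℓ. For a typical x the inner product ⟨x , y⟩ has
-- standard deviation of order p √k, so the strip has measure of order ℓ / √k. As k is of order log
-- n / ℓ, this is ℓ^(3/2) / (log n)^(1/2), and m has to dominate n times this quantity. The
-- independence number asks for less: X and Y contribute only O(n / k) to it.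
--
-- The condition p ≥ h arises because the functional inequality loses a factor ρ^p per coordinate,
-- where ρ = 1 + 1/q and q is of order p². The choice p = 16 · 4^ℓ, about log² n, leaves ample room,
-- still has log p = O(ℓ), and makes √p / 4 = 2^ℓ an integer.
--
-- There are no real numbers: a probability is an integral over natural weights compared with the
-- total mass H, and inequalities between powers of ρ or square roots are multiplied out.

cancel-≤ : ∀ {P Q A B} s → A ≤ B → P + B + s ≡ Q + A → P ≤ Q
cancel-≤ {P} {Q} {A} {B} s A≤B eq = +-cancelʳ-≤ B P Q (begin
  P + B     ≤⟨ m≤m+n _ s ⟩
  P + B + s ≡⟨ eq ⟩
  Q + A     ≤⟨ +-monoʳ-≤ Q A≤B ⟩
  Q + B     ∎)
  where open ≤-Reasoning

sq-cancel-≤ : ∀ {m n} → m * m ≤ n * n → m ≤ n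
sq-cancel-≤ {m} {n} le with m ≤? n
... | yes p = p
... | no ¬p = ⊥-elim (<⇒≱ (*-mono-< (≰⇒> ¬p) (≰⇒> ¬p)) le)

-- (1 + 1/q)^i ≥ 1 + i/q, multiplied by q^(i + 1). Powers of ρ = 1 + 1/q occur only in this cleared
-- form, as pairs of powers of `q` and `suc q`.
bernoulli : ∀ q i → q ^ i * (q + i) ≤ q * suc q ^ i
bernoulli q zero = ≤-reflexive (lemma q)
  where
  lemma : ∀ q → 1 * (q + 0) ≡ q * 1
  lemma = solve-∀
bernoulli q (suc i) = begin
  q * q ^ i * (q + suc i)       ≤⟨ m≤m+n _ (q ^ i * i) ⟩
  q * q ^ i * (q + suc i) + q ^ i * i ≡⟨ lemma q i (q ^ i) ⟩
  suc q * (q ^ i * (q + i))     ≤⟨ *-monoʳ-≤ (suc q) (bernoulli q i) ⟩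
  suc q * (q * suc q ^ i)       ≡⟨ lemma₂ q (suc q ^ i) ⟩
  q * (suc q * suc q ^ i)       ∎
  where
  open ≤-Reasoning
  lemma : ∀ q i z → q * z * (q + suc i) + z * i ≡ suc q * (z * (q + i))
  lemma = solve-∀
  lemma₂ : ∀ q z → suc q * (q * z) ≡ q * (suc q * z)
  lemma₂ = solve-∀

-- Finite measures and products of centred binomials

private variable
  A B : Set

-- Unnormalised, so that all integrals are natural numbers. A list of atoms, because rounding the
-- weights to vertex counts costs an error proportional to the number of atoms.
Measure : Set → Set
Measure A = List (A × ℕ)

∫ : Measure A → (A → ℕ) → ℕ
∫ []            f = 0
∫ ((x , w) ∷ μ) f = w * f x + ∫ μ f

∫-mono : (μ : Measure A) {f g : A → ℕ} → (∀ x → f x ≤ g x) → ∫ μ f ≤ ∫ μ g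
∫-mono []            le = z≤n
∫-mono ((x , w) ∷ μ) le = +-mono-≤ (*-monoʳ-≤ w (le x)) (∫-mono μ le)

∫-cong : (μ : Measure A) {f g : A → ℕ} → (∀ x → f x ≡ g x) → ∫ μ f ≡ ∫ μ g
∫-cong []            eq = refl
∫-cong ((x , w) ∷ μ) eq = cong₂ (λ a b → w * a + b) (eq x) (∫-cong μ eq)

∫-+ : (μ : Measure A) (f g : A → ℕ) → ∫ μ (λ x → f x + g x) ≡ ∫ μ f + ∫ μ g
∫-+ []            f g = refl
∫-+ ((x , w) ∷ μ) f g rewrite ∫-+ μ f g = lemma w (f x) (g x) (∫ μ f) (∫ μ g)
  where
  lemma : ∀ w a b c d → w * (a + b) + (c + d) ≡ w * a + c + (w * b + d)
  lemma = solve-∀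

∫-*ˡ : (μ : Measure A) (c : ℕ) (f : A → ℕ) → ∫ μ (λ x → c * f x) ≡ c * ∫ μ f
∫-*ˡ []            c f = ≡-sym (*-zeroʳ c)
∫-*ˡ ((x , w) ∷ μ) c f rewrite ∫-*ˡ μ c f = lemma w c (f x) (∫ μ f)
  where
  lemma : ∀ w c a b → w * (c * a) + c * b ≡ c * (w * a + b)
  lemma = solve-∀

∫-*ʳ : (μ : Measure A) (c : ℕ) (f : A → ℕ) → ∫ μ (λ x → f x * c) ≡ ∫ μ f * c
∫-*ʳ μ c f = trans (∫-cong μ (λ x → *-comm (f x) c)) (trans (∫-*ˡ μ c f) (*-comm c _))

mass : Measure A → ℕ
mass μ = ∫ μ (λ _ → 1)

∫-const : (μ : Measure A) (c : ℕ) → ∫ μ (λ _ → c) ≡ c * mass μ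
∫-const μ c = trans (∫-cong μ (λ _ → ≡-sym (*-identityʳ c))) (∫-*ˡ μ c (λ _ → 1))

∫-0 : (μ : Measure A) → ∫ μ (λ _ → 0) ≡ 0
∫-0 μ = ∫-const μ 0

∫-++ : (μ ν : Measure A) (f : A → ℕ) → ∫ (μ ++ ν) f ≡ ∫ μ f + ∫ ν f
∫-++ []            ν f = refl
∫-++ ((x , w) ∷ μ) ν f rewrite ∫-++ μ ν f = ≡-sym (+-assoc (w * f x) (∫ μ f) (∫ ν f))

extend : ∀ {h} → Measure A → Measure (Vec A h) → Measure (Vec A (suc h))
extend []            ν = []
extend ((x , w) ∷ μ) ν = map (λ (v , u) → (x ∷ v , w * u)) ν ++ extend μ ν

power : Measure A → (h : ℕ) → Measure (Vec A h)
power μ zero    = ([] , 1) ∷ []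
power μ (suc h) = extend μ (power μ h)

∫-power-suc : (μ : Measure A) (h : ℕ) (f : Vec A (suc h) → ℕ) →
              ∫ (power μ (suc h)) f ≡ ∫ μ (λ x → ∫ (power μ h) (λ v → f (x ∷ v)))
∫-power-suc {A} μ h f = go μ
  where
  scale : ∀ x w (ρ : Measure (Vec A h)) →
          ∫ (map (λ (v , u) → (x ∷ v , w * u)) ρ) f ≡ w * ∫ ρ (λ v → f (x ∷ v))
  scale x w []            = ≡-sym (*-zeroʳ w)
  scale x w ((v , u) ∷ ρ) rewrite scale x w ρ = lemma w u (f (x ∷ v)) (∫ ρ (λ v → f (x ∷ v)))
    where
    lemma : ∀ w u a b → w * u * a + w * b ≡ w * (u * a + b)
    lemma = solve-∀
  go : ∀ ρ → ∫ (extend ρ (power μ h)) f ≡ ∫ ρ (λ x → ∫ (power μ h) (λ v → f (x ∷ v)))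
  go []            = refl
  go ((x , w) ∷ ρ) = trans (∫-++ (map _ (power μ h)) _ f) (cong₂ _+_ (scale x w (power μ h)) (go ρ))

-- Independence of the coordinates, needed for the exponential moment of the number of small
-- coordinates.
∫-power-* : (μ : Measure A) (h : ℕ) (g : A → ℕ) →
            ∫ (power μ h) (Vec.foldr _ (λ x r → g x * r) 1) ≡ ∫ μ g ^ h
∫-power-* μ zero    g = refl
∫-power-* μ (suc h) g = begin
  ∫ (power μ (suc h)) G                        ≡⟨ ∫-power-suc μ h G ⟩
  ∫ μ (λ x → ∫ (power μ h) (λ v → g x * G v))  ≡⟨ ∫-cong μ (λ x → trans (∫-*ˡ (power μ h) (g x) G) (cong (g x *_) (∫-power-* μ h g))) ⟩
  ∫ μ (λ x → g x * ∫ μ g ^ h)                  ≡⟨ ∫-*ʳ μ (∫ μ g ^ h) g ⟩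
  ∫ μ g * ∫ μ g ^ h                            ∎
  where
  open ≡-Reasoning
  G : ∀ {n} → Vec _ n → ℕ
  G = Vec.foldr _ (λ x r → g x * r) 1

length-power : (μ : Measure A) (h : ℕ) → length (power μ h) ≡ length μ ^ h
length-power μ zero    = refl
length-power {A} μ (suc h) = go μ
  where
  go : ∀ (ρ : Measure A) → length (extend ρ (power μ h)) ≡ length ρ * length μ ^ h
  go []            = refl
  go ((x , w) ∷ ρ) = trans (length-++ (map _ (power μ h)))
    (cong₂ _+_ (trans (length-map _ (power μ h)) (length-power μ h)) (go ρ))

-- The first argument carries the left neighbour, so `pascal 0` takes a row of Pascal's triangle to
-- the next one.
pascal : ℕ → List ℕ → List ℕ
pascal c []       = c ∷ []
pascal c (d ∷ ds) = (c + d) ∷ pascal d ds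

pascalRow : ℕ → List ℕ
pascalRow zero    = 1 ∷ []
pascalRow (suc p) = pascal 0 (pascalRow p)

place : ℤ → List ℕ → Measure ℤ
place z []       = []
place z (c ∷ cs) = (z , c) ∷ place (z ℤ.+ ℤ.+ 2) cs

-- The distribution of a ±1 walk from 0 after p steps.
binomial : ℕ → Measure ℤ
binomial p = place (ℤ.- (ℤ.+ p)) (pascalRow p)

-- The carried weight `c` is the mass that the preceding point z - 2 sends up to z - 1; with this
-- term the recursion passes through the list.
∫-place-pascal : ∀ z c cs (f : ℤ → ℕ) →
  ∫ (place (z ℤ.- 1ℤ) (pascal c cs)) f ≡
  c * f (z ℤ.- 1ℤ) + ∫ (place z cs) (λ y → f (y ℤ.+ 1ℤ) + f (y ℤ.- 1ℤ))
∫-place-pascal z c []       f = refl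
∫-place-pascal z c (d ∷ ds) f = begin
  (c + d) * f z⁻ + ∫ (place (z⁻ ℤ.+ ℤ.+ 2) (pascal d ds)) f
    ≡⟨ cong (λ y → (c + d) * f z⁻ + ∫ (place y (pascal d ds)) f) (shift z) ⟩
  (c + d) * f z⁻ + ∫ (place (z ℤ.+ ℤ.+ 2 ℤ.- 1ℤ) (pascal d ds)) f
    ≡⟨ cong ((c + d) * f z⁻ +_) (∫-place-pascal (z ℤ.+ ℤ.+ 2) d ds f) ⟩
  (c + d) * f z⁻ + (d * f (z ℤ.+ ℤ.+ 2 ℤ.- 1ℤ) + rest)
    ≡⟨ cong (λ y → (c + d) * f z⁻ + (d * f y + rest)) (shift₂ z) ⟩
  (c + d) * f z⁻ + (d * f (z ℤ.+ 1ℤ) + rest)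
    ≡⟨ lemma c d (f z⁻) (f (z ℤ.+ 1ℤ)) rest ⟩
  c * f z⁻ + (d * (f (z ℤ.+ 1ℤ) + f z⁻) + rest) ∎
  where
  open ≡-Reasoning
  z⁻ = z ℤ.- 1ℤ
  rest = ∫ (place (z ℤ.+ ℤ.+ 2) ds) (λ y → f (y ℤ.+ 1ℤ) + f (y ℤ.- 1ℤ))
  shift : ∀ z → z ℤ.- 1ℤ ℤ.+ ℤ.+ 2 ≡ z ℤ.+ ℤ.+ 2 ℤ.- 1ℤ
  shift = ℤSolver.solve-∀
  shift₂ : ∀ z → z ℤ.+ ℤ.+ 2 ℤ.- 1ℤ ≡ z ℤ.+ 1ℤ
  shift₂ z = trans (ℤP.+-assoc z (ℤ.+ 2) (ℤ.- 1ℤ)) refl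
  lemma : ∀ c d a b r → (c + d) * a + (d * b + r) ≡ c * a + (d * (b + a) + r)
  lemma = solve-∀

-- Conditioning on a single ±1 step. Symmetry, concentration and the Littlewood-Offord bound are all
-- inductions over this identity.
∫-binomial-suc : ∀ p (f : ℤ → ℕ) →
  ∫ (binomial (suc p)) f ≡ ∫ (binomial p) (λ z → f (z ℤ.+ 1ℤ) + f (z ℤ.- 1ℤ))
∫-binomial-suc p f = trans
  (cong (λ y → ∫ (place y (pascalRow (suc p))) f) (negsuc p))
  (∫-place-pascal (ℤ.- (ℤ.+ p)) 0 (pascalRow p) f)
  where
  negsuc : ∀ p → ℤ.- (ℤ.+ suc p) ≡ ℤ.- (ℤ.+ p) ℤ.- 1ℤ
  negsuc p = trans (cong ℤ.-_ (ℤP.+-comm 1ℤ (ℤ.+ p))) (ℤP.neg-distrib-+ (ℤ.+ p) 1ℤ)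

∫-binomial-zero : (f : ℤ → ℕ) → ∫ (binomial 0) f ≡ f 0ℤ
∫-binomial-zero f = trans (+-identityʳ _) (+-identityʳ _)

length-binomial : ∀ p → length (binomial p) ≡ suc p
length-binomial p = trans (length-place _ (pascalRow p)) (length-row p)
  where
  length-place : ∀ z cs → length (place z cs) ≡ length cs
  length-place z []       = refl
  length-place z (c ∷ cs) = cong suc (length-place _ cs)
  length-pascal : ∀ c cs → length (pascal c cs) ≡ suc (length cs)
  length-pascal c []       = refl
  length-pascal c (d ∷ ds) = cong suc (length-pascal d ds)
  length-row : ∀ p → length (pascalRow p) ≡ suc p
  length-row zero    = refl
  length-row (suc p) = trans (length-pascal 0 (pascalRow p)) (cong suc (length-row p))

mass-binomial : ∀ p → mass (binomial p) ≡ 2 ^ p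
mass-binomial zero    = refl
mass-binomial (suc p) = trans (∫-binomial-suc p _)
  (trans (∫-const (binomial p) 2) (cong (2 *_) (mass-binomial p)))

∫-binomial-neg : ∀ p (f : ℤ → ℕ) → ∫ (binomial p) (f ∘ ℤ.-_) ≡ ∫ (binomial p) f
∫-binomial-neg zero    f = refl
∫-binomial-neg (suc p) f = begin
  ∫ (binomial (suc p)) (f ∘ ℤ.-_)                                          ≡⟨ ∫-binomial-suc p _ ⟩
  ∫ (binomial p) (λ z → f (ℤ.- (z ℤ.+ 1ℤ)) + f (ℤ.- (z ℤ.- 1ℤ)))           ≡⟨ ∫-cong (binomial p) (λ z →
      trans (+-comm (f (ℤ.- (z ℤ.+ 1ℤ))) _) (cong₂ (λ a b → f a + f b) (neg₁ z) (neg₂ z))) ⟩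
  ∫ (binomial p) ((λ z → f (z ℤ.+ 1ℤ) + f (z ℤ.- 1ℤ)) ∘ ℤ.-_)              ≡⟨ ∫-binomial-neg p _ ⟩
  ∫ (binomial p) (λ z → f (z ℤ.+ 1ℤ) + f (z ℤ.- 1ℤ))                       ≡⟨ ≡-sym (∫-binomial-suc p f) ⟩
  ∫ (binomial (suc p)) f                                                   ∎
  where
  open ≡-Reasoning
  neg₁ : ∀ z → ℤ.- (z ℤ.- 1ℤ) ≡ ℤ.- z ℤ.+ 1ℤ
  neg₁ = ℤSolver.solve-∀
  neg₂ : ∀ z → ℤ.- (z ℤ.+ 1ℤ) ≡ ℤ.- z ℤ.- 1ℤ
  neg₂ = ℤSolver.solve-∀

mass-power : (μ : Measure A) (h : ℕ) → mass (power μ h) ≡ mass μ ^ h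
mass-power μ zero    = refl
mass-power μ (suc h) = trans (∫-power-suc μ h _)
  (trans (∫-const μ (mass (power μ h))) (trans (cong (_* mass μ) (mass-power μ h)) (*-comm _ (mass μ))))

negate : ∀ {h} → Vec ℤ h → Vec ℤ h
negate = Vec.map (λ z → ℤ.- z)

∫-power-neg : ∀ p h (f : Vec ℤ h → ℕ) →
  ∫ (power (binomial p) h) (f ∘ negate) ≡ ∫ (power (binomial p) h) f
∫-power-neg p zero    f = refl
∫-power-neg p (suc h) f = begin
  ∫ (power μ (suc h)) (f ∘ negate)                              ≡⟨ ∫-power-suc μ h _ ⟩
  ∫ μ (λ z → ∫ (power μ h) (λ v → f (ℤ.- z ∷ negate v)))        ≡⟨ ∫-cong μ (λ z → ∫-power-neg p h (λ v → f (ℤ.- z ∷ v))) ⟩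
  ∫ μ ((λ z → ∫ (power μ h) (λ v → f (z ∷ v))) ∘ ℤ.-_)                ≡⟨ ∫-binomial-neg p _ ⟩
  ∫ μ (λ z → ∫ (power μ h) (λ v → f (z ∷ v)))                         ≡⟨ ≡-sym (∫-power-suc μ h f) ⟩
  ∫ (power μ (suc h)) f                                               ∎
  where
  open ≡-Reasoning
  μ = binomial p


-- Gaussian concentration for centred binomials

-- A converse to Bernoulli's inequality for small exponents: ρ^j ≤ 1 + 2j/q with ρ = 1 + 1/q.
bernoulli-upper : ∀ q j → 2 * j ≤ q → suc q ^ j * q ≤ q ^ j * (q + 2 * j)
bernoulli-upper q zero    _  = ≤-reflexive (cong (1 *_) (≡-sym (+-identityʳ q)))
bernoulli-upper q (suc j) le = begin
  suc q * suc q ^ j * q               ≡⟨ *-assoc (suc q) (suc q ^ j) q ⟩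
  suc q * (suc q ^ j * q)             ≤⟨ *-monoʳ-≤ (suc q) (bernoulli-upper q j 2j≤q) ⟩
  suc q * (q ^ j * (q + 2 * j))       ≤⟨ cancel-≤ 0 (*-monoʳ-≤ (q ^ j) 2j≤q) (lemma q j (q ^ j)) ⟩
  q * q ^ j * (q + 2 * suc j)         ∎
  where
  open ≤-Reasoning
  2j≤q : 2 * j ≤ q
  2j≤q = ≤-trans (*-monoʳ-≤ 2 (n≤1+n j)) le
  lemma : ∀ q j z → suc q * (z * (q + 2 * j)) + z * q + 0 ≡ q * z * (q + 2 * suc j) + z * (2 * j)
  lemma = solve-∀

-- With ρ = 1 + 1/q this is cosh² (½ j log ρ) ≤ ρ ^ i, denominators cleared.
cosh-bound : ∀ q j i .{{_ : NonZero q}} → 4 * (j * j) ≤ q * i →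
  (suc q ^ j + q ^ j) * (suc q ^ j + q ^ j) * q ^ i ≤ 4 * (suc q ^ j * q ^ j) * suc q ^ i
cosh-bound q j i 4j²≤qi with 2 * j ≤? q
-- With N = β + g, (N + β)² = 4Nβ + g². Since g/β = ρ^j - 1 ≤ 2j/q, the excess g² is at most
-- (i/q)β², and the factor 1 + i/q ≤ ρ^i absorbs it.
... | yes 2j≤q = *-cancelˡ-≤ q (begin
  q * ((N + β) * (N + β) * q ^ i)               ≡⟨ cong (λ y → q * ((y + β) * (y + β) * q ^ i)) N≡ ⟩
  q * ((β + g + β) * (β + g + β) * q ^ i)       ≡⟨ lemma₁ q β g (q ^ i) ⟩
  (4 * ((β + g) * β) * q + q * (g * g)) * q ^ i ≤⟨ *-monoˡ-≤ (q ^ i) (+-monoʳ-≤ (4 * ((β + g) * β) * q) qg²≤) ⟩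
  (4 * ((β + g) * β) * q + i * (β * β)) * q ^ i ≤⟨ m≤m+n _ (3 * (i * (β * β)) * q ^ i + 4 * (g * β) * i * q ^ i) ⟩
  (4 * ((β + g) * β) * q + i * (β * β)) * q ^ i + (3 * (i * (β * β)) * q ^ i + 4 * (g * β) * i * q ^ i)
                                                ≡⟨ lemma₂ q β g i (q ^ i) ⟩
  4 * ((β + g) * β) * (q ^ i * (q + i))         ≤⟨ *-monoʳ-≤ (4 * ((β + g) * β)) (bernoulli q i) ⟩
  4 * ((β + g) * β) * (q * suc q ^ i)           ≡⟨ lemma₃ ((β + g) * β) q (suc q ^ i) ⟩
  q * (4 * ((β + g) * β) * suc q ^ i)           ≡⟨ cong (λ y → q * (4 * (y * β) * suc q ^ i)) (≡-sym N≡) ⟩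
  q * (4 * (N * β) * suc q ^ i)                 ∎)
  where
  open ≤-Reasoning
  N = suc q ^ j
  β = q ^ j
  g = N ∸ β
  N≡ : N ≡ β + g
  N≡ = ≡-sym (m+[n∸m]≡n (^-monoˡ-≤ j (n≤1+n q)))
  qg≤ : q * g ≤ 2 * j * β
  qg≤ = cancel-≤ 0 (subst (λ y → y * q ≤ β * (q + 2 * j)) N≡ (bernoulli-upper q j 2j≤q)) (lemma q g j β)
    where
    lemma : ∀ q g j β → q * g + β * (q + 2 * j) + 0 ≡ 2 * j * β + (β + g) * q
    lemma = solve-∀
  qg²≤ : q * (g * g) ≤ i * (β * β)
  qg²≤ = *-cancelˡ-≤ q (begin
    q * (q * (g * g))          ≡⟨ lemma q g ⟩
    (q * g) * (q * g)          ≤⟨ *-mono-≤ qg≤ qg≤ ⟩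
    (2 * j * β) * (2 * j * β)  ≡⟨ lemma₂ j β ⟩
    4 * (j * j) * (β * β)      ≤⟨ *-monoˡ-≤ (β * β) 4j²≤qi ⟩
    q * i * (β * β)            ≡⟨ *-assoc q i _ ⟩
    q * (i * (β * β))          ∎)
    where
    lemma : ∀ q g → q * (q * (g * g)) ≡ (q * g) * (q * g)
    lemma = solve-∀
    lemma₂ : ∀ j β → (2 * j * β) * (2 * j * β) ≡ 4 * (j * j) * (β * β)
    lemma₂ = solve-∀
  lemma₁ : ∀ q β g z → q * ((β + g + β) * (β + g + β) * z) ≡ (4 * ((β + g) * β) * q + q * (g * g)) * z
  lemma₁ = solve-∀
  lemma₂ : ∀ q β g i z → (4 * ((β + g) * β) * q + i * (β * β)) * z + (3 * (i * (β * β)) * z + 4 * (g * β) * i * z)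
           ≡ 4 * ((β + g) * β) * (z * (q + i))
  lemma₂ = solve-∀
  lemma₃ : ∀ x q z → 4 * x * (q * z) ≡ q * (4 * x * z)
  lemma₃ = solve-∀
-- Here the hypothesis forces 2j ≤ i, so ρ^i ≥ ρ^j and the crude bound (N + β)² ≤ 4N² is enough.
... | no 2j≰q = begin
  (N + β) * (N + β) * q ^ i      ≤⟨ *-monoˡ-≤ (q ^ i) (*-mono-≤ (+-monoʳ-≤ N β≤N) (+-monoʳ-≤ N β≤N)) ⟩
  (N + N) * (N + N) * q ^ i      ≡⟨ cong (λ y → (N + N) * (N + N) * q ^ y) i≡ ⟩
  (N + N) * (N + N) * q ^ (j + r) ≡⟨ cong ((N + N) * (N + N) *_) (^-distribˡ-+-* q j r) ⟩
  (N + N) * (N + N) * (β * q ^ r) ≤⟨ *-monoʳ-≤ ((N + N) * (N + N)) (*-monoʳ-≤ β (^-monoˡ-≤ r (n≤1+n q))) ⟩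
  (N + N) * (N + N) * (β * suc q ^ r) ≡⟨ lemma N β (suc q ^ r) ⟩
  4 * (N * β) * (N * suc q ^ r)  ≡⟨ cong (4 * (N * β) *_) (≡-sym (^-distribˡ-+-* (suc q) j r)) ⟩
  4 * (N * β) * suc q ^ (j + r)  ≡⟨ cong (λ y → 4 * (N * β) * suc q ^ y) (≡-sym i≡) ⟩
  4 * (N * β) * suc q ^ i        ∎
  where
  open ≤-Reasoning
  N = suc q ^ j
  β = q ^ j
  β≤N : β ≤ N
  β≤N = ^-monoˡ-≤ j (n≤1+n q)
  q<2j : q < 2 * j
  q<2j = ≰⇒> 2j≰q
  2j≤i : 2 * j ≤ i
  2j≤i = *-cancelˡ-≤ (2 * j) {{>-nonZero (≤-<-trans z≤n q<2j)}} (begin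
    2 * j * (2 * j)  ≡⟨ lemma₄ j ⟩
    4 * (j * j)      ≤⟨ 4j²≤qi ⟩
    q * i            ≤⟨ *-monoˡ-≤ i (<⇒≤ q<2j) ⟩
    2 * j * i        ∎)
    where
    lemma₄ : ∀ j → 2 * j * (2 * j) ≡ 4 * (j * j)
    lemma₄ = solve-∀
  r = i ∸ j
  i≡ : i ≡ j + r
  i≡ = ≡-sym (m+[n∸m]≡n (≤-trans (m≤n*m j 2) 2j≤i))
  lemma : ∀ N β z → (N + N) * (N + N) * (β * z) ≡ 4 * (N * β) * (N * z)
  lemma = solve-∀

-- The Hamilton–Jacobi step: (U − u)(U − v) ≥ 0 and u v = x y ≤ K² give U (u + v) ≤ U² + K²,
-- where K = P / k bounds x and y and U = P ν / (k β) bounds u and v.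
four-point-bound : ∀ {P k ν β x y u v} .{{_ : NonZero P}} →
  x * k ≤ P → y * k ≤ P → u * (k * β) ≤ P * ν → v * (k * β) ≤ P * ν → u * v ≡ x * y →
  ν * β * k * (x + y + (u + v)) ≤ P * ((ν + β) * (ν + β))
four-point-bound {P} {k} {ν} {β} {x} {y} {u} {v} xk yk uk vk uv = begin
  ν * β * k * (x + y + (u + v))                           ≡⟨ lemma₁ ν β k x y (u + v) ⟩
  ν * β * (x * k + y * k) + ν * β * k * (u + v)           ≤⟨ +-mono-≤ (*-monoʳ-≤ (ν * β) (+-mono-≤ xk yk)) off-diagonal ⟩
  ν * β * (P + P) + P * (ν * ν + β * β)                   ≡⟨ lemma₂ P ν β ⟩
  P * ((ν + β) * (ν + β))                                 ∎
  where
  open ≤-Reasoning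
  X = P * ν
  Y = k * β
  product : X * Y * (u + v) ≤ X * X + Y * Y * (u * v)
  product = begin
    X * Y * (u + v)                              ≡⟨ lemma X Y u v ⟩
    u * Y * X + v * Y * X                        ≡⟨ cong₂ (λ a b → u * Y * a + v * Y * b) (≡-sym eqv) (≡-sym equ) ⟩
    u * Y * (v * Y + t) + v * Y * (u * Y + s)    ≤⟨ m≤m+n _ (s * t) ⟩
    u * Y * (v * Y + t) + v * Y * (u * Y + s) + s * t ≡⟨ lemma′ u v Y s t ⟩
    (u * Y + s) * (v * Y + t) + Y * Y * (u * v)  ≡⟨ cong₂ (λ a b → a * b + Y * Y * (u * v)) equ eqv ⟩
    X * X + Y * Y * (u * v)                      ∎
    where
    s = X ∸ u * Y
    t = X ∸ v * Y
    equ : u * Y + s ≡ X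
    equ = m+[n∸m]≡n uk
    eqv : v * Y + t ≡ X
    eqv = m+[n∸m]≡n vk
    lemma : ∀ X Y u v → X * Y * (u + v) ≡ u * Y * X + v * Y * X
    lemma = solve-∀
    lemma′ : ∀ u v Y s t → u * Y * (v * Y + t) + v * Y * (u * Y + s) + s * t ≡ (u * Y + s) * (v * Y + t) + Y * Y * (u * v)
    lemma′ = solve-∀
  off-diagonal : ν * β * k * (u + v) ≤ P * (ν * ν + β * β)
  off-diagonal = *-cancelˡ-≤ P (begin
    P * (ν * β * k * (u + v))                          ≡⟨ lemma P ν β k (u + v) ⟩
    X * Y * (u + v)                                    ≤⟨ product ⟩
    X * X + Y * Y * (u * v)                            ≡⟨ cong (λ a → X * X + Y * Y * a) uv ⟩
    X * X + Y * Y * (x * y)                            ≡⟨ cong (X * X +_) (lemma′ k β x y) ⟩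
    X * X + β * β * ((x * k) * (y * k))                ≤⟨ +-monoʳ-≤ (X * X) (*-monoʳ-≤ (β * β) (*-mono-≤ xk yk)) ⟩
    X * X + β * β * (P * P)                            ≡⟨ lemma″ P ν β ⟩
    P * (P * (ν * ν + β * β))                          ∎)
    where
    lemma : ∀ P ν β k z → P * (ν * β * k * z) ≡ P * ν * (k * β) * z
    lemma = solve-∀
    lemma′ : ∀ k β x y → k * β * (k * β) * (x * y) ≡ β * β * ((x * k) * (y * k))
    lemma′ = solve-∀
    lemma″ : ∀ P ν β → P * ν * (P * ν) + β * β * (P * P) ≡ P * (P * (ν * ν + β * β))
    lemma″ = solve-∀
  lemma₁ : ∀ ν β k x y z → ν * β * k * (x + y + z) ≡ ν * β * (x * k + y * k) + ν * β * k * z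
  lemma₁ = solve-∀
  lemma₂ : ∀ P ν β → ν * β * (P + P) + P * (ν * ν + β * β) ≡ P * ((ν + β) * (ν + β))
  lemma₂ = solve-∀

sqr : ℤ → ℕ
sqr z = ℤ.∣ z ∣ * ℤ.∣ z ∣

dist² : ∀ {h} → Vec ℤ h → Vec ℤ h → ℕ
dist² []       []       = 0
dist² (x ∷ xs) (y ∷ ys) = sqr (x ℤ.- y) + dist² xs ys

-- 576 = 4 · 12²: raising the distance d by 2 raises the exponent by at most j = 12p(d + 1), and
-- `cosh-bound` with i = (d + 1)² asks for 4j² ≤ q i.
module Concentration (p q : ℕ) .{{q≢0 : NonZero q}} (q≡ : q ≡ 576 * (p * p)) where

  -- After integrating t of the p steps, f x · g y is still at most ρ ^ cost t |x − y|,
  -- up to constants, where ρ = 1 + 1/q.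
  cost : ℕ → ℕ → ℕ
  cost t d = p * (d * d) + t * (suc d * suc d)

  weaken : ∀ {m M s s′} → s ≤ s′ → m * q ^ s ≤ M * suc q ^ s → m * q ^ s′ ≤ M * suc q ^ s′
  weaken {m} {M} {s} {s′} s≤s′ le = begin
    m * q ^ s′                     ≡⟨ cong (λ z → m * q ^ z) (≡-sym s′≡) ⟩
    m * q ^ (s + r)                ≡⟨ cong (m *_) (^-distribˡ-+-* q s r) ⟩
    m * (q ^ s * q ^ r)            ≡⟨ ≡-sym (*-assoc m _ _) ⟩
    m * q ^ s * q ^ r              ≤⟨ *-mono-≤ le (^-monoˡ-≤ r (n≤1+n q)) ⟩
    M * suc q ^ s * suc q ^ r      ≡⟨ *-assoc M _ _ ⟩
    M * (suc q ^ s * suc q ^ r)    ≡⟨ cong (M *_) (≡-sym (^-distribˡ-+-* (suc q) s r)) ⟩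
    M * suc q ^ (s + r)            ≡⟨ cong (λ z → M * suc q ^ z) s′≡ ⟩
    M * suc q ^ s′                 ∎
    where
    open ≤-Reasoning
    r = s′ ∸ s
    s′≡ : s + r ≡ s′
    s′≡ = m+[n∸m]≡n s≤s′

  cost-mono : ∀ t {d d′} → d ≤ d′ → cost t d ≤ cost t d′
  cost-mono t le = +-mono-≤ (*-monoʳ-≤ p (*-mono-≤ le le)) (*-monoʳ-≤ t (*-mono-≤ (s≤s le) (s≤s le)))

  -- `x` and `y` are products of f and g after equal steps, which keep the distance; `u` and `v`
  -- belong to opposite steps, which may raise it by 2. Bounding `u` and `v` separately would lose
  -- ρ^j. As u v = x y, they cannot both be large, and the loss drops to a squared hyperbolic
  -- cosine, which the increment of `cost` pays for.
  bit-step : ∀ {t d M x y u v} .{{_ : NonZero M}} → t ≤ p →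
    x * q ^ cost t d ≤ M * suc q ^ cost t d → y * q ^ cost t d ≤ M * suc q ^ cost t d →
    u * q ^ cost t (2 + d) ≤ M * suc q ^ cost t (2 + d) → v * q ^ cost t (2 + d) ≤ M * suc q ^ cost t (2 + d) →
    u * v ≡ x * y →
    (x + y + (u + v)) * q ^ cost (suc t) d ≤ M * 4 * suc q ^ cost (suc t) d
  bit-step {t} {d} {M} {x} {y} {u} {v} t≤p hx hy hu hv uv =
    *-cancelˡ-≤ (ν * β) {{m*n≢0 ν β}} (begin
      ν * β * (T * q ^ cost (suc t) d)              ≡⟨ cong (λ s → ν * β * (T * s)) (split q) ⟩
      ν * β * (T * (k * q ^ i))                     ≡⟨ lemma₁ ν β k T (q ^ i) ⟩
      ν * β * k * T * q ^ i                         ≤⟨ *-monoˡ-≤ (q ^ i) (four-point-bound {P} {k} {ν} {β} {x} {y} {u} {v} {{m*n≢0 M K}} hx hy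
                                                         (shift u hu) (shift v hv) uv) ⟩
      P * ((ν + β) * (ν + β)) * q ^ i               ≡⟨ *-assoc P _ _ ⟩
      P * ((ν + β) * (ν + β) * q ^ i)               ≤⟨ *-monoʳ-≤ P (cosh-bound q j i 4j²≤qi) ⟩
      P * (4 * (ν * β) * suc q ^ i)                 ≡⟨ lemma₂ M K (ν * β) (suc q ^ i) ⟩
      ν * β * (M * 4 * (K * suc q ^ i))             ≡⟨ cong (λ s → ν * β * (M * 4 * s)) (≡-sym (split (suc q))) ⟩
      ν * β * (M * 4 * suc q ^ cost (suc t) d)      ∎)
    where
    open ≤-Reasoning
    T = x + y + (u + v)
    i = suc d * suc d
    j = p * (4 * suc d) + t * (4 * suc (suc d))
    k = q ^ cost t d
    K = suc q ^ cost t d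
    ν = suc q ^ j
    β = q ^ j
    P = M * K
    instance
      ν≢0 : NonZero ν
      ν≢0 = m^n≢0 (suc q) j
      β≢0 : NonZero β
      β≢0 = m^n≢0 q j
      K≢0 : NonZero K
      K≢0 = m^n≢0 (suc q) (cost t d)
    split : ∀ b → b ^ cost (suc t) d ≡ b ^ cost t d * b ^ i
    split b = trans (cong (b ^_) (lemma p t d)) (^-distribˡ-+-* b (cost t d) i)
      where
      lemma : ∀ p t d → p * (d * d) + suc t * (suc d * suc d) ≡ p * (d * d) + t * (suc d * suc d) + suc d * suc d
      lemma = solve-∀
    split₂ : ∀ b → b ^ cost t (2 + d) ≡ b ^ cost t d * b ^ j
    split₂ b = trans (cong (b ^_) (lemma p t d)) (^-distribˡ-+-* b (cost t d) j)
      where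
      lemma : ∀ p t d → p * ((2 + d) * (2 + d)) + t * (suc (2 + d) * suc (2 + d))
              ≡ p * (d * d) + t * (suc d * suc d) + (p * (4 * suc d) + t * (4 * suc (suc d)))
      lemma = solve-∀
    shift : ∀ w → w * q ^ cost t (2 + d) ≤ M * suc q ^ cost t (2 + d) → w * (k * β) ≤ P * ν
    shift w = subst₂ _≤_ (cong (w *_) (split₂ q)) (trans (cong (M *_) (split₂ (suc q))) (≡-sym (*-assoc M K ν)))
    j≤ : j ≤ 12 * (p * suc d)
    j≤ = begin
      p * (4 * suc d) + t * (4 * suc (suc d))   ≤⟨ +-monoʳ-≤ _ (*-mono-≤ t≤p (*-monoʳ-≤ 4 (s≤s (m≤n+m (suc d) d)))) ⟩
      p * (4 * suc d) + p * (4 * suc (d + suc d)) ≡⟨ lemma p d ⟩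
      12 * (p * suc d)                          ∎
      where
      lemma : ∀ p d → p * (4 * suc d) + p * (4 * suc (d + suc d)) ≡ 12 * (p * suc d)
      lemma = solve-∀
    4j²≤qi : 4 * (j * j) ≤ q * i
    4j²≤qi = begin
      4 * (j * j)                                    ≤⟨ *-monoʳ-≤ 4 (*-mono-≤ j≤ j≤) ⟩
      4 * (12 * (p * suc d) * (12 * (p * suc d)))    ≡⟨ lemma p (suc d) ⟩
      576 * (p * p) * i                              ≡⟨ cong (_* i) (≡-sym q≡) ⟩
      q * i                                          ∎
      where
      lemma : ∀ p z → 4 * (12 * (p * z) * (12 * (p * z))) ≡ 576 * (p * p) * (z * z)
      lemma = solve-∀
    lemma₁ : ∀ ν β k T z → ν * β * (T * (k * z)) ≡ ν * β * k * T * z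
    lemma₁ = solve-∀
    lemma₂ : ∀ M K w z → M * K * (4 * w * z) ≡ w * (M * 4 * (K * z))
    lemma₂ = solve-∀

  -- Induction on the r steps still to be integrated; the hypothesis is the invariant after t steps.
  -- At the end both functions are evaluated at 0, where the cost is just the number of steps, so a
  -- full coordinate loses only ρ^p.
  binomial-concentration : ∀ r t → t + r ≤ p → ∀ M .{{_ : NonZero M}} (f g : ℤ → ℕ) →
    (∀ x y → f x * g y * q ^ cost t ℤ.∣ x ℤ.- y ∣ ≤ M * suc q ^ cost t ℤ.∣ x ℤ.- y ∣) →
    ∫ (binomial r) f * ∫ (binomial r) g * q ^ (t + r) ≤ M * 4 ^ r * suc q ^ (t + r)
  binomial-concentration zero t _ M f g H
    rewrite ∫-binomial-zero f | ∫-binomial-zero g | *-identityʳ M =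
    subst (λ s → f 0ℤ * g 0ℤ * q ^ s ≤ M * suc q ^ s) (lemma p t) (H 0ℤ 0ℤ)
    where
    lemma : ∀ p t → p * (0 * 0) + t * (1 * 1) ≡ t + 0
    lemma = solve-∀
  binomial-concentration (suc r) t le M f g H
    rewrite ∫-binomial-suc r f | ∫-binomial-suc r g | ≡-sym (*-assoc M 4 (4 ^ r)) | +-suc t r =
    binomial-concentration r (suc t) le (M * 4) {{m*n≢0 M 4}} _ _ step
    where
    Bounded : ℕ → ℤ → ℤ → Set
    Bounded d x y = f x * g y * q ^ cost t d ≤ M * suc q ^ cost t d
    step : ∀ x y → (f (x ℤ.+ 1ℤ) + f (x ℤ.- 1ℤ)) * (g (y ℤ.+ 1ℤ) + g (y ℤ.- 1ℤ)) * q ^ cost (suc t) ℤ.∣ x ℤ.- y ∣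
                   ≤ M * 4 * suc q ^ cost (suc t) ℤ.∣ x ℤ.- y ∣
    step x y = subst (λ z → z * q ^ cost (suc t) d ≤ M * 4 * suc q ^ cost (suc t) d)
        (foil a a′ b b′)
        (bit-step {t} {d} {M} {a * b} {a′ * b′} {a * b′} {a′ * b} (≤-trans (m≤m+n t r) (<⇒≤ le))
          (exactly (x ℤ.+ 1ℤ) (y ℤ.+ 1ℤ) (diag₁ x y)) (exactly (x ℤ.- 1ℤ) (y ℤ.- 1ℤ) (diag₂ x y))
          (within (x ℤ.+ 1ℤ) (y ℤ.- 1ℤ) (ℤ.+ 2) (off₁ x y) refl) (within (x ℤ.- 1ℤ) (y ℤ.+ 1ℤ) (ℤ.-[1+ 1 ]) (off₂ x y) refl)
          (cross a a′ b b′))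
      where
      d = ℤ.∣ x ℤ.- y ∣
      a = f (x ℤ.+ 1ℤ)
      a′ = f (x ℤ.- 1ℤ)
      b = g (y ℤ.+ 1ℤ)
      b′ = g (y ℤ.- 1ℤ)
      exactly : ∀ x′ y′ → x′ ℤ.- y′ ≡ x ℤ.- y → Bounded d x′ y′
      exactly x′ y′ eq = subst (λ z → Bounded ℤ.∣ z ∣ x′ y′) eq (H x′ y′)
      within : ∀ x′ y′ s → x′ ℤ.- y′ ≡ s ℤ.+ (x ℤ.- y) → ℤ.∣ s ∣ ≡ 2 → Bounded (2 + d) x′ y′
      within x′ y′ s eq ∣s∣ = weaken {f x′ * g y′} {M} (cost-mono t (begin
        ℤ.∣ x′ ℤ.- y′ ∣            ≡⟨ cong ℤ.∣_∣ eq ⟩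
        ℤ.∣ s ℤ.+ (x ℤ.- y) ∣      ≤⟨ ℤP.∣i+j∣≤∣i∣+∣j∣ s (x ℤ.- y) ⟩
        ℤ.∣ s ∣ + d                ≡⟨ cong (_+ d) ∣s∣ ⟩
        2 + d                      ∎)) (H x′ y′)
        where open ≤-Reasoning
      diag₁ : ∀ x y → x ℤ.+ 1ℤ ℤ.- (y ℤ.+ 1ℤ) ≡ x ℤ.- y
      diag₁ = ℤSolver.solve-∀
      diag₂ : ∀ x y → x ℤ.- 1ℤ ℤ.- (y ℤ.- 1ℤ) ≡ x ℤ.- y
      diag₂ = ℤSolver.solve-∀
      off₁ : ∀ x y → x ℤ.+ 1ℤ ℤ.- (y ℤ.- 1ℤ) ≡ ℤ.+ 2 ℤ.+ (x ℤ.- y)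
      off₁ = ℤSolver.solve-∀
      off₂ : ∀ x y → x ℤ.- 1ℤ ℤ.- (y ℤ.+ 1ℤ) ≡ ℤ.-[1+ 1 ] ℤ.+ (x ℤ.- y)
      off₂ = ℤSolver.solve-∀
      foil : ∀ a a′ b b′ → a * b + a′ * b′ + (a * b′ + a′ * b) ≡ (a + a′) * (b + b′)
      foil = solve-∀
      cross : ∀ a a′ b b′ → a * b′ * (a′ * b) ≡ a * b * (a′ * b′)
      cross = solve-∀

  -- Tensorisation. For fixed first coordinates x and y the factor ρ^(p|x - y|²) is moved into the
  -- constant; the inequality for the other coordinates is then the hypothesis of the
  -- one-dimensional one, applied to the partial integrals.
  concentration : ∀ h M .{{_ : NonZero M}} (f g : Vec ℤ h → ℕ) →
    (∀ x y → f x * g y * q ^ (p * dist² x y) ≤ M * suc q ^ (p * dist² x y)) →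
    ∫ (power (binomial p) h) f * ∫ (power (binomial p) h) g * q ^ (h * p) ≤ M * 4 ^ (h * p) * suc q ^ (h * p)
  concentration zero    M f g H = subst₂ _≤_
    (cong₂ (λ a b → a * b * 1) (unit (f [])) (unit (g []))) (cong (_* 1) (≡-sym (*-identityʳ M)))
    (subst (λ s → f [] * g [] * q ^ s ≤ M * suc q ^ s) (*-zeroʳ p) (H [] []))
    where
    unit : ∀ a → a ≡ 1 * a + 0
    unit = solve-∀
  concentration (suc h) M {{M≢0}} f g H
    rewrite ∫-power-suc (binomial p) h f | ∫-power-suc (binomial p) h g = begin
    ∫ μ F * ∫ μ G * q ^ (p + h * p)              ≡⟨ cong (∫ μ F * ∫ μ G *_) (^-distribˡ-+-* q p (h * p)) ⟩
    ∫ μ F * ∫ μ G * (q ^ p * qʰ)                 ≡⟨ lemma₁ (∫ μ F) (∫ μ G) (q ^ p) qʰ ⟩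
    ∫ μ F * qʰ * ∫ μ G * q ^ p                   ≡⟨ cong (λ s → s * ∫ μ G * q ^ p) (≡-sym (∫-*ʳ μ qʰ F)) ⟩
    ∫ μ (λ z → F z * qʰ) * ∫ μ G * q ^ p         ≤⟨ binomial-concentration p 0 ≤-refl (M * 4ʰ * Qʰ) {{nz}} _ G outer ⟩
    M * 4ʰ * Qʰ * 4 ^ p * suc q ^ p              ≡⟨ lemma₂ M 4ʰ Qʰ (4 ^ p) (suc q ^ p) ⟩
    M * (4 ^ p * 4ʰ) * (suc q ^ p * Qʰ)          ≡⟨ cong₂ (λ s t → M * s * t) (≡-sym (^-distribˡ-+-* 4 p (h * p))) (≡-sym (^-distribˡ-+-* (suc q) p (h * p))) ⟩
    M * 4 ^ (p + h * p) * suc q ^ (p + h * p)    ∎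
    where
    open ≤-Reasoning
    μ = binomial p
    ν = power (binomial p) h
    F = λ z → ∫ ν (λ v → f (z ∷ v))
    G = λ z → ∫ ν (λ v → g (z ∷ v))
    qʰ = q ^ (h * p)
    4ʰ = 4 ^ (h * p)
    Qʰ = suc q ^ (h * p)
    nz : NonZero (M * 4ʰ * Qʰ)
    nz = m*n≢0 (M * 4ʰ) Qʰ {{m*n≢0 M 4ʰ {{M≢0}} {{m^n≢0 4 (h * p)}}}} {{m^n≢0 (suc q) (h * p)}}
    lemma₁ : ∀ a b c d → a * b * (c * d) ≡ a * d * b * c
    lemma₁ = solve-∀
    lemma₂ : ∀ M a b c d → M * a * b * c * d ≡ M * (c * a) * (d * b)
    lemma₂ = solve-∀
    outer : ∀ x y → F x * qʰ * G y * q ^ cost 0 ℤ.∣ x ℤ.- y ∣ ≤ M * 4ʰ * Qʰ * suc q ^ cost 0 ℤ.∣ x ℤ.- y ∣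
    outer x y = subst (λ s → F x * qʰ * G y * q ^ s ≤ M * 4ʰ * Qʰ * suc q ^ s) (≡-sym (+-identityʳ (p * d²))) (begin
      F x * qʰ * G y * qᵈ                       ≡⟨ lemma₃ (F x) qʰ (G y) qᵈ ⟩
      F x * qᵈ * G y * qʰ                       ≡⟨ cong (λ s → s * G y * qʰ) (≡-sym (∫-*ʳ ν qᵈ _)) ⟩
      ∫ ν (λ v → f (x ∷ v) * qᵈ) * G y * qʰ     ≤⟨ concentration h (M * Qᵈ) {{m*n≢0 M Qᵈ {{M≢0}} {{m^n≢0 (suc q) (p * d²)}}}} (λ v → f (x ∷ v) * qᵈ) (λ w → g (y ∷ w)) inner ⟩
      M * Qᵈ * 4ʰ * Qʰ                          ≡⟨ lemma₄ M Qᵈ 4ʰ Qʰ ⟩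
      M * 4ʰ * Qʰ * Qᵈ                          ∎)
      where
      d² = ℤ.∣ x ℤ.- y ∣ * ℤ.∣ x ℤ.- y ∣
      qᵈ = q ^ (p * d²)
      Qᵈ = suc q ^ (p * d²)
      lemma₃ : ∀ a b c d → a * b * c * d ≡ a * d * c * b
      lemma₃ = solve-∀
      lemma₄ : ∀ M a b c → M * a * b * c ≡ M * b * c * a
      lemma₄ = solve-∀
      inner : ∀ v w → f (x ∷ v) * qᵈ * g (y ∷ w) * q ^ (p * dist² v w) ≤ M * Qᵈ * suc q ^ (p * dist² v w)
      inner v w = subst₂ _≤_
        (trans (cong (f (x ∷ v) * g (y ∷ w) *_) (split q)) (lemma₅ (f (x ∷ v)) (g (y ∷ w)) qᵈ (q ^ (p * dist² v w))))
        (trans (cong (M *_) (split (suc q))) (≡-sym (*-assoc M Qᵈ (suc q ^ (p * dist² v w)))))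
        (H (x ∷ v) (y ∷ w))
        where
        split : ∀ b → b ^ (p * (d² + dist² v w)) ≡ b ^ (p * d²) * b ^ (p * dist² v w)
        split b = trans (cong (b ^_) (*-distribˡ-+ p d² _)) (^-distribˡ-+-* b (p * d²) _)
        lemma₅ : ∀ a b c d → a * b * (c * d) ≡ a * c * b * d
        lemma₅ = solve-∀


-- The Littlewood–Offord problem

-- walks n s counts the ±1 walks of length n from s that stay positive.
walks : ℕ → ℕ → ℕ
walks zero    zero    = 0
walks zero    (suc s) = 1
walks (suc n) zero    = 0
walks (suc n) (suc s) = walks n (suc (suc s)) + walks n s

-- The increment of `walks` in s. The rule at 0 is the general one with the value at -1 set equal to
-- the value at 0, a reflection.
walkDiff : ℕ → ℕ → ℕ
walkDiff zero    zero    = 1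
walkDiff zero    (suc s) = 0
walkDiff (suc n) zero    = walkDiff n 1 + walkDiff n 0
walkDiff (suc n) (suc s) = walkDiff n (suc (suc s)) + walkDiff n s

walks-zero : ∀ n → walks n 0 ≡ 0
walks-zero zero    = refl
walks-zero (suc n) = refl

walks-suc : ∀ n s → walks n (suc s) ≡ walks n s + walkDiff n s
walks-suc zero    zero    = refl
walks-suc zero    (suc s) = refl
walks-suc (suc n) zero
  rewrite walks-suc n 1 | walks-suc n 0 | walks-zero n = trans (+-identityʳ _) (+-comm (walkDiff n 0) _)
walks-suc (suc n) (suc s)
  rewrite walks-suc n (suc (suc s)) | walks-suc n s =
  lemma (walks n (suc (suc s))) (walkDiff n (suc (suc s))) (walks n s) (walkDiff n s)
  where
  lemma : ∀ a b c d → a + b + (c + d) ≡ a + c + (b + d)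
  lemma = solve-∀

walkDiff-suc : ∀ n s → walkDiff n (suc s) ≤ walkDiff n s
walkDiff-suc zero    s       = z≤n
walkDiff-suc (suc n) zero    = +-monoˡ-≤ (walkDiff n 0) (walkDiff-suc n 1)
walkDiff-suc (suc n) (suc s) = +-mono-≤ (walkDiff-suc n (suc (suc s))) (walkDiff-suc n s)

-- `walks n` is concave in s and vanishes at 0, so its first increment dominates all others.
walks-linear : ∀ n s → walks n s ≤ s * walkDiff n 0
walks-linear n zero    = ≤-reflexive (walks-zero n)
walks-linear n (suc s) = begin
  walks n (suc s)                 ≡⟨ trans (walks-suc n s) (+-comm (walks n s) _) ⟩
  walkDiff n s + walks n s        ≤⟨ +-mono-≤ (antitone s) (walks-linear n s) ⟩
  walkDiff n 0 + s * walkDiff n 0 ∎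
  where
  open ≤-Reasoning
  antitone : ∀ s → walkDiff n s ≤ walkDiff n 0
  antitone zero    = ≤-refl
  antitone (suc s) = ≤-trans (walkDiff-suc n s) (antitone s)

nC0≡1 : ∀ n → n C 0 ≡ 1
nC0≡1 n = trans (nCk≡nC[n∸k] {0} {n} z≤n) (nCn≡1 n)

central-symmetry : ∀ n → suc (n + n) C n ≡ suc (n + n) C suc n
central-symmetry n = trans (nCk≡nC[n∸k] (m≤n⇒m≤1+n (m≤m+n n n))) (cong (suc (n + n) C_) (begin
  suc (n + n) ∸ n   ≡⟨ +-∸-assoc 1 (m≤m+n n n) ⟩
  suc (n + n ∸ n)   ≡⟨ cong suc (m+n∸m≡n n n) ⟩
  suc n             ∎))
  where open ≡-Reasoning

-- The disjunction says i = ⌈(n + s)/2⌉ and keeps both parities in one induction over Pascal's rule.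
-- At s = 0 with n odd the reflected term is moved into place by the symmetry of the row.
walkDiff-binomial : ∀ n s i → n + s ≡ i + i ⊎ suc (n + s) ≡ i + i → walkDiff n s ≡ n C i
walkDiff-binomial zero zero zero    _ = refl
walkDiff-binomial zero zero (suc i) (inj₂ eq) = case trans (suc-injective eq) (+-suc i i) of λ ()
walkDiff-binomial zero (suc s) zero    (inj₁ ())
walkDiff-binomial zero (suc s) zero    (inj₂ ())
walkDiff-binomial zero (suc s) (suc i) _ = ≡-sym (k>n⇒nCk≡0 {0} {suc i} (s≤s z≤n))
walkDiff-binomial (suc n) s zero (inj₁ ())
walkDiff-binomial (suc n) s zero (inj₂ ())
walkDiff-binomial (suc n) zero (suc i) (inj₁ eq)
  rewrite +-identityʳ n with refl ← trans (suc-injective eq) (+-suc i i) = begin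
  walkDiff n 1 + walkDiff n 0   ≡⟨ cong₂ _+_ (walkDiff-binomial n 1 (suc i) (inj₁ (trans (+-comm n 1) (cong suc (≡-sym (+-suc i i))))))
                                             (walkDiff-binomial n 0 (suc i) (inj₂ (cong suc (trans (+-identityʳ n) (≡-sym (+-suc i i)))))) ⟩
  n C suc i + n C suc i         ≡⟨ cong (_+ n C suc i) (≡-sym (central-symmetry i)) ⟩
  n C i + n C suc i             ≡⟨ nCk+nC[k+1]≡[n+1]C[k+1] n i ⟩
  suc n C suc i                 ∎
  where open ≡-Reasoning
walkDiff-binomial (suc n) zero (suc i) (inj₂ eq)
  rewrite +-identityʳ n with refl ← suc-injective (trans (suc-injective eq) (+-suc i i)) = begin
  walkDiff n 1 + walkDiff n 0   ≡⟨ cong₂ _+_ (walkDiff-binomial n 1 (suc i) (inj₂ (trans (cong suc (+-comm n 1)) (cong suc (≡-sym (+-suc i i))))))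
                                             (walkDiff-binomial n 0 i (inj₁ (+-identityʳ n))) ⟩
  n C suc i + n C i             ≡⟨ +-comm (n C suc i) _ ⟩
  n C i + n C suc i             ≡⟨ nCk+nC[k+1]≡[n+1]C[k+1] n i ⟩
  suc n C suc i                 ∎
  where open ≡-Reasoning
walkDiff-binomial (suc n) (suc s) (suc i) parity = begin
  walkDiff n (suc (suc s)) + walkDiff n s ≡⟨ cong₂ _+_ (walkDiff-binomial n (suc (suc s)) (suc i) (up parity)) (walkDiff-binomial n s i (down parity)) ⟩
  n C suc i + n C i             ≡⟨ +-comm (n C suc i) _ ⟩
  n C i + n C suc i             ≡⟨ nCk+nC[k+1]≡[n+1]C[k+1] n i ⟩
  suc n C suc i                 ∎
  where
  open ≡-Reasoning
  up : suc n + suc s ≡ suc i + suc i ⊎ suc (suc n + suc s) ≡ suc i + suc i →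
       n + suc (suc s) ≡ suc i + suc i ⊎ suc (n + suc (suc s)) ≡ suc i + suc i
  up (inj₁ eq) = inj₁ (trans (+-suc n (suc s)) eq)
  up (inj₂ eq) = inj₂ (trans (cong suc (+-suc n (suc s))) eq)
  down : suc n + suc s ≡ suc i + suc i ⊎ suc (suc n + suc s) ≡ suc i + suc i → n + s ≡ i + i ⊎ suc (n + s) ≡ i + i
  down (inj₁ eq) = inj₁ (suc-injective (trans (≡-sym (+-suc n s)) (trans (suc-injective eq) (+-suc i i))))
  down (inj₂ eq) = inj₂ (suc-injective (trans (cong suc (≡-sym (+-suc n s))) (trans (suc-injective eq) (+-suc i i))))

absorption : ∀ n k → suc k * (suc n C suc k) ≡ suc n * (n C k)
absorption zero    zero    = refl
absorption zero    (suc k)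
  rewrite k>n⇒nCk≡0 {1} {suc (suc k)} (s≤s (s≤s z≤n)) | k>n⇒nCk≡0 {0} {suc k} (s≤s z≤n) = *-zeroʳ (suc (suc k))
absorption (suc n) zero    = begin
  1 * (suc (suc n) C 1)                 ≡⟨ cong (1 *_) (≡-sym (nCk+nC[k+1]≡[n+1]C[k+1] (suc n) 0)) ⟩
  1 * (suc n C 0 + suc n C 1)           ≡⟨ *-distribˡ-+ 1 (suc n C 0) (suc n C 1) ⟩
  1 * (suc n C 0) + 1 * (suc n C 1)     ≡⟨ cong₂ (λ a b → 1 * a + b) (nC0≡1 (suc n)) (absorption n 0) ⟩
  1 + suc n * (n C 0)                   ≡⟨ cong (λ a → 1 + suc n * a) (nC0≡1 n) ⟩
  suc (suc n) * 1                       ≡⟨ cong (suc (suc n) *_) (≡-sym (nC0≡1 (suc n))) ⟩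
  suc (suc n) * (suc n C 0)             ∎
  where open ≡-Reasoning
absorption (suc n) (suc k) = begin
  suc (suc k) * (suc (suc n) C suc (suc k))
    ≡⟨ cong (suc (suc k) *_) (≡-sym (nCk+nC[k+1]≡[n+1]C[k+1] (suc n) (suc k))) ⟩
  suc (suc k) * (c + suc n C suc (suc k))               ≡⟨ lemma (suc k) c (suc n C suc (suc k)) ⟩
  c + (suc k * c + suc (suc k) * (suc n C suc (suc k))) ≡⟨ cong₂ (λ a b → c + (a + b)) (absorption n k) (absorption n (suc k)) ⟩
  c + (suc n * (n C k) + suc n * (n C suc k))           ≡⟨ cong (c +_) (≡-sym (*-distribˡ-+ (suc n) (n C k) _)) ⟩
  c + suc n * (n C k + n C suc k)                       ≡⟨ cong (λ a → c + suc n * a) (nCk+nC[k+1]≡[n+1]C[k+1] n k) ⟩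
  suc (suc n) * c                                       ∎
  where
  open ≡-Reasoning
  c = suc n C suc k
  lemma : ∀ k c d → suc k * (c + d) ≡ c + (k * c + suc k * d)
  lemma = solve-∀

central-ratio : ∀ n → suc n * ((suc n + suc n) C suc n) ≡ 2 * suc (n + n) * ((n + n) C n)
central-ratio n = begin
  suc n * ((suc n + suc n) C suc n)                    ≡⟨ cong (λ a → suc n * (suc a C suc n)) (+-suc n n) ⟩
  suc n * (suc (suc (n + n)) C suc n)                  ≡⟨ cong (suc n *_) (≡-sym (nCk+nC[k+1]≡[n+1]C[k+1] (suc (n + n)) n)) ⟩
  suc n * (suc (n + n) C n + c)                        ≡⟨ cong (λ a → suc n * (a + c)) (central-symmetry n) ⟩
  suc n * (c + c)                                      ≡⟨ lemma (suc n) c ⟩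
  2 * (suc n * c)                                      ≡⟨ cong (2 *_) (absorption (n + n) n) ⟩
  2 * (suc (n + n) * ((n + n) C n))                    ≡⟨ ≡-sym (*-assoc 2 (suc (n + n)) _) ⟩
  2 * suc (n + n) * ((n + n) C n)                      ∎
  where
  open ≡-Reasoning
  c = suc (n + n) C suc n
  lemma : ∀ a c → a * (c + c) ≡ 2 * (a * c)
  lemma = solve-∀

-- By `central-ratio` the quotient of consecutive values of C(2n , n)² (2n + 1) / 16^n is (2n +
-- 1)(2n + 3) / (2n + 2)² < 1.
central-bound : ∀ n → ((n + n) C n) * ((n + n) C n) * suc (n + n) ≤ 16 ^ n
central-bound zero    = ≤-refl
central-bound (suc n) = *-cancelˡ-≤ (suc n * suc n) (begin
  suc n * suc n * (c′ * c′ * suc (suc n + suc n))                   ≡⟨ lemma₁ (suc n) c′ _ ⟩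
  (suc n * c′) * (suc n * c′) * suc (suc n + suc n)                 ≡⟨ cong (λ a → a * a * suc (suc n + suc n)) (central-ratio n) ⟩
  (2 * suc (n + n) * c) * (2 * suc (n + n) * c) * suc (suc n + suc n) ≤⟨ m≤m+n _ (4 * (suc (n + n) * c * c)) ⟩
  (2 * suc (n + n) * c) * (2 * suc (n + n) * c) * suc (suc n + suc n) + 4 * (suc (n + n) * c * c)
                                                                    ≡⟨ lemma₂ n c ⟩
  16 * (suc n * suc n) * (c * c * suc (n + n))                      ≤⟨ *-monoʳ-≤ (16 * (suc n * suc n)) (central-bound n) ⟩
  16 * (suc n * suc n) * 16 ^ n                                     ≡⟨ lemma₃ (suc n * suc n) (16 ^ n) ⟩
  suc n * suc n * (16 * 16 ^ n)                                     ∎)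
  where
  open ≤-Reasoning
  c = (n + n) C n
  c′ = (suc n + suc n) C suc n
  lemma₁ : ∀ a c d → a * a * (c * c * d) ≡ (a * c) * (a * c) * d
  lemma₁ = solve-∀
  lemma₂ : ∀ n c → (2 * suc (n + n) * c) * (2 * suc (n + n) * c) * suc (suc n + suc n) + 4 * (suc (n + n) * c * c)
           ≡ 16 * (suc n * suc n) * (c * c * suc (n + n))
  lemma₂ = solve-∀
  lemma₃ : ∀ a b → 16 * a * b ≡ a * (16 * b)
  lemma₃ = solve-∀

walks-bound : ∀ n s → walks (n + n) s * walks (n + n) s * (n + n) ≤ s * s * 4 ^ (n + n)
walks-bound n s = begin
  walks (n + n) s * walks (n + n) s * (n + n)  ≤⟨ *-mono-≤ (*-mono-≤ linear linear) (n≤1+n (n + n)) ⟩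
  s * c * (s * c) * suc (n + n)                ≡⟨ lemma s c (suc (n + n)) ⟩
  s * s * (c * c * suc (n + n))                ≤⟨ *-monoʳ-≤ (s * s) (central-bound n) ⟩
  s * s * 16 ^ n                               ≡⟨ cong (s * s *_) (trans (^-*-assoc 4 2 n) (cong (λ a → 4 ^ (n + a)) (+-identityʳ n))) ⟩
  s * s * 4 ^ (n + n)                          ∎
  where
  open ≤-Reasoning
  c = (n + n) C n
  linear : walks (n + n) s ≤ s * c
  linear = subst (λ a → walks (n + n) s ≤ s * a) (walkDiff-binomial (n + n) 0 n (inj₁ (+-identityʳ (n + n)))) (walks-linear (n + n) s)
  lemma : ∀ s c d → s * c * (s * c) * d ≡ s * s * (c * c * d)
  lemma = solve-∀


𝟙 : Bool → ℕ
𝟙 b = if b then 1 else 0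

𝟙≤1 : ∀ b → 𝟙 b ≤ 1
𝟙≤1 false = z≤n
𝟙≤1 true  = ≤-refl

inner : ∀ {h} → Vec ℤ h → Vec ℤ h → ℤ
inner []       []       = 0ℤ
inner (x ∷ xs) (y ∷ ys) = x ℤ.* y ℤ.+ inner xs ys

module LittlewoodOfford (a : ℕ) where

  hit : ℤ → ℤ → ℕ
  hit c z = 𝟙 (does (c ℤ.≤? z) ∧ does (z ℤ.<? c ℤ.+ ℤ.+ (2 * a)))

  -- Left endpoints of disjoint intervals of length 2a in descending order, so that the head of the
  -- list is the topmost interval.
  Sparse : List ℤ → Set
  Sparse = AllPairs (λ c c′ → c′ ℤ.+ ℤ.+ (2 * a) ℤ.≤ c)

  -- Here v c is meant to count the sign patterns whose sum lies in [ c , c + 2a ),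
  -- for n coefficients of size at least a and r arbitrary ones.
  Spread : (ℤ → ℕ) → ℕ → ℕ → Set
  Spread v r n = ∀ cs → Sparse cs → sum (map v cs) ≤ 2 ^ r * walks n (length cs)

  hit-shift : ∀ c w s → hit c (w ℤ.+ s) ≡ hit (c ℤ.- w) s
  hit-shift c w s = cong₂ (λ a b → 𝟙 (a ∧ b))
    (does-⇔ (mk⇔ (λ le → subst (c ℤ.- w ℤ.≤_) (e₁ w s) (ℤP.+-monoˡ-≤ (ℤ.- w) le))
                 (λ le → subst (ℤ._≤ w ℤ.+ s) (e₂ c w) (ℤP.+-monoʳ-≤ w le)))
            (c ℤ.≤? w ℤ.+ s) (c ℤ.- w ℤ.≤? s))
    (does-⇔ (mk⇔ (λ lt → subst₂ ℤ._<_ (e₁ w s) (e₃ c w (ℤ.+ (2 * a))) (ℤP.+-monoˡ-< (ℤ.- w) lt))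
                 (λ lt → subst (w ℤ.+ s ℤ.<_) (e₄ c w (ℤ.+ (2 * a))) (ℤP.+-monoʳ-< w lt)))
            (w ℤ.+ s ℤ.<? c ℤ.+ ℤ.+ (2 * a)) (s ℤ.<? c ℤ.- w ℤ.+ ℤ.+ (2 * a)))
    where
    e₁ : ∀ w s → w ℤ.+ s ℤ.- w ≡ s
    e₁ = ℤSolver.solve-∀
    e₂ : ∀ c w → w ℤ.+ (c ℤ.- w) ≡ c
    e₂ = ℤSolver.solve-∀
    e₃ : ∀ c w t → c ℤ.+ t ℤ.- w ≡ c ℤ.- w ℤ.+ t
    e₃ = ℤSolver.solve-∀
    e₄ : ∀ c w t → w ℤ.+ (c ℤ.- w ℤ.+ t) ≡ c ℤ.+ t
    e₄ = ℤSolver.solve-∀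

  hit-above : ∀ {c z} → c ℤ.+ ℤ.+ (2 * a) ℤ.≤ z → hit c z ≡ 0
  hit-above {c} {z} le
    rewrite dec-false (z ℤ.<? c ℤ.+ ℤ.+ (2 * a)) (ℤP.≤⇒≯ le) with does (c ℤ.≤? z)
  ... | true  = refl
  ... | false = refl

  spread-hit : ∀ z → Spread (λ c → hit c z) 0 0
  spread-hit z []       []         = z≤n
  spread-hit z (c ∷ cs) (gaps ∷ sparse) with c ℤ.≤? z
  ... | yes c≤z = +-mono-≤ (𝟙≤1 _) (≤-reflexive (vanish cs gaps))
    where
    vanish : ∀ cs → All (λ c′ → c′ ℤ.+ ℤ.+ (2 * a) ℤ.≤ c) cs → sum (map (λ c → hit c z) cs) ≡ 0
    vanish []       []         = refl
    vanish (c ∷ cs) (gap ∷ gaps) = cong₂ _+_ (hit-above {c} (ℤP.≤-trans gap c≤z)) (vanish cs gaps)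
  ... | no _    = ≤-trans (spread-hit z cs sparse) (at-most-one (length cs))
    where
    at-most-one : ∀ s → 1 * walks 0 s ≤ 1
    at-most-one zero    = z≤n
    at-most-one (suc s) = ≤-refl

  spread-cong : ∀ {v w r n} → (∀ c → v c ≡ w c) → Spread v r n → Spread w r n
  spread-cong eq S cs sparse = subst (_≤ _) (cong sum (map-cong eq cs)) (S cs sparse)

  sparse-shift : ∀ t {cs} → Sparse cs → Sparse (map (ℤ._+ t) cs)
  sparse-shift t sparse = AllPairsP.map⁺ (AllPairs.map (λ {c} {c′} le →
    subst (ℤ._≤ c ℤ.+ t) (swap c′ t _) (ℤP.+-monoˡ-≤ t le)) sparse)
    where
    swap : ∀ c t s → c ℤ.+ s ℤ.+ t ≡ c ℤ.+ t ℤ.+ s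
    swap = ℤSolver.solve-∀

  sum-map-+ : ∀ (v w : ℤ → ℕ) cs → sum (map (λ c → v c + w c) cs) ≡ sum (map v cs) + sum (map w cs)
  sum-map-+ v w []       = refl
  sum-map-+ v w (c ∷ cs) rewrite sum-map-+ v w cs = lemma (v c) (w c) (sum (map v cs)) (sum (map w cs))
    where
    lemma : ∀ a b c d → a + b + (c + d) ≡ a + c + (b + d)
    lemma = solve-∀

  sum-shift : ∀ (v : ℤ → ℕ) t cs → sum (map (λ c → v (c ℤ.+ t)) cs) ≡ sum (map v (map (ℤ._+ t) cs))
  sum-shift v t cs = cong sum (map-∘ cs)

  -- Kleitman's trick: the topmost interval of the family shifted up
  -- is moved to the family shifted down, leaving families of sizes s + 1 and s − 1.
  spread-large : ∀ {v r n b} → a ≤ b → Spread v r n → Spread (λ c → v (c ℤ.- ℤ.+ b) + v (c ℤ.+ ℤ.+ b)) r (suc n)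
  spread-large                     _   S []       []              = z≤n
  spread-large {v} {r} {n} {b} a≤b S (c ∷ cs) (gaps ∷ sparse) = begin
    v (c ℤ.- β) + v (c ℤ.+ β) + sum (map (λ c → v (c ℤ.- β) + v (c ℤ.+ β)) cs)
      ≡⟨ cong (v (c ℤ.- β) + v (c ℤ.+ β) +_) (trans (sum-map-+ _ _ cs) (cong₂ _+_ (sum-shift v (ℤ.- β) cs) (sum-shift v β cs))) ⟩
    v (c ℤ.- β) + v (c ℤ.+ β) + (sum (map v down) + sum (map v up))
      ≡⟨ lemma (v (c ℤ.- β)) (v (c ℤ.+ β)) (sum (map v down)) (sum (map v up)) ⟩
    sum (map v (c ℤ.+ β ∷ c ℤ.- β ∷ down)) + sum (map v up)
      ≤⟨ +-mono-≤ (S _ (top ∷ sparse-shift (ℤ.- β) (gaps ∷ sparse))) (S up (sparse-shift β sparse)) ⟩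
    2 ^ r * walks n (suc (suc (length down))) + 2 ^ r * walks n (length up)
      ≡⟨ cong₂ (λ i j → 2 ^ r * walks n (suc (suc i)) + 2 ^ r * walks n j) (length-map _ cs) (length-map _ cs) ⟩
    2 ^ r * walks n (suc (suc (length cs))) + 2 ^ r * walks n (length cs)
      ≡⟨ ≡-sym (*-distribˡ-+ (2 ^ r) (walks n (suc (suc (length cs)))) _) ⟩
    2 ^ r * walks (suc n) (suc (length cs)) ∎
    where
    open ≤-Reasoning
    β = ℤ.+ b
    down = map (ℤ._- β) cs
    up = map (ℤ._+ β) cs
    lemma : ∀ a b c d → a + b + (c + d) ≡ b + (a + c) + d
    lemma = solve-∀
    c-β+2a≤c+β : c ℤ.- β ℤ.+ ℤ.+ (2 * a) ℤ.≤ c ℤ.+ β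
    c-β+2a≤c+β = subst (c ℤ.- β ℤ.+ ℤ.+ (2 * a) ℤ.≤_) (e c β)
      (ℤP.+-monoʳ-≤ (c ℤ.- β) (ℤP.≤-trans (ℤ.+≤+ (*-monoʳ-≤ 2 a≤b)) (ℤP.≤-reflexive (ℤP.pos-* 2 b))))
      where
      e : ∀ c β → c ℤ.- β ℤ.+ ℤ.+ 2 ℤ.* β ≡ c ℤ.+ β
      e = ℤSolver.solve-∀
    c≤c+2a : ∀ c → c ℤ.≤ c ℤ.+ ℤ.+ (2 * a)
    c≤c+2a c = ℤP.i≤i+j c (ℤ.+ (2 * a))
    top : All (λ c′ → c′ ℤ.+ ℤ.+ (2 * a) ℤ.≤ c ℤ.+ β) (c ℤ.- β ∷ down)
    top = c-β+2a≤c+β ∷ AllP.map⁺ (All.map (λ {c′} gap → ℤP.≤-trans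
      (ℤP.+-monoˡ-≤ (ℤ.+ (2 * a)) (ℤP.+-monoˡ-≤ (ℤ.- β) (ℤP.≤-trans (c≤c+2a c′) gap))) c-β+2a≤c+β) gaps)

  spread-coefficient : ∀ {v r n} y → a ≤ ℤ.∣ y ∣ → Spread v r n → Spread (λ c → v (c ℤ.- y) + v (c ℤ.+ y)) r (suc n)
  spread-coefficient {v} {r} {n} (ℤ.+ b)    a≤b S = spread-large {v} {r} {n} a≤b S
  spread-coefficient {v} {r} {n} ℤ.-[1+ b ] a≤b S = spread-cong {r = r} {suc n}
    (λ c → +-comm (v (c ℤ.- ℤ.+ suc b)) _) (spread-large {v} {r} {n} a≤b S)

  spread-trivial : ∀ {v r n} y → Spread v r n → Spread (λ c → v (c ℤ.- y) + v (c ℤ.+ y)) (suc r) n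
  spread-trivial {v} {r} {n} y S cs sparse = begin
    sum (map (λ c → v (c ℤ.- y) + v (c ℤ.+ y)) cs)      ≡⟨ trans (sum-map-+ _ _ cs) (cong₂ _+_ (sum-shift v (ℤ.- y) cs) (sum-shift v y cs)) ⟩
    sum (map v down) + sum (map v up)                   ≤⟨ +-mono-≤ (S down (sparse-shift (ℤ.- y) sparse)) (S up (sparse-shift y sparse)) ⟩
    2 ^ r * walks n (length down) + 2 ^ r * walks n (length up)
                                                        ≡⟨ cong₂ (λ i j → 2 ^ r * walks n i + 2 ^ r * walks n j) (length-map _ cs) (length-map _ cs) ⟩
    2 ^ r * walks n (length cs) + 2 ^ r * walks n (length cs)
                                                        ≡⟨ lemma (2 ^ r) (walks n (length cs)) ⟩
    2 ^ suc r * walks n (length cs)                     ∎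
    where
    open ≤-Reasoning
    down = map (ℤ._- y) cs
    up = map (ℤ._+ y) cs
    lemma : ∀ a b → a * b + a * b ≡ 2 * a * b
    lemma = solve-∀

  -- The effect of one further coordinate z with coefficient y: adding y z to the sum amounts to
  -- moving the interval by -y z.
  Smoothed : ℕ → (ℤ → ℕ) → ℤ → ℤ → ℕ
  Smoothed q v y c = ∫ (binomial q) (λ z → v (c ℤ.- y ℤ.* z))

  smoothed-zero : ∀ v y c → v c ≡ Smoothed 0 v y c
  smoothed-zero v y c = ≡-sym (trans (∫-binomial-zero (λ z → v (c ℤ.- y ℤ.* z))) (cong v (e c y)))
    where
    e : ∀ c y → c ℤ.- y ℤ.* 0ℤ ≡ c
    e = ℤSolver.solve-∀

  smoothed-suc : ∀ q v y c → Smoothed q (λ c → v (c ℤ.- y) + v (c ℤ.+ y)) y c ≡ Smoothed (suc q) v y c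
  smoothed-suc q v y c = ≡-sym (trans (∫-binomial-suc q _)
    (∫-cong (binomial q) (λ z → cong₂ (λ a b → v a + v b) (e₁ c y z) (e₂ c y z))))
    where
    e₁ : ∀ c y z → c ℤ.- y ℤ.* (z ℤ.+ 1ℤ) ≡ c ℤ.- y ℤ.* z ℤ.- y
    e₁ = ℤSolver.solve-∀
    e₂ : ∀ c y z → c ℤ.- y ℤ.* (z ℤ.- 1ℤ) ≡ c ℤ.- y ℤ.* z ℤ.+ y
    e₂ = ℤSolver.solve-∀

  spread-smoothed : ∀ q {v r n} y → a ≤ ℤ.∣ y ∣ → Spread v r n → Spread (Smoothed q v y) r (q + n)
  spread-smoothed zero    {v} {r} {n} y le S = spread-cong {r = r} {n} (smoothed-zero v y) S
  spread-smoothed (suc q) {v} {r} {n} y le S = spread-cong {r = r} {suc q + n} (smoothed-suc q v y)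
    (subst (Spread (Smoothed q v′ y) r) (+-suc q n) (spread-smoothed q {v′} {r} {suc n} y le (spread-coefficient {v} {r} {n} y le S)))
    where
    v′ = λ c → v (c ℤ.- y) + v (c ℤ.+ y)

  spread-smoothed-trivial : ∀ q {v r n} y → Spread v r n → Spread (Smoothed q v y) (q + r) n
  spread-smoothed-trivial zero    {v} {r} {n} y S = spread-cong {r = r} {n} (smoothed-zero v y) S
  spread-smoothed-trivial (suc q) {v} {r} {n} y S = spread-cong {r = suc q + r} {n} (smoothed-suc q v y)
    (subst (λ s → Spread (Smoothed q v′ y) s n) (+-suc q r) (spread-smoothed-trivial q {v′} {suc r} {n} y (spread-trivial {v} {r} {n} y S)))
    where
    v′ = λ c → v (c ℤ.- y) + v (c ℤ.+ y)

  isLarge : ℤ → Bool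
  isLarge z = a ≤ᵇ ℤ.∣ z ∣

  large small : ∀ {h} → Vec ℤ h → ℕ
  large []       = 0
  large (z ∷ zs) = (if isLarge z then 1 else 0) + large zs
  small []       = 0
  small (z ∷ zs) = (if isLarge z then 0 else 1) + small zs

  -- A binomial coordinate is a sum of p signs. With a large coefficient it supplies p steps of the
  -- walk; with a small one it only multiplies the count by 2^p.
  spread-inner : ∀ p {h} (y : Vec ℤ h) →
    Spread (λ c → ∫ (power (binomial p) h) (λ x → hit c (inner y x))) (small y * p) (large y * p)
  spread-inner p []       = spread-cong {r = 0} {0} (λ c → ≡-sym (trans (+-identityʳ (1 * hit c 0ℤ)) (+-identityʳ _))) (spread-hit 0ℤ)
  spread-inner p {suc h} (y ∷ ys) = spread-cong {r = small (y ∷ ys) * p} {large (y ∷ ys) * p} shifted smoothed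
    where
    v : ℤ → ℕ
    v c = ∫ (power (binomial p) h) (λ x → hit c (inner ys x))
    shifted : ∀ c → Smoothed p v y c ≡ ∫ (power (binomial p) (suc h)) (λ x → hit c (inner (y ∷ ys) x))
    shifted c = ≡-sym (trans (∫-power-suc (binomial p) h _)
      (∫-cong (binomial p) (λ z → ∫-cong (power (binomial p) h) (λ x → hit-shift c (y ℤ.* z) (inner ys x)))))
    smoothed : Spread (Smoothed p v y) (small (y ∷ ys) * p) (large (y ∷ ys) * p)
    smoothed with isLarge y in eq
    ... | true  = spread-smoothed p {v} {small ys * p} {large ys * p} y (≤ᵇ⇒≤ a _ (subst IsTrue (≡-sym eq) tt)) (spread-inner p ys)
    ... | false = spread-smoothed-trivial p {v} {small ys * p} {large ys * p} y (spread-inner p ys)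

  cover : ℤ → ℕ → List ℤ
  cover c zero    = []
  cover c (suc s) = c ℤ.+ ℤ.+ (2 * a * s) ∷ cover c s

  length-cover : ∀ c s → length (cover c s) ≡ s
  length-cover c zero    = refl
  length-cover c (suc s) = cong suc (length-cover c s)

  step-≤ : ∀ c {i s} → i < s → c ℤ.+ ℤ.+ (2 * a * i) ℤ.+ ℤ.+ (2 * a) ℤ.≤ c ℤ.+ ℤ.+ (2 * a * s)
  step-≤ c {i} {s} i<s = subst (ℤ._≤ c ℤ.+ ℤ.+ (2 * a * s)) (≡-sym (ℤP.+-assoc c (ℤ.+ (2 * a * i)) (ℤ.+ (2 * a))))
    (ℤP.+-monoʳ-≤ c (ℤ.+≤+ (begin
      2 * a * i + 2 * a ≡⟨ trans (+-comm (2 * a * i) (2 * a)) (≡-sym (*-suc (2 * a) i)) ⟩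
      2 * a * suc i     ≤⟨ *-monoʳ-≤ (2 * a) i<s ⟩
      2 * a * s         ∎)))
    where open ≤-Reasoning

  sparse-cover : ∀ c s → Sparse (cover c s)
  sparse-cover c zero    = []
  sparse-cover c (suc s) = below s ≤-refl ∷ sparse-cover c s
    where
    below : ∀ i → i ≤ s → All (λ c′ → c′ ℤ.+ ℤ.+ (2 * a) ℤ.≤ c ℤ.+ ℤ.+ (2 * a * s)) (cover c i)
    below zero    _   = []
    below (suc i) i<s = step-≤ c i<s ∷ below i (<⇒≤ i<s)

  hit-inside : ∀ {c z} → c ℤ.≤ z → z ℤ.< c ℤ.+ ℤ.+ (2 * a) → hit c z ≡ 1
  hit-inside {c} {z} c≤z z<
    rewrite dec-true (c ℤ.≤? z) c≤z | dec-true (z ℤ.<? c ℤ.+ ℤ.+ (2 * a)) z< = refl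

  covered : ∀ c s z → c ℤ.≤ z → z ℤ.< c ℤ.+ ℤ.+ (2 * a * s) → 1 ≤ sum (map (λ c′ → hit c′ z) (cover c s))
  covered c zero    z c≤z z<c = ⊥-elim (ℤP.<⇒≱ z<c (ℤP.≤-trans (ℤP.≤-reflexive
    (trans (cong (λ i → c ℤ.+ ℤ.+ i) (*-zeroʳ (2 * a))) (ℤP.+-identityʳ c))) c≤z))
  covered c (suc s) z c≤z z<c = split (c ℤ.+ ℤ.+ (2 * a * s) ℤ.≤? z)
    where
    z<top : z ℤ.< c ℤ.+ ℤ.+ (2 * a * s) ℤ.+ ℤ.+ (2 * a)
    z<top = subst (z ℤ.<_) (trans (cong (λ i → c ℤ.+ ℤ.+ i) (trans (*-suc (2 * a) s) (+-comm (2 * a) _)))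
      (≡-sym (ℤP.+-assoc c (ℤ.+ (2 * a * s)) (ℤ.+ (2 * a))))) z<c
    split : Dec (c ℤ.+ ℤ.+ (2 * a * s) ℤ.≤ z) → 1 ≤ sum (map (λ c′ → hit c′ z) (cover c (suc s)))
    split (yes top≤z) = ≤-trans (≤-reflexive (≡-sym (hit-inside top≤z z<top))) (m≤m+n _ _)
    split (no  top≰z) = ≤-trans (covered c s z c≤z (ℤP.≰⇒> top≰z)) (m≤n+m _ _)

  large+small : ∀ {h} (y : Vec ℤ h) → large y + small y ≡ h
  large+small []       = refl
  large+small (z ∷ zs) with isLarge z
  ... | true  = cong suc (large+small zs)
  ... | false = trans (+-suc (large zs) (small zs)) (cong suc (large+small zs))


-- Geometry of the discrete sphere

*-^ : ∀ m n h → (m * n) ^ h ≡ m ^ h * n ^ h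
*-^ m n zero    = refl
*-^ m n (suc h) rewrite *-^ m n h = lemma m n (m ^ h) (n ^ h)
  where
  lemma : ∀ m n a b → m * n * (a * b) ≡ m * a * (n * b)
  lemma = solve-∀

sum-∫ : (μ : Measure A) (f : B → A → ℕ) (cs : List B) →
        sum (map (λ c → ∫ μ (f c)) cs) ≡ ∫ μ (λ x → sum (map (λ c → f c x) cs))
sum-∫ μ f []       = ≡-sym (∫-0 μ)
sum-∫ μ f (c ∷ cs) = trans (cong (∫ μ (f c) +_) (sum-∫ μ f cs)) (≡-sym (∫-+ μ (f c) _))

sqr-ℤ : ∀ z → ℤ.+ sqr z ≡ z ℤ.* z
sqr-ℤ (ℤ.+ n)    = ℤP.pos-* n n
sqr-ℤ ℤ.-[1+ n ] = refl

sqr-nonneg : ∀ z → 0ℤ ℤ.≤ z ℤ.* z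
sqr-nonneg z = subst (0ℤ ℤ.≤_) (sqr-ℤ z) (ℤ.+≤+ z≤n)

i≤i+nonneg : ∀ i {j} → 0ℤ ℤ.≤ j → i ℤ.≤ i ℤ.+ j
i≤i+nonneg i {j} 0≤j = subst (ℤ._≤ i ℤ.+ j) (ℤP.+-identityʳ i) (ℤP.+-monoʳ-≤ i 0≤j)

norm² : ∀ {h} → Vec ℤ h → ℕ
norm² []       = 0
norm² (x ∷ xs) = sqr x + norm² xs

negate-involutive : ∀ {h} (x : Vec ℤ h) → negate (negate x) ≡ x
negate-involutive []       = refl
negate-involutive (x ∷ xs) = cong₂ _∷_ (ℤP.neg-involutive x) (negate-involutive xs)

inner-negate : ∀ {h} (x y : Vec ℤ h) → inner x (negate y) ≡ ℤ.- inner x y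
inner-negate []       []       = refl
inner-negate (x ∷ xs) (y ∷ ys) rewrite inner-negate xs ys = lemma x y (inner xs ys)
  where
  lemma : ∀ x y s → x ℤ.* (ℤ.- y) ℤ.+ ℤ.- s ≡ ℤ.- (x ℤ.* y ℤ.+ s)
  lemma = ℤSolver.solve-∀

dist²-negate-comm : ∀ {h} (x y : Vec ℤ h) → dist² x (negate y) ≡ dist² y (negate x)
dist²-negate-comm []       []       = refl
dist²-negate-comm (x ∷ xs) (y ∷ ys) = cong₂ (λ a b → sqr a + b) (lemma x y) (dist²-negate-comm xs ys)
  where
  lemma : ∀ x y → x ℤ.- ℤ.- y ≡ y ℤ.- ℤ.- x
  lemma = ℤSolver.solve-∀

-- 2x = (x + y) + (x + z) − (y + z)
norm²-≤-antipodal : ∀ {h} (x y z : Vec ℤ h) →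
  4 * norm² x ≤ 3 * (dist² x (negate y) + dist² x (negate z) + dist² y (negate z))
norm²-≤-antipodal []       []       []       = z≤n
norm²-≤-antipodal (x ∷ xs) (y ∷ ys) (z ∷ zs) = begin
  4 * (sqr x + norm² xs)                ≡⟨ *-distribˡ-+ 4 (sqr x) (norm² xs) ⟩
  4 * sqr x + 4 * norm² xs              ≤⟨ +-mono-≤ (ℤP.drop‿+≤+ pointwise) (norm²-≤-antipodal xs ys zs) ⟩
  3 * (s + t + w) + 3 * (S + T′ + W)    ≡⟨ lemma s t w S T′ W ⟩
  3 * (s + S + (t + T′) + (w + W))      ∎
  where
  open ≤-Reasoning
  s = sqr (x ℤ.- ℤ.- y)
  t = sqr (x ℤ.- ℤ.- z)
  w = sqr (y ℤ.- ℤ.- z)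
  S = dist² xs (negate ys)
  T′ = dist² xs (negate zs)
  W = dist² ys (negate zs)
  lemma : ∀ s t w S T W → 3 * (s + t + w) + 3 * (S + T + W) ≡ 3 * (s + S + (t + T) + (w + W))
  lemma = solve-∀
  -- Cauchy-Schwarz for A + B - C with A = x + y, B = x + z, C = y + z; the defect is (A - B)² + (A
  -- + C)² + (B + C)².
  identity : ∀ x y z → ℤ.+ 3 ℤ.* ((x ℤ.- ℤ.- y) ℤ.* (x ℤ.- ℤ.- y) ℤ.+ (x ℤ.- ℤ.- z) ℤ.* (x ℤ.- ℤ.- z) ℤ.+ (y ℤ.- ℤ.- z) ℤ.* (y ℤ.- ℤ.- z))
    ≡ ℤ.+ 4 ℤ.* (x ℤ.* x) ℤ.+ ((y ℤ.- z) ℤ.* (y ℤ.- z) ℤ.+ (x ℤ.+ ℤ.+ 2 ℤ.* y ℤ.+ z) ℤ.* (x ℤ.+ ℤ.+ 2 ℤ.* y ℤ.+ z)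
        ℤ.+ (x ℤ.+ y ℤ.+ ℤ.+ 2 ℤ.* z) ℤ.* (x ℤ.+ y ℤ.+ ℤ.+ 2 ℤ.* z))
  identity = ℤSolver.solve-∀
  cast : ℤ.+ (3 * (s + t + w)) ≡ ℤ.+ 3 ℤ.* ((x ℤ.- ℤ.- y) ℤ.* (x ℤ.- ℤ.- y) ℤ.+ (x ℤ.- ℤ.- z) ℤ.* (x ℤ.- ℤ.- z) ℤ.+ (y ℤ.- ℤ.- z) ℤ.* (y ℤ.- ℤ.- z))
  cast = trans (ℤP.pos-* 3 (s + t + w)) (cong (ℤ.+ 3 ℤ.*_)
    (cong₂ ℤ._+_ (cong₂ ℤ._+_ (sqr-ℤ (x ℤ.- ℤ.- y)) (sqr-ℤ (x ℤ.- ℤ.- z))) (sqr-ℤ (y ℤ.- ℤ.- z))))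
  pointwise : ℤ.+ (4 * sqr x) ℤ.≤ ℤ.+ (3 * (s + t + w))
  pointwise = subst₂ ℤ._≤_ (≡-sym (trans (ℤP.pos-* 4 (sqr x)) (cong (ℤ.+ 4 ℤ.*_) (sqr-ℤ x)))) (≡-sym (trans cast (identity x y z)))
    (i≤i+nonneg (ℤ.+ 4 ℤ.* (x ℤ.* x)) (
      (ℤP.+-mono-≤ (ℤP.+-mono-≤ (sqr-nonneg (y ℤ.- z)) (sqr-nonneg (x ℤ.+ ℤ.+ 2 ℤ.* y ℤ.+ z))) (sqr-nonneg (x ℤ.+ y ℤ.+ ℤ.+ 2 ℤ.* z)))))

-- 2 s t ≤ s² + t² in every coordinate, with s = x + x′ and t = y + y′.
inner-≤-antipodal : ∀ {h} (x x′ y y′ : Vec ℤ h) →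
  ℤ.+ 2 ℤ.* (inner x y ℤ.+ inner x y′ ℤ.+ (inner x′ y ℤ.+ inner x′ y′)) ℤ.≤ ℤ.+ (dist² x (negate x′) + dist² y (negate y′))
inner-≤-antipodal []       []         []       []         = ℤ.+≤+ z≤n
inner-≤-antipodal (x ∷ xs) (x′ ∷ xs′) (y ∷ ys) (y′ ∷ ys′) = begin
  ℤ.+ 2 ℤ.* (x ℤ.* y ℤ.+ a ℤ.+ (x ℤ.* y′ ℤ.+ b) ℤ.+ (x′ ℤ.* y ℤ.+ c ℤ.+ (x′ ℤ.* y′ ℤ.+ d)))
    ≡⟨ split x x′ y y′ a b c d ⟩
  ℤ.+ 2 ℤ.* (s ℤ.* t) ℤ.+ ℤ.+ 2 ℤ.* (a ℤ.+ b ℤ.+ (c ℤ.+ d))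
    ≤⟨ ℤP.+-mono-≤ am-gm (inner-≤-antipodal xs xs′ ys ys′) ⟩
  ℤ.+ (sqr s + sqr t) ℤ.+ ℤ.+ (X + Y)
    ≡⟨ cong ℤ.+_ (lemma (sqr s) (sqr t) X Y) ⟩
  ℤ.+ (sqr s + X + (sqr t + Y)) ∎
  where
  open ℤP.≤-Reasoning
  a = inner xs ys
  b = inner xs ys′
  c = inner xs′ ys
  d = inner xs′ ys′
  s = x ℤ.- ℤ.- x′
  t = y ℤ.- ℤ.- y′
  X = dist² xs (negate xs′)
  Y = dist² ys (negate ys′)
  split : ∀ x x′ y y′ a b c d →
    ℤ.+ 2 ℤ.* (x ℤ.* y ℤ.+ a ℤ.+ (x ℤ.* y′ ℤ.+ b) ℤ.+ (x′ ℤ.* y ℤ.+ c ℤ.+ (x′ ℤ.* y′ ℤ.+ d)))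
    ≡ ℤ.+ 2 ℤ.* ((x ℤ.- ℤ.- x′) ℤ.* (y ℤ.- ℤ.- y′)) ℤ.+ ℤ.+ 2 ℤ.* (a ℤ.+ b ℤ.+ (c ℤ.+ d))
  split = ℤSolver.solve-∀
  lemma : ∀ s t X Y → s + t + (X + Y) ≡ s + X + (t + Y)
  lemma = solve-∀
  complete : ∀ s t → s ℤ.* s ℤ.+ t ℤ.* t ≡ ℤ.+ 2 ℤ.* (s ℤ.* t) ℤ.+ (s ℤ.- t) ℤ.* (s ℤ.- t)
  complete = ℤSolver.solve-∀
  am-gm : ℤ.+ 2 ℤ.* (s ℤ.* t) ℤ.≤ ℤ.+ (sqr s + sqr t)
  am-gm = begin
    ℤ.+ 2 ℤ.* (s ℤ.* t)                                       ≤⟨ i≤i+nonneg _ (sqr-nonneg (s ℤ.- t)) ⟩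
    ℤ.+ 2 ℤ.* (s ℤ.* t) ℤ.+ (s ℤ.- t) ℤ.* (s ℤ.- t)           ≡⟨ ≡-sym (complete s t) ⟩
    s ℤ.* s ℤ.+ t ℤ.* t                                       ≡⟨ ≡-sym (cong₂ ℤ._+_ (sqr-ℤ s) (sqr-ℤ t)) ⟩
    ℤ.+ (sqr s + sqr t)                                       ∎

∧-true : ∀ {a b} → a ∧ b ≡ true → a ≡ true × b ≡ true
∧-true {true} {true} refl = refl , refl

true⇒≤ : ∀ {m n} → (m ≤ᵇ n) ≡ true → m ≤ n
true⇒≤ {m} eq = ≤ᵇ⇒≤ m _ (subst IsTrue (≡-sym eq) tt)

false⇒> : ∀ {m n} → (m ≤ᵇ n) ≡ false → n < m
false⇒> eq = ≰⇒> (λ le → subst IsTrue eq (≤⇒≤ᵇ le))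


abs<⇒bounds : ∀ {a} z → ℤ.∣ z ∣ < a → ℤ.- (ℤ.+ a) ℤ.≤ z × z ℤ.< ℤ.+ a
abs<⇒bounds (ℤ.+ n)    n<a = ℤP.≤-trans ℤP.neg-≤-pos (ℤ.+≤+ z≤n) , ℤ.+<+ n<a
abs<⇒bounds ℤ.-[1+ n ] n<a = ℤP.neg-mono-≤ (ℤ.+≤+ (<⇒≤ n<a)) , ℤ.-<+

-- A coordinate is large from a = √p / 4 on, and k is half the dimension. D is chosen to make p D =
-- q u, hence ρ^(pD) = (ρ^q)^u ≥ 2^u: this is the gain from concentration at squared distance D.
module Sphere (a k u p q D : ℕ) .{{a≢0 : NonZero a}} .{{p≢0 : NonZero p}} .{{q≢0 : NonZero q}}
  (p≡ : p ≡ 16 * (a * a)) (q≡ : q ≡ 576 * (p * p)) (D≡ : D ≡ p * (576 * u)) where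

  h : ℕ
  h = k + k

  open LittlewoodOfford a
  open Concentration p q q≡

  μ : Measure (Vec ℤ h)
  μ = power (binomial p) h

  H : ℕ
  H = mass μ

  H≡ : H ≡ (2 ^ p) ^ h
  H≡ = trans (mass-power (binomial p) h) (cong (_^ h) (mass-binomial p))

  H≢0 : NonZero H
  H≢0 = subst NonZero (≡-sym H≡) (m^n≢0 (2 ^ p) h {{m^n≢0 2 p}})

  H≡2^hp : H ≡ 2 ^ (h * p)
  H≡2^hp = trans H≡ (trans (^-*-assoc 2 p h) (cong (2 ^_) (*-comm p h)))

  4^hp≡H² : 4 ^ (h * p) ≡ H * H
  4^hp≡H² = trans (*-^ 2 2 (h * p)) (cong₂ _*_ (≡-sym H≡2^hp) (≡-sym H≡2^hp))

  walks-bound-p : ∀ c s → walks (c * p) s * walks (c * p) s * (c * p) ≤ s * s * 4 ^ (c * p)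
  walks-bound-p c s = subst (λ n → walks n s * walks n s * n ≤ s * s * 4 ^ n) (lemma c (a * a) p≡) (walks-bound (c * (8 * (a * a))) s)
    where
    lemma′ : ∀ c b → c * (8 * b) + c * (8 * b) ≡ c * (16 * b)
    lemma′ = solve-∀
    lemma : ∀ c b → p ≡ 16 * b → c * (8 * b) + c * (8 * b) ≡ c * p
    lemma c b eq = trans (lemma′ c b) (cong (c *_) (≡-sym eq))

  -- A single coordinate is itself a Littlewood-Offord problem, with p coefficients equal to 1. The
  -- values of size below a are covered by a intervals of length 2, and a / √p = 1/4.
  smallCoordinate : 4 * ∫ (binomial p) (λ z → if isLarge z then 0 else 1) ≤ 2 ^ p
  smallCoordinate = ≤-trans (*-monoʳ-≤ 4 anticoncentration) (sq-cancel-≤ (*-cancelˡ-≤ (a * a) {{m*n≢0 a a}} (begin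
    a * a * (4 * w * (4 * w))      ≡⟨ lemma a w ⟩
    w * w * (16 * (a * a))         ≡⟨ cong (w * w *_) (≡-sym p≡) ⟩
    w * w * p                      ≤⟨ subst (λ n → walks n a * walks n a * n ≤ a * a * 4 ^ n) (*-identityˡ p) (walks-bound-p 1 a) ⟩
    a * a * 4 ^ p                  ≡⟨ cong (a * a *_) (*-^ 2 2 p) ⟩
    a * a * (2 ^ p * 2 ^ p)        ∎)))
    where
    open ≤-Reasoning
    module Unit = LittlewoodOfford 1
    w = walks p a
    cs = Unit.cover (ℤ.- (ℤ.+ a)) a
    lemma : ∀ a w → a * a * (4 * w * (4 * w)) ≡ w * w * (16 * (a * a))
    lemma = solve-∀
    spread : Unit.Spread (λ c → ∫ (binomial p) (Unit.hit c)) 0 p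
    spread = Unit.spread-cong {r = 0} {p}
      (λ c → ∫-cong (binomial p) (λ z → trans (≡-sym (Unit.hit-shift c (1ℤ ℤ.* z) 0ℤ)) (cong (Unit.hit c) (e z))))
      (subst (Unit.Spread (Unit.Smoothed p (λ c → Unit.hit c 0ℤ) 1ℤ) 0) (+-identityʳ p)
        (Unit.spread-smoothed p {λ c → Unit.hit c 0ℤ} {0} {0} 1ℤ ≤-refl (Unit.spread-hit 0ℤ)))
      where
      e : ∀ z → 1ℤ ℤ.* z ℤ.+ 0ℤ ≡ z
      e = ℤSolver.solve-∀
    pointwise : ∀ z → (if isLarge z then 0 else 1) ≤ sum (map (λ c → Unit.hit c z) cs)
    pointwise z with isLarge z in eq
    ... | true  = z≤n
    ... | false = Unit.covered (ℤ.- (ℤ.+ a)) a z (proj₁ bounds) (subst (z ℤ.<_) e (proj₂ bounds))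
      where
      bounds = abs<⇒bounds z (false⇒> eq)
      double : ∀ A → A ≡ ℤ.- A ℤ.+ (A ℤ.+ A)
      double = ℤSolver.solve-∀
      e : ℤ.+ a ≡ ℤ.- (ℤ.+ a) ℤ.+ ℤ.+ (2 * 1 * a)
      e = trans (double (ℤ.+ a)) (cong (λ n → ℤ.- (ℤ.+ a) ℤ.+ ℤ.+ (a + n)) (≡-sym (+-identityʳ a)))
    anticoncentration : ∫ (binomial p) (λ z → if isLarge z then 0 else 1) ≤ w
    anticoncentration = begin
      ∫ (binomial p) (λ z → if isLarge z then 0 else 1)                 ≤⟨ ∫-mono (binomial p) pointwise ⟩
      ∫ (binomial p) (λ z → sum (map (λ c → Unit.hit c z) cs))          ≡⟨ ≡-sym (sum-∫ (binomial p) Unit.hit cs) ⟩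
      sum (map (λ c → ∫ (binomial p) (Unit.hit c)) cs)                  ≤⟨ spread cs (Unit.sparse-cover (ℤ.- (ℤ.+ a)) a) ⟩
      1 * walks p (length cs)                                           ≡⟨ trans (*-identityˡ _) (cong (walks p) (Unit.length-cover (ℤ.- (ℤ.+ a)) a)) ⟩
      w                                                                 ∎

  isBad : Vec ℤ h → Bool
  isBad x = k ≤ᵇ small x

  -- Exponential Markov inequality: 3^(number of small coordinates) has mean at most (3/4 +
  -- 3/4)^(2k) = (9/4)^k, so bad points have measure at most (3/4)^k, which Bernoulli's inequality
  -- bounds by 3/k.
  few-bad : k * ∫ μ (𝟙 ∘ isBad) ≤ 3 * H
  few-bad = *-cancelˡ-≤ (4 ^ k * 3 ^ k) {{m*n≢0 (4 ^ k) (3 ^ k) {{m^n≢0 4 k}} {{m^n≢0 3 k}}}} (begin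
    4 ^ k * 3 ^ k * (k * X)                       ≡⟨ lemma₁ (4 ^ k) (3 ^ k) k X ⟩
    k * (4 ^ k * (3 ^ k * X))                     ≤⟨ *-monoʳ-≤ k (*-monoʳ-≤ (4 ^ k) markov) ⟩
    k * (4 ^ k * ∫ μ (λ x → 3 ^ small x))         ≤⟨ *-monoʳ-≤ k moment ⟩
    k * (3 ^ k * 3 ^ k * H)                       ≡⟨ lemma₂ k (3 ^ k) H ⟩
    3 ^ k * k * (3 ^ k * H)                       ≤⟨ *-monoˡ-≤ (3 ^ k * H) (*-monoʳ-≤ (3 ^ k) (m≤n+m k 3)) ⟩
    3 ^ k * (3 + k) * (3 ^ k * H)                 ≤⟨ *-monoˡ-≤ (3 ^ k * H) (bernoulli 3 k) ⟩
    3 * 4 ^ k * (3 ^ k * H)                       ≡⟨ lemma₃ (4 ^ k) (3 ^ k) H ⟩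
    4 ^ k * 3 ^ k * (3 * H)                       ∎)
    where
    open ≤-Reasoning
    X = ∫ μ (𝟙 ∘ isBad)
    lemma₁ : ∀ a b k X → a * b * (k * X) ≡ k * (a * (b * X))
    lemma₁ = solve-∀
    lemma₂ : ∀ k b H → k * (b * b * H) ≡ b * k * (b * H)
    lemma₂ = solve-∀
    lemma₃ : ∀ a b H → 3 * a * (b * H) ≡ a * b * (3 * H)
    lemma₃ = solve-∀
    markov : 3 ^ k * X ≤ ∫ μ (λ x → 3 ^ small x)
    markov = subst (_≤ ∫ μ (λ x → 3 ^ small x)) (∫-*ˡ μ (3 ^ k) (𝟙 ∘ isBad)) (∫-mono μ pointwise)
      where
      pointwise : ∀ x → 3 ^ k * 𝟙 (isBad x) ≤ 3 ^ small x
      pointwise x with isBad x in eq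
      ... | true  = ≤-trans (≤-reflexive (*-identityʳ _)) (^-monoʳ-≤ 3 (true⇒≤ {k} {small x} eq))
      ... | false = ≤-trans (≤-reflexive (*-zeroʳ (3 ^ k))) z≤n
    g : ℤ → ℕ
    g z = if isLarge z then 1 else 3
    3^small : ∀ {n} (x : Vec ℤ n) → 3 ^ small x ≡ Vec.foldr _ (λ z r → g z * r) 1 x
    3^small []       = refl
    3^small (z ∷ zs) with isLarge z
    ... | true  = trans (3^small zs) (≡-sym (*-identityˡ _))
    ... | false = cong (3 *_) (3^small zs)
    2∫g≤ : 2 * ∫ (binomial p) g ≤ 3 * 2 ^ p
    2∫g≤ = begin
      2 * ∫ (binomial p) g                                ≡⟨ cong (2 *_) (∫-cong (binomial p) pointwise) ⟩
      2 * ∫ (binomial p) (λ z → 1 + 2 * s z)              ≡⟨ cong (2 *_) (trans (∫-+ (binomial p) (λ _ → 1) (λ z → 2 * s z)) (cong₂ _+_ (mass-binomial p) (∫-*ˡ (binomial p) 2 s))) ⟩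
      2 * (2 ^ p + 2 * ∫ (binomial p) s)                  ≡⟨ lemma (2 ^ p) (∫ (binomial p) s) ⟩
      2 * 2 ^ p + 4 * ∫ (binomial p) s                    ≤⟨ +-monoʳ-≤ (2 * 2 ^ p) smallCoordinate ⟩
      2 * 2 ^ p + 2 ^ p                                   ≡⟨ lemma′ (2 ^ p) ⟩
      3 * 2 ^ p                                           ∎
      where
      s : ℤ → ℕ
      s z = if isLarge z then 0 else 1
      pointwise : ∀ z → g z ≡ 1 + 2 * s z
      pointwise z with isLarge z
      ... | true  = refl
      ... | false = refl
      lemma : ∀ a b → 2 * (a + 2 * b) ≡ 2 * a + 4 * b
      lemma = solve-∀
      lemma′ : ∀ a → 2 * a + a ≡ 3 * a
      lemma′ = solve-∀
    moment : 4 ^ k * ∫ μ (λ x → 3 ^ small x) ≤ 3 ^ k * 3 ^ k * H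
    moment = begin
      4 ^ k * ∫ μ (λ x → 3 ^ small x)        ≡⟨ cong₂ _*_ (trans (*-^ 2 2 k) (≡-sym (^-distribˡ-+-* 2 k k))) (trans (∫-cong μ 3^small) (∫-power-* (binomial p) h g)) ⟩
      2 ^ h * ∫ (binomial p) g ^ h           ≡⟨ ≡-sym (*-^ 2 _ h) ⟩
      (2 * ∫ (binomial p) g) ^ h             ≤⟨ ^-monoˡ-≤ h 2∫g≤ ⟩
      (3 * 2 ^ p) ^ h                        ≡⟨ *-^ 3 (2 ^ p) h ⟩
      3 ^ h * (2 ^ p) ^ h                    ≡⟨ cong₂ _*_ (^-distribˡ-+-* 3 k k) (≡-sym H≡) ⟩
      3 ^ k * 3 ^ k * H                      ∎

  -- S and −S are at squared distance more than D.
  far-apart-measure : h ≤ p → (S : Vec ℤ h → Bool) →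
    (∀ x y → S x ≡ true → S y ≡ true → D < dist² x (negate y)) →
    2 ^ u * (∫ μ (𝟙 ∘ S) * ∫ μ (𝟙 ∘ S)) ≤ 2 * (H * H)
  far-apart-measure h≤p S far = *-cancelˡ-≤ (M * q ^ hp) {{m*n≢0 M (q ^ hp) {{M≢0}} {{m^n≢0 q hp }}}} (begin
    M * q ^ hp * (2 ^ u * (α * α))                     ≡⟨ lemma₁ M (q ^ hp) (2 ^ u) α ⟩
    2 ^ u * M * (α * α * q ^ hp)                       ≤⟨ *-monoˡ-≤ (α * α * q ^ hp) 2^u*M≤N ⟩
    N * (α * α * q ^ hp)                               ≡⟨ lemma₂ N α (q ^ hp) ⟩
    N * α * α * q ^ hp                                 ≡⟨ cong₂ (λ s t → s * t * q ^ hp) (≡-sym (∫-*ˡ μ N (𝟙 ∘ S))) (≡-sym (∫-power-neg p h (𝟙 ∘ S))) ⟩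
    ∫ μ f * ∫ μ g * q ^ hp                             ≤⟨ concentration h M {{M≢0}} f g bounded ⟩
    M * 4 ^ hp * suc q ^ hp                            ≡⟨ cong (λ s → M * s * suc q ^ hp) 4^hp≡H² ⟩
    M * (H * H) * suc q ^ hp                           ≤⟨ *-monoʳ-≤ (M * (H * H)) suc-q^hp≤ ⟩
    M * (H * H) * (2 * q ^ hp)                         ≡⟨ lemma₃ M (H * H) (q ^ hp) ⟩
    M * q ^ hp * (2 * (H * H))                         ∎)
    where
    open ≤-Reasoning
    hp = h * p
    α = ∫ μ (𝟙 ∘ S)
    M = q ^ (p * D)
    N = suc q ^ (p * D)
    -- Up to the denominator `M`, f is ρ^(pD) on S and g is the indicator of -S; the product is
    -- positive only at squared distances above D, where ρ^(p|x - y|²) exceeds it.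
    f g : Vec ℤ h → ℕ
    f x = N * 𝟙 (S x)
    g y = 𝟙 (S (negate y))
    M≢0 : NonZero M
    M≢0 = m^n≢0 q (p * D) 
    lemma₁ : ∀ M c t α → M * c * (t * (α * α)) ≡ t * M * (α * α * c)
    lemma₁ = solve-∀
    lemma₂ : ∀ N α c → N * (α * α * c) ≡ N * α * α * c
    lemma₂ = solve-∀
    lemma₃ : ∀ M s c → M * s * (2 * c) ≡ M * c * (2 * s)
    lemma₃ = solve-∀
    pD≡qu : p * D ≡ q * u
    pD≡qu = trans (cong (p *_) D≡) (trans (lemma p u) (cong (_* u) (≡-sym q≡)))
      where
      lemma : ∀ p u → p * (p * (576 * u)) ≡ 576 * (p * p) * u
      lemma = solve-∀
    2^u*M≤N : 2 ^ u * M ≤ N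
    2^u*M≤N = begin
      2 ^ u * q ^ (p * D)        ≡⟨ cong (λ e → 2 ^ u * q ^ e) pD≡qu ⟩
      2 ^ u * q ^ (q * u)        ≡⟨ cong (2 ^ u *_) (≡-sym (^-*-assoc q q u)) ⟩
      2 ^ u * (q ^ q) ^ u        ≡⟨ ≡-sym (*-^ 2 (q ^ q) u) ⟩
      (2 * q ^ q) ^ u            ≤⟨ ^-monoˡ-≤ u (*-cancelˡ-≤ q  (≤-trans (≤-reflexive (lemma q (q ^ q))) (bernoulli q q))) ⟩
      (suc q ^ q) ^ u            ≡⟨ ^-*-assoc (suc q) q u ⟩
      suc q ^ (q * u)            ≡⟨ cong (suc q ^_) (≡-sym pD≡qu) ⟩
      suc q ^ (p * D)            ∎
      where
      lemma : ∀ q z → q * (2 * z) ≡ z * (q + q)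
      lemma = solve-∀
    -- The place where p ≥ h is used: it keeps the total loss ρ^(hp) of the tensorised inequality
    -- below 2.
    2hp≤q : 2 * hp ≤ q
    2hp≤q = begin
      2 * (h * p)      ≤⟨ *-mono-≤ {2} {576} (m≤m+n 2 574) (*-monoˡ-≤ p h≤p) ⟩
      576 * (p * p)    ≡⟨ ≡-sym q≡ ⟩
      q                ∎
    suc-q^hp≤ : suc q ^ hp ≤ 2 * q ^ hp
    suc-q^hp≤ = *-cancelʳ-≤ _ _ q  (begin
      suc q ^ hp * q             ≤⟨ bernoulli-upper q hp 2hp≤q ⟩
      q ^ hp * (q + 2 * hp)      ≤⟨ *-monoʳ-≤ (q ^ hp) (+-monoʳ-≤ q 2hp≤q) ⟩
      q ^ hp * (q + q)           ≡⟨ lemma q (q ^ hp) ⟩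
      2 * q ^ hp * q             ∎)
      where
      lemma : ∀ q z → z * (q + q) ≡ 2 * z * q
      lemma = solve-∀
    bounded : ∀ x y → f x * g y * q ^ (p * dist² x y) ≤ M * suc q ^ (p * dist² x y)
    bounded x y with S x in Sx | S (negate y) in Sy
    ... | false | _     rewrite *-zeroʳ N = z≤n
    ... | true  | false rewrite *-zeroʳ (N * 1) = z≤n
    ... | true  | true  = begin
      N * 1 * 1 * q ^ (p * d)                       ≡⟨ cong₂ _*_ (trans (*-identityʳ _) (*-identityʳ N)) (split q) ⟩
      N * (M * q ^ r)                               ≤⟨ *-monoʳ-≤ N (*-monoʳ-≤ M (^-monoˡ-≤ r (n≤1+n q))) ⟩
      N * (M * suc q ^ r)                           ≡⟨ lemma N M (suc q ^ r) ⟩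
      M * (N * suc q ^ r)                           ≡⟨ cong (M *_) (≡-sym (split (suc q))) ⟩
      M * suc q ^ (p * d)                           ∎
      where
      d = dist² x y
      r = p * d ∸ p * D
      D≤d : D ≤ d
      D≤d = <⇒≤ (subst (λ v → D < dist² x v) (negate-involutive y) (far x (negate y) Sx Sy))
      split : ∀ b → b ^ (p * d) ≡ b ^ (p * D) * b ^ r
      split b = trans (cong (b ^_) (≡-sym (m+[n∸m]≡n (*-monoʳ-≤ p D≤d)))) (^-distribˡ-+-* b (p * D) r)
      lemma : ∀ N M z → N * (M * z) ≡ M * (N * z)
      lemma = solve-∀


-- The Bollobás-Erdős graph on the discrete sphere

module SphereGraph (a k ℓ p q D : ℕ) .{{a≢0 : NonZero a}} .{{p≢0 : NonZero p}} .{{q≢0 : NonZero q}}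
  (p≡ : p ≡ 16 * (a * a)) (q≡ : q ≡ 576 * (p * p)) (D≡ : D ≡ p * (576 * suc (ℓ + ℓ)))
  (k+k≤p : k + k ≤ p) (k≤2^ℓ : k ≤ 2 ^ ℓ) (k-large : 20736 * suc (ℓ + ℓ) ≤ k) where

  -- Odd, so that 2^u α² ≤ 2H² reduces to a comparison of squares, 2^ℓ α ≤ H; with k ≤ 2^ℓ this
  -- gives measure at most H/k.
  u : ℕ
  u = suc (ℓ + ℓ)

  open Sphere a k u p q D p≡ q≡ D≡ public
  open LittlewoodOfford a

  isGood : Vec ℤ h → Bool
  isGood x = not (isBad x)

  antipodal far : Vec ℤ h → Vec ℤ h → Bool
  antipodal x y = (isGood x ∧ isGood y) ∧ (dist² x (negate y) ≤ᵇ D)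
  far x y = does (ℤ.+ D ℤ.<? inner x y)

  antipodal-sym : ∀ x y → antipodal x y ≡ antipodal y x
  antipodal-sym x y = cong₂ (λ b d → b ∧ (d ≤ᵇ D)) (∧-comm (isGood x) _) (dist²-negate-comm x y)

  good⇒small<k : ∀ {x} → isGood x ≡ true → small x < k
  good⇒small<k {x} eq with isBad x in bad
  ... | false = false⇒> bad

  antipodal⇒dist²≤D : ∀ {x y} → antipodal x y ≡ true → dist² x (negate y) ≤ D
  antipodal⇒dist²≤D {x} {y} eq = true⇒≤ (proj₂ (∧-true {isGood x ∧ isGood y} eq))

  good⇒k≤large : ∀ {x} → small x < k → k ≤ large x
  good⇒k≤large {x} small<k = +-cancelʳ-≤ k k (large x) (begin
    k + k               ≡⟨ ≡-sym (large+small x) ⟩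
    large x + small x   ≤⟨ +-monoʳ-≤ (large x) (<⇒≤ small<k) ⟩
    large x + k         ∎)
    where open ≤-Reasoning

  large-norm² : ∀ {n} (x : Vec ℤ n) → large x * (a * a) ≤ norm² x
  large-norm² []       = z≤n
  large-norm² (z ∷ zs) with isLarge z in eq
  ... | true  = +-mono-≤ (*-mono-≤ (true⇒≤ {a} eq) (true⇒≤ {a} eq)) (large-norm² zs)
  ... | false = ≤-trans (large-norm² zs) (m≤n+m (norm² zs) (sqr z))

  -- A good point has more than k coordinates of size at least a, so 4|x|² > 4k a², whereas a
  -- triangle forces 4|x|² ≤ 9D. As 9D = 4a² · 36 · 576 u, the constant is 20736 = 36 · 576.
  no-triangle : ∀ x y z → antipodal x y ≡ true → antipodal x z ≡ true → antipodal y z ≡ true → ⊥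
  no-triangle x y z xy xz yz = <⇒≱ suc-k≤ k-large
    where
    open ≤-Reasoning
    x-small<k : small x < k
    x-small<k = good⇒small<k {x} (proj₁ (∧-true (proj₁ (∧-true {isGood x ∧ isGood y} xy))))
    k<large : k < large x
    k<large = +-cancelʳ-< (small x) k (large x) (begin-strict
      k + small x         <⟨ +-monoʳ-< k x-small<k ⟩
      k + k               ≡⟨ ≡-sym (large+small x) ⟩
      large x + small x   ∎)
    suc-k≤ : suc k ≤ 20736 * u
    suc-k≤ = *-cancelˡ-≤ (4 * (a * a)) {{m*n≢0 4 (a * a) {{_}} {{m*n≢0 a a}}}} (begin
      4 * (a * a) * suc k                   ≤⟨ *-monoʳ-≤ (4 * (a * a)) k<large ⟩
      4 * (a * a) * large x                 ≡⟨ lemma₁ (a * a) (large x) ⟩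
      4 * (large x * (a * a))               ≤⟨ *-monoʳ-≤ 4 (large-norm² x) ⟩
      4 * norm² x                           ≤⟨ norm²-≤-antipodal x y z ⟩
      3 * (dist² x (negate y) + dist² x (negate z) + dist² y (negate z))
                                            ≤⟨ *-monoʳ-≤ 3 (+-mono-≤ (+-mono-≤ (antipodal⇒dist²≤D {x} {y} xy) (antipodal⇒dist²≤D {x} {z} xz)) (antipodal⇒dist²≤D {y} {z} yz)) ⟩
      3 * (D + D + D)                       ≡⟨ cong (λ d → 3 * (d + d + d)) (trans D≡ (cong (_* (576 * u)) p≡)) ⟩
      3 * (16 * (a * a) * (576 * u) + 16 * (a * a) * (576 * u) + 16 * (a * a) * (576 * u))
                                            ≡⟨ lemma₂ 576 (a * a) u ⟩
      4 * (a * a) * (20736 * u)             ∎)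
      where
      lemma₁ : ∀ b l → 4 * b * l ≡ 4 * (l * b)
      lemma₁ = solve-∀
      lemma₂ : ∀ c b u → 3 * (16 * b * (c * u) + 16 * b * (c * u) + 16 * b * (c * u)) ≡ 4 * b * (36 * c * u)
      lemma₂ = solve-∀

  -- A loop at x would be the degenerate triangle x, x, x.
  antipodal-irrefl : ∀ x → antipodal x x ≡ false
  antipodal-irrefl x with antipodal x x in eq
  ... | true  = ⊥-elim (no-triangle x x x eq eq eq)
  ... | false = refl

  far⇒D<inner : ∀ {x y} → far x y ≡ true → ℤ.+ D ℤ.< inner x y
  far⇒D<inner {x} {y} eq with ℤ.+ D ℤ.<? inner x y
  ... | yes D<xy = D<xy

  no-rectangle : ∀ x x′ y y′ → antipodal x x′ ≡ true → antipodal y y′ ≡ true →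
    far x y ≡ true → far x y′ ≡ true → far x′ y ≡ true → far x′ y′ ≡ true → ⊥
  no-rectangle x x′ y y′ xx yy f₁ f₂ f₃ f₄ = <⇒≱ (ℤP.drop‿+<+ (begin-strict
    ℤ.+ (2 * (D + D + (D + D)))                         ≡⟨ ℤP.pos-* 2 (D + D + (D + D)) ⟩
    ℤ.+ 2 ℤ.* ℤ.+ (D + D + (D + D))                     <⟨ ℤP.*-monoˡ-<-pos (ℤ.+ 2) (ℤP.+-mono-< (ℤP.+-mono-< (far⇒D<inner {x} f₁) (far⇒D<inner {x} f₂))
                                                             (ℤP.+-mono-< (far⇒D<inner {x′} f₃) (far⇒D<inner {x′} f₄))) ⟩
    ℤ.+ 2 ℤ.* (inner x y ℤ.+ inner x y′ ℤ.+ (inner x′ y ℤ.+ inner x′ y′)) ≤⟨ inner-≤-antipodal x x′ y y′ ⟩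
    ℤ.+ (dist² x (negate x′) + dist² y (negate y′))     ≤⟨ ℤ.+≤+ (+-mono-≤ (antipodal⇒dist²≤D {x} xx) (antipodal⇒dist²≤D {y} yy)) ⟩
    ℤ.+ (D + D)                                         ∎)) (≤-trans (m≤m+n (D + D) (D + D)) (m≤m+n _ _))
    where open ℤP.≤-Reasoning

  -- The good points of S have no nearly antipodal pair and so measure at most 2^(-ℓ) H ≤ H/k; the
  -- bad points add at most 3H/k.
  independent-measure : (S : Vec ℤ h → Bool) →
    (∀ x y → S x ≡ true → S y ≡ true → antipodal x y ≡ false) → k * ∫ μ (𝟙 ∘ S) ≤ 4 * H
  independent-measure S independent = begin
    k * ∫ μ (𝟙 ∘ S)                                ≤⟨ *-monoʳ-≤ k (∫-mono μ pointwise) ⟩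
    k * ∫ μ (λ x → 𝟙 (S⁺ x) + 𝟙 (isBad x))         ≡⟨ cong (k *_) (∫-+ μ (𝟙 ∘ S⁺) (𝟙 ∘ isBad)) ⟩
    k * (α + ∫ μ (𝟙 ∘ isBad))                      ≡⟨ *-distribˡ-+ k α _ ⟩
    k * α + k * ∫ μ (𝟙 ∘ isBad)                    ≤⟨ +-mono-≤ (≤-trans (*-monoˡ-≤ α k≤2^ℓ) good-part) few-bad ⟩
    H + 3 * H                                      ∎
    where
    open ≤-Reasoning
    S⁺ : Vec ℤ h → Bool
    S⁺ x = S x ∧ isGood x
    α = ∫ μ (𝟙 ∘ S⁺)
    pointwise : ∀ x → 𝟙 (S x) ≤ 𝟙 (S⁺ x) + 𝟙 (isBad x)
    pointwise x with S x | isBad x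
    ... | false | _     = z≤n
    ... | true  | false = ≤-refl
    ... | true  | true  = ≤-refl
    apart : ∀ x y → S⁺ x ≡ true → S⁺ y ≡ true → D < dist² x (negate y)
    apart x y Sx Sy with ∧-true {S x} Sx | ∧-true {S y} Sy
    ... | Sx , gx | Sy , gy = false⇒> (trans (≡-sym (cong₂ (λ b c → (b ∧ c) ∧ (dist² x (negate y) ≤ᵇ D)) gx gy)) (independent x y Sx Sy))
    good-part : 2 ^ ℓ * α ≤ H
    good-part = sq-cancel-≤ (*-cancelˡ-≤ 2 (begin
      2 * (2 ^ ℓ * α * (2 ^ ℓ * α))     ≡⟨ lemma (2 ^ ℓ) α ⟩
      2 * (2 ^ ℓ * 2 ^ ℓ) * (α * α)     ≡⟨ cong (λ s → 2 * s * (α * α)) (≡-sym (^-distribˡ-+-* 2 ℓ ℓ)) ⟩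
      2 ^ u * (α * α)                   ≤⟨ far-apart-measure k+k≤p S⁺ apart ⟩
      2 * (H * H)                       ∎))
      where
      lemma : ∀ t α → 2 * (t * α * (t * α)) ≡ 2 * (t * t) * (α * α)
      lemma = solve-∀

  -- slots intervals of length 2a cover [ −D , D ].
  slots : ℕ
  slots = suc (9216 * (a * u))

  central : ℤ → ℕ
  central z = sum (map (λ c → hit c z) (cover (ℤ.- (ℤ.+ D)) slots))

  central≤1 : ∀ z → central z ≤ 1
  central≤1 z = spread-hit z _ (sparse-cover (ℤ.- (ℤ.+ D)) slots)

  -- 9216 = 16 · 576 comes from p = 16a² and D = 576 p u. The one extra slot makes the half-open
  -- intervals contain the endpoint D.
  2D<2a*slots : 2 * D < 2 * a * slots
  2D<2a*slots = begin-strict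
    2 * D                                            ≡⟨ cong (2 *_) (trans D≡ (cong (_* (576 * u)) p≡)) ⟩
    2 * (16 * (a * a) * (576 * u))                   ≡⟨ lemma₁ 576 a u ⟩
    2 * a * (9216 * (a * u))                         <⟨ m<n+m _ (>-nonZero⁻¹ (2 * a) {{m*n≢0 2 a}}) ⟩
    2 * a + 2 * a * (9216 * (a * u))                 ≡⟨ ≡-sym (*-suc (2 * a) _) ⟩
    2 * a * slots                                    ∎
    where
    open ≤-Reasoning
    lemma₁ : ∀ c a u → 2 * (16 * (a * a) * (c * u)) ≡ 2 * a * (16 * c * (a * u))
    lemma₁ = solve-∀

  central-covers : ∀ z → 1 ≤ 𝟙 (does (ℤ.+ D ℤ.<? z)) + 𝟙 (does (ℤ.+ D ℤ.<? ℤ.- z)) + central z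
  central-covers z = split (ℤ.+ D ℤ.<? z) (ℤ.+ D ℤ.<? ℤ.- z)
    where
    double : ∀ d → ℤ.- d ℤ.+ (d ℤ.+ d) ≡ d
    double = ℤSolver.solve-∀
    e : ℤ.- (ℤ.+ D) ℤ.+ ℤ.+ (2 * D) ≡ ℤ.+ D
    e = trans (cong (λ n → ℤ.- (ℤ.+ D) ℤ.+ ℤ.+ (D + n)) (+-identityʳ D)) (double (ℤ.+ D))
    split : (d₁ : Dec (ℤ.+ D ℤ.< z)) (d₂ : Dec (ℤ.+ D ℤ.< ℤ.- z)) → 1 ≤ 𝟙 (does d₁) + 𝟙 (does d₂) + central z
    split (yes _)   _         = s≤s z≤n
    split (no _)    (yes _)   = s≤s z≤n
    split (no D≮z)  (no D≮-z) = covered (ℤ.- (ℤ.+ D)) slots z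
      (subst (ℤ.- (ℤ.+ D) ℤ.≤_) (ℤP.neg-involutive z) (ℤP.neg-mono-≤ (ℤP.≮⇒≥ D≮-z)))
      (ℤP.≤-<-trans (ℤP.≮⇒≥ D≮z) (subst (ℤ._< ℤ.- (ℤ.+ D) ℤ.+ ℤ.+ (2 * a * slots)) e (ℤP.+-monoʳ-< (ℤ.- (ℤ.+ D)) (ℤ.+<+ 2D<2a*slots))))

  farMass centralMass : Vec ℤ h → ℕ
  farMass x = ∫ μ (λ y → 𝟙 (far x y))
  centralMass x = ∫ μ (λ y → central (inner x y))

  -- Either ⟨x , y⟩ > D, or ⟨x , y⟩ < -D, or y lies in the strip; the reflection of y gives the
  -- first two events equal measure.
  H≤2far+central : ∀ x → H ≤ 2 * farMass x + centralMass x
  H≤2far+central x = begin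
    H                                                                     ≤⟨ ∫-mono μ (λ y → central-covers (inner x y)) ⟩
    ∫ μ (λ y → 𝟙 (far x y) + 𝟙 (does (ℤ.+ D ℤ.<? ℤ.- inner x y)) + central (inner x y)) ≡⟨ ∫-+ μ _ _ ⟩
    ∫ μ (λ y → 𝟙 (far x y) + 𝟙 (does (ℤ.+ D ℤ.<? ℤ.- inner x y))) + centralMass x       ≡⟨ cong (_+ centralMass x) (∫-+ μ _ _) ⟩
    farMass x + ∫ μ (λ y → 𝟙 (does (ℤ.+ D ℤ.<? ℤ.- inner x y))) + centralMass x         ≡⟨ cong (λ s → farMass x + s + centralMass x) reflected ⟩
    farMass x + farMass x + centralMass x                                 ≡⟨ cong (λ s → farMass x + s + centralMass x) (≡-sym (+-identityʳ _)) ⟩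
    2 * farMass x + centralMass x                                         ∎
    where
    open ≤-Reasoning
    reflected : ∫ μ (λ y → 𝟙 (does (ℤ.+ D ℤ.<? ℤ.- inner x y))) ≡ farMass x
    reflected = trans (∫-cong μ (λ y → cong (λ z → 𝟙 (does (ℤ.+ D ℤ.<? z))) (≡-sym (inner-negate x y))))
      (∫-power-neg p h (λ y → 𝟙 (far x y)))

  centralMass≤H : ∀ x → centralMass x ≤ H
  centralMass≤H x = ∫-mono μ (λ y → central≤1 (inner x y))

  -- Littlewood-Offord with at least k p signs of coefficient at least a: the strip has relative
  -- measure at most slots / √(kp) = slots / (4a √k). The factor 4 is given away, and 9217 absorbs
  -- the extra slot.
  centralMass-bound : ∀ x → isBad x ≡ false → centralMass x * centralMass x * k ≤ 9217 * (u * H) * (9217 * (u * H))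
  centralMass-bound x good = *-cancelˡ-≤ (a * a) {{m*n≢0 a a}} (begin
    a * a * (Z * Z * k)                            ≤⟨ m≤m+n _ (15 * (a * a * (Z * Z * k))) ⟩
    16 * (a * a * (Z * Z * k))                     ≡⟨ lemma₁ (a * a) Z k ⟩
    Z * Z * (k * (16 * (a * a)))                   ≡⟨ cong (λ s → Z * Z * (k * s)) (≡-sym p≡) ⟩
    Z * Z * (k * p)                                ≤⟨ *-mono-≤ (*-mono-≤ Z≤ Z≤) (*-monoˡ-≤ p (good⇒k≤large {x} (false⇒> good))) ⟩
    2 ^ r * w * (2 ^ r * w) * n                    ≡⟨ lemma₂ (2 ^ r) w n ⟩
    2 ^ r * 2 ^ r * (w * w * n)                    ≤⟨ *-monoʳ-≤ (2 ^ r * 2 ^ r) (walks-bound-p (large x) slots) ⟩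
    2 ^ r * 2 ^ r * (slots * slots * 4 ^ n)        ≡⟨ cong (λ s → 2 ^ r * 2 ^ r * (slots * slots * s)) (*-^ 2 2 n) ⟩
    2 ^ r * 2 ^ r * (slots * slots * (2 ^ n * 2 ^ n)) ≡⟨ lemma₃ (2 ^ r) slots (2 ^ n) ⟩
    slots * (2 ^ n * 2 ^ r) * (slots * (2 ^ n * 2 ^ r)) ≡⟨ cong (λ s → slots * s * (slots * s)) 2^n*2^r≡H ⟩
    slots * H * (slots * H)                        ≤⟨ *-mono-≤ (*-monoˡ-≤ H slots≤) (*-monoˡ-≤ H slots≤) ⟩
    9217 * (a * u) * H * (9217 * (a * u) * H)      ≡⟨ lemma₄ 9217 a u H ⟩
    a * a * (9217 * (u * H) * (9217 * (u * H)))    ∎)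
    where
    open ≤-Reasoning
    Z = centralMass x
    r = small x * p
    n = large x * p
    w = walks n slots
    Z≤ : Z ≤ 2 ^ r * w
    Z≤ = begin
      Z                                                          ≡⟨ ≡-sym (sum-∫ μ (λ c y → hit c (inner x y)) cs) ⟩
      sum (map (λ c → ∫ μ (λ y → hit c (inner x y))) cs)         ≤⟨ spread-inner p x cs (sparse-cover (ℤ.- (ℤ.+ D)) slots) ⟩
      2 ^ r * walks n (length cs)                                ≡⟨ cong (λ s → 2 ^ r * walks n s) (length-cover (ℤ.- (ℤ.+ D)) slots) ⟩
      2 ^ r * w                                                  ∎
      where cs = cover (ℤ.- (ℤ.+ D)) slots
    2^n*2^r≡H : 2 ^ n * 2 ^ r ≡ H
    2^n*2^r≡H = trans (≡-sym (^-distribˡ-+-* 2 n r)) (trans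
      (cong (2 ^_) (trans (≡-sym (*-distribʳ-+ p (large x) (small x))) (cong (_* p) (large+small x)))) (≡-sym H≡2^hp))
    slots≤ : slots ≤ 9217 * (a * u)
    slots≤ = +-monoˡ-≤ (9216 * (a * u)) (>-nonZero⁻¹ (a * u) {{m*n≢0 a u}})
    lemma₁ : ∀ b Z k → 16 * (b * (Z * Z * k)) ≡ Z * Z * (k * (16 * b))
    lemma₁ = solve-∀
    lemma₂ : ∀ t w n → t * w * (t * w) * n ≡ t * t * (w * w * n)
    lemma₂ = solve-∀
    lemma₃ : ∀ t s m → t * t * (s * s * (m * m)) ≡ s * (m * t) * (s * (m * t))
    lemma₃ = solve-∀
    lemma₄ : ∀ c a u H → c * (a * u) * H * (c * (a * u) * H) ≡ a * a * (c * (u * H) * (c * (u * H)))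
    lemma₄ = solve-∀


-- Graphs on a list of vertex types

sum-map-mono : ∀ {f g : A → ℕ} (xs : List A) → (∀ x → f x ≤ g x) → sum (map f xs) ≤ sum (map g xs)
sum-map-mono []       le = z≤n
sum-map-mono (x ∷ xs) le = +-mono-≤ (le x) (sum-map-mono xs le)

sum-map-++ : (f : A → ℕ) (xs ys : List A) → sum (map f (xs ++ ys)) ≡ sum (map f xs) + sum (map f ys)
sum-map-++ f xs ys = trans (cong sum (map-++ f xs ys)) (sum-++ (map f xs) (map f ys))

sum-map-const : (c : ℕ) (xs : List A) → sum (map (λ _ → c) xs) ≡ length xs * c
sum-map-const c []       = refl
sum-map-const c (x ∷ xs) = cong (c +_) (sum-map-const c xs)

sum-replicate : (f : A → ℕ) (n : ℕ) (x : A) → sum (map f (replicate n x)) ≡ n * f x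
sum-replicate f zero    x = refl
sum-replicate f (suc n) x = cong (f x +_) (sum-replicate f n x)

sample : ℕ → (H : ℕ) .{{_ : NonZero H}} → Measure A → List A
sample N H []            = []
sample N H ((x , w) ∷ μ) = replicate (N * w / H) x ++ sample N H μ

sample-upper : ∀ N H .{{_ : NonZero H}} (μ : Measure A) (f : A → ℕ) →
  H * sum (map f (sample N H μ)) ≤ N * ∫ μ f
sample-upper N H []            f = ≤-reflexive (trans (*-zeroʳ H) (≡-sym (*-zeroʳ N)))
sample-upper N H ((x , w) ∷ μ) f = begin
  H * sum (map f (replicate c x ++ sample N H μ))      ≡⟨ cong (H *_) (trans (sum-map-++ f (replicate c x) _) (cong (_+ s) (sum-replicate f c x))) ⟩
  H * (c * f x + s)                                    ≡⟨ lemma₁ H c (f x) s ⟩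
  c * H * f x + H * s                                  ≤⟨ +-mono-≤ (*-monoˡ-≤ (f x) (m/n*n≤m (N * w) H)) (sample-upper N H μ f) ⟩
  N * w * f x + N * ∫ μ f                              ≡⟨ lemma₂ N w (f x) (∫ μ f) ⟩
  N * (w * f x + ∫ μ f)                                ∎
  where
  open ≤-Reasoning
  c = N * w / H
  s = sum (map f (sample N H μ))
  lemma₁ : ∀ H c a s → H * (c * a + s) ≡ c * H * a + H * s
  lemma₁ = solve-∀
  lemma₂ : ∀ N w a s → N * w * a + N * s ≡ N * (w * a + s)
  lemma₂ = solve-∀

-- Rounding down loses less than one copy per atom, hence at most b of the sum, whatever the weight
-- of the atom.
sample-lower : ∀ N H .{{_ : NonZero H}} (μ : Measure A) (f : A → ℕ) b → (∀ x → f x ≤ b) →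
  N * ∫ μ f ≤ H * (sum (map f (sample N H μ)) + length μ * b)
sample-lower N H []            f b f≤b = ≤-trans (≤-reflexive (*-zeroʳ N)) z≤n
sample-lower N H ((x , w) ∷ μ) f b f≤b = begin
  N * (w * f x + ∫ μ f)                                ≡⟨ lemma₁ N w (f x) (∫ μ f) ⟩
  N * w * f x + N * ∫ μ f                              ≤⟨ +-mono-≤ (*-monoˡ-≤ (f x) rounding) (sample-lower N H μ f b f≤b) ⟩
  (H + c * H) * f x + H * (s + length μ * b)           ≡⟨ lemma₂ H c (f x) s (length μ * b) ⟩
  H * (c * f x + s + (f x + length μ * b))             ≤⟨ *-monoʳ-≤ H (+-monoʳ-≤ (c * f x + s) (+-monoˡ-≤ (length μ * b) (f≤b x))) ⟩
  H * (c * f x + s + (b + length μ * b))               ≡⟨ cong (λ z → H * (z + (b + length μ * b))) (≡-sym (trans (sum-map-++ f (replicate c x) _) (cong (_+ s) (sum-replicate f c x)))) ⟩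
  H * (sum (map f (replicate c x ++ sample N H μ)) + (b + length μ * b)) ∎
  where
  open ≤-Reasoning
  c = N * w / H
  s = sum (map f (sample N H μ))
  rounding : N * w ≤ H + c * H
  rounding = ≤-trans (≤-reflexive (m≡m%n+[m/n]*n (N * w) H)) (+-monoˡ-≤ (c * H) (<⇒≤ (m%n<n (N * w) H)))
  lemma₁ : ∀ N w a s → N * (w * a + s) ≡ N * w * a + N * s
  lemma₁ = solve-∀
  lemma₂ : ∀ H c a s t → (H + c * H) * a + H * (s + t) ≡ H * (c * a + s + (a + t))
  lemma₂ = solve-∀

-- Vertices are positions in a list of types, so a blow-up is a repeated entry and counts are sums
-- over lists. By `~-irrefl` the copies of one type form an independent set.
module TypedGraph {V : Set} (_~_ : V → V → Bool)
  (~-sym : ∀ s t → (s ~ t) ≡ (t ~ s)) (~-irrefl : ∀ t → (t ~ t) ≡ false) where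

  graph : (ts : List V) → Graph (length ts)
  graph ts = record
    { adj    = λ i j → lookup ts i ~ lookup ts j
    ; sym    = λ i j → ~-sym (lookup ts i) (lookup ts j)
    ; irrefl = λ i → ~-irrefl (lookup ts i)
    }

  degree : V → List V → ℕ
  degree t us = sum (map (λ u → 𝟙 (t ~ u)) us)

  pairs : List V → ℕ
  pairs []       = 0
  pairs (t ∷ ts) = degree t ts + pairs ts

  cross : List V → List V → ℕ
  cross ts us = sum (map (λ t → degree t us) ts)

  sum-tabulate-lookup : (f : V → ℕ) (ts : List V) → sum (tabulate (λ i → f (lookup ts i))) ≡ sum (map f ts)
  sum-tabulate-lookup f []       = refl
  sum-tabulate-lookup f (t ∷ ts) = cong (f t +_) (sum-tabulate-lookup f ts)

  edges-graph : ∀ ts → edges (graph ts) ≡ pairs ts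
  edges-graph ts = trans (tabulated ts) (counted ts)
    where
    row : ∀ ts → Fin (length ts) → Fin (length ts) → ℕ
    row ts i j = if (toℕ i <ᵇ toℕ j) ∧ (lookup ts i ~ lookup ts j) then 1 else 0
    tabulated : ∀ ts → edges (graph ts) ≡ sum (tabulate (λ i → sum (tabulate (row ts i))))
    tabulated ts = cong sum (trans (map-tabulate id _)
      (≡-sym (trans (≡-sym (map-tabulate id _)) (trans (map-cong (λ i → cong sum (≡-sym (map-tabulate id (row ts i)))) (allFin _)) (map-tabulate id _)))))
    counted : ∀ ts → sum (tabulate (λ i → sum (tabulate (row ts i)))) ≡ pairs ts
    counted []       = refl
    counted (t ∷ ts) = cong₂ _+_ (sum-tabulate-lookup (λ u → 𝟙 (t ~ u)) ts) (counted ts)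

  -- Only an inequality, since pairs inside `xs` are discarded: the edge bound counts edges between
  -- different parts alone.
  pairs-++ : ∀ xs ys → cross xs ys + pairs ys ≤ pairs (xs ++ ys)
  pairs-++ []       ys = ≤-refl
  pairs-++ (x ∷ xs) ys = begin
    degree x ys + cross xs ys + pairs ys                 ≡⟨ +-assoc (degree x ys) _ _ ⟩
    degree x ys + (cross xs ys + pairs ys)               ≤⟨ +-mono-≤ (m≤n+m _ (degree x xs)) (pairs-++ xs ys) ⟩
    degree x xs + degree x ys + pairs (xs ++ ys)         ≡⟨ cong (_+ pairs (xs ++ ys)) (≡-sym (sum-map-++ _ xs ys)) ⟩
    degree x (xs ++ ys) + pairs (xs ++ ys)               ∎
    where open ≤-Reasoning

  degree-++ : ∀ t xs ys → degree t (xs ++ ys) ≡ degree t xs + degree t ys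
  degree-++ t = sum-map-++ (λ u → 𝟙 (t ~ u))

-- Passes from a set of vertices to a function on types. With g the indicator of the types that S
-- meets, S is in effect enlarged to all copies of its types, and the measure bounds apply.
∣S∣≤sum : {V : Set} (g : V → ℕ) (ts : List V) (S : Subset (length ts)) →
  (∀ i → i ∈ S → 1 ≤ g (lookup ts i)) → ∣ S ∣ ≤ sum (map g ts)
∣S∣≤sum g []       []          H = z≤n
∣S∣≤sum g (t ∷ ts) (true ∷ S)  H = +-mono-≤ (H fzero Vec.here) (∣S∣≤sum g ts S (λ i i∈S → H (fsuc i) (Vec.there i∈S)))
∣S∣≤sum g (t ∷ ts) (false ∷ S) H = ≤-trans (∣S∣≤sum g ts S (λ i i∈S → H (fsuc i) (Vec.there i∈S))) (m≤n+m _ (g t))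


-- The graph with parts I, J, X and Y

data VertexType (h : ℕ) : Set where
  I J spare : VertexType h
  X Y       : Vec ℤ h → VertexType h

private
  -- An embedding along which decidable equality is pulled back; it is needed to decide which types
  -- an independent set meets.
  code : ∀ {h} → VertexType h → Fin 5 × Vec ℤ h
  code I     = fzero , Vec.replicate _ 0ℤ
  code J     = fsuc fzero , Vec.replicate _ 0ℤ
  code spare = fsuc (fsuc fzero) , Vec.replicate _ 0ℤ
  code (X x) = fsuc (fsuc (fsuc fzero)) , x
  code (Y y) = fsuc (fsuc (fsuc (fsuc fzero))) , y

  decode : ∀ {h} → Fin 5 × Vec ℤ h → VertexType h
  decode (fzero , _)                              = I
  decode (fsuc fzero , _)                         = J
  decode (fsuc (fsuc fzero) , _)                  = spare
  decode (fsuc (fsuc (fsuc fzero)) , x)           = X x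
  decode (fsuc (fsuc (fsuc (fsuc fzero))) , y)    = Y y

  decode-code : ∀ {h} (t : VertexType h) → decode (code t) ≡ t
  decode-code I     = refl
  decode-code J     = refl
  decode-code spare = refl
  decode-code (X x) = refl
  decode-code (Y y) = refl

_≟ᵛ_ : ∀ {h} (s t : VertexType h) → Dec (s ≡ t)
s ≟ᵛ t = map′ (λ eq → trans (≡-sym (decode-code s)) (trans (cong decode eq) (decode-code t))) (cong code)
  (×-≡-dec FinP._≟_ (Vec-≡-dec ℤP._≟_) (code s) (code t))

module Construction (a k ℓ p q D : ℕ) .{{a≢0 : NonZero a}} .{{p≢0 : NonZero p}} .{{q≢0 : NonZero q}}
  (p≡ : p ≡ 16 * (a * a)) (q≡ : q ≡ 576 * (p * p)) (D≡ : D ≡ p * (576 * suc (ℓ + ℓ)))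
  (k+k≤p : k + k ≤ p) (k≤2^ℓ : k ≤ 2 ^ ℓ) (k-large : 20736 * suc (ℓ + ℓ) ≤ k) where

  open SphereGraph a k ℓ p q D p≡ q≡ D≡ k+k≤p k≤2^ℓ k-large public

  _~_ : VertexType h → VertexType h → Bool
  I   ~ J   = true
  J   ~ I   = true
  I   ~ X _ = true
  X _ ~ I   = true
  J   ~ Y _ = true
  Y _ ~ J   = true
  X x ~ X y = antipodal x y
  Y x ~ Y y = antipodal x y
  X x ~ Y y = far x y
  Y y ~ X x = far x y
  _   ~ _   = false

  ~-sym : ∀ s t → (s ~ t) ≡ (t ~ s)
  ~-sym I     I     = refl
  ~-sym I     J     = refl
  ~-sym I     spare = refl
  ~-sym I     (X _) = refl
  ~-sym I     (Y _) = refl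
  ~-sym J     I     = refl
  ~-sym J     J     = refl
  ~-sym J     spare = refl
  ~-sym J     (X _) = refl
  ~-sym J     (Y _) = refl
  ~-sym spare I     = refl
  ~-sym spare J     = refl
  ~-sym spare spare = refl
  ~-sym spare (X _) = refl
  ~-sym spare (Y _) = refl
  ~-sym (X _) I     = refl
  ~-sym (X _) J     = refl
  ~-sym (X _) spare = refl
  ~-sym (X x) (X y) = antipodal-sym x y
  ~-sym (X _) (Y _) = refl
  ~-sym (Y _) I     = refl
  ~-sym (Y _) J     = refl
  ~-sym (Y _) spare = refl
  ~-sym (Y _) (X _) = refl
  ~-sym (Y x) (Y y) = antipodal-sym x y

  ~-irrefl : ∀ t → (t ~ t) ≡ false
  ~-irrefl I     = refl
  ~-irrefl J     = refl
  ~-irrefl spare = refl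
  ~-irrefl (X x) = antipodal-irrefl x
  ~-irrefl (Y y) = antipodal-irrefl y

  open TypedGraph _~_ ~-sym ~-irrefl public

  -- The neighbourhood of I consists of J and X, with no edges between them, and that of J of I and
  -- Y. So a K₄ through I or J has its other three vertices in X or in Y, a triangle. Otherwise
  -- three vertices share a part, or the split is two and two.
  no-clique : ∀ r s t u → (r ~ s) ≡ true → (r ~ t) ≡ true → (r ~ u) ≡ true →
    (s ~ t) ≡ true → (s ~ u) ≡ true → (t ~ u) ≡ true → ⊥
  no-clique I     (X x) (X y) (X z) _  _  _  xy xz yz = no-triangle x y z xy xz yz
  no-clique (X x) I     (X y) (X z) _  xy xz _  _  yz = no-triangle x y z xy xz yz
  no-clique (X x) (X y) I     (X z) xy _  xz _  yz _  = no-triangle x y z xy xz yz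
  no-clique (X x) (X y) (X z) I     xy xz _  yz _  _  = no-triangle x y z xy xz yz
  no-clique J     (Y x) (Y y) (Y z) _  _  _  xy xz yz = no-triangle x y z xy xz yz
  no-clique (Y x) J     (Y y) (Y z) _  xy xz _  _  yz = no-triangle x y z xy xz yz
  no-clique (Y x) (Y y) J     (Y z) xy _  xz _  yz _  = no-triangle x y z xy xz yz
  no-clique (Y x) (Y y) (Y z) J     xy xz _  yz _  _  = no-triangle x y z xy xz yz
  no-clique (X x) (X y) (X z) (X _) xy xz _  yz _  _  = no-triangle x y z xy xz yz
  no-clique (X x) (X y) (X z) (Y _) xy xz _  yz _  _  = no-triangle x y z xy xz yz
  no-clique (X x) (X y) (Y _) (X z) xy _  xz _  yz _  = no-triangle x y z xy xz yz
  no-clique (X x) (Y _) (X y) (X z) _  xy xz _  _  yz = no-triangle x y z xy xz yz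
  no-clique (Y _) (X x) (X y) (X z) _  _  _  xy xz yz = no-triangle x y z xy xz yz
  no-clique (Y x) (Y y) (Y z) (Y _) xy xz _  yz _  _  = no-triangle x y z xy xz yz
  no-clique (Y x) (Y y) (Y z) (X _) xy xz _  yz _  _  = no-triangle x y z xy xz yz
  no-clique (Y x) (Y y) (X _) (Y z) xy _  xz _  yz _  = no-triangle x y z xy xz yz
  no-clique (Y x) (X _) (Y y) (Y z) _  xy xz _  _  yz = no-triangle x y z xy xz yz
  no-clique (X _) (Y x) (Y y) (Y z) _  _  _  xy xz yz = no-triangle x y z xy xz yz
  no-clique (X x) (X v) (Y y) (Y z) xv xy xz vy vz yz = no-rectangle x v y z xv yz xy xz vy vz
  no-clique (X x) (Y y) (X v) (Y z) xy xv xz vy yz vz = no-rectangle x v y z xv yz xy xz vy vz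
  no-clique (X x) (Y y) (Y z) (X v) xy xz xv yz vy vz = no-rectangle x v y z xv yz xy xz vy vz
  no-clique (Y y) (X x) (X v) (Y z) xy vy yz xv xz vz = no-rectangle x v y z xv yz xy xz vy vz
  no-clique (Y y) (X x) (Y z) (X v) xy yz vy xz xv vz = no-rectangle x v y z xv yz xy xz vy vz
  no-clique (Y y) (Y z) (X x) (X v) yz xy vy xz vz xv = no-rectangle x v y z xv yz xy xz vy vz

  no-clique I J     _ J _ _ _ _ () _
  no-clique I (X _) _ J _ _ _ _ () _
  no-clique J I     _ I _ _ _ _ () _
  no-clique J (Y _) _ I _ _ _ _ () _

  no-K4 : ∀ ts → ¬ HasK4 (graph ts)
  no-K4 ts (a , b , c , d , ab , ac , ad , bc , bd , cd) =
    no-clique (lookup ts a) (lookup ts b) (lookup ts c) (lookup ts d) ab ac ad bc bd cd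

  -- N is the intended size of X and of Y and `n₁` their size after rounding; the r isolated `spare`
  -- vertices make up the difference to the required order.
  module Vertices (m r N : ℕ) where

    instance
      H-nonZero : NonZero H
      H-nonZero = H≢0

    points : List (Vec ℤ h)
    points = sample N H μ

    n₁ classes : ℕ
    n₁ = length points
    classes = length μ

    sideY sideXY sideJ types : List (VertexType h)
    sideY  = map Y points ++ replicate r spare
    sideXY = map X points ++ sideY
    sideJ  = replicate m J ++ sideXY
    types  = replicate m I ++ sideJ

    length-types : length types ≡ m + (m + (n₁ + (n₁ + r)))
    length-types =
      trans (length-++ (replicate m I)) (cong₂ _+_ (length-replicate m)
        (trans (length-++ (replicate m J)) (cong₂ _+_ (length-replicate m)
          (trans (length-++ (map X points)) (cong₂ _+_ (length-map X points)
            (trans (length-++ (map Y points)) (cong₂ _+_ (length-map Y points) (length-replicate r))))))))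

    sum-points : (f : VertexType h → ℕ) →
      sum (map f types) ≡ m * f I + (m * f J + (sum (map (f ∘ X) points) + (sum (map (f ∘ Y) points) + r * f spare)))
    sum-points f =
      trans (sum-map-++ f (replicate m I) _) (cong₂ _+_ (sum-replicate f m I)
        (trans (sum-map-++ f (replicate m J) _) (cong₂ _+_ (sum-replicate f m J)
          (trans (sum-map-++ f (map X points) _) (cong₂ _+_ (cong sum (≡-sym (map-∘ points)))
            (trans (sum-map-++ f (map Y points) _) (cong₂ _+_ (cong sum (≡-sym (map-∘ points))) (sum-replicate f r spare))))))))

    n₁≤N : n₁ ≤ N
    n₁≤N = *-cancelˡ-≤ H (begin
      H * n₁                               ≡⟨ cong (H *_) (≡-sym (trans (sum-map-const 1 points) (*-identityʳ n₁))) ⟩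
      H * sum (map (λ _ → 1) points)       ≤⟨ sample-upper N H μ (λ _ → 1) ⟩
      N * H                                ≡⟨ *-comm N H ⟩
      H * N                                ∎)
      where open ≤-Reasoning

    N≤n₁+classes : N ≤ n₁ + classes
    N≤n₁+classes = *-cancelˡ-≤ H (begin
      H * N                                              ≡⟨ *-comm H N ⟩
      N * H                                              ≤⟨ sample-lower N H μ (λ _ → 1) 1 (λ _ → ≤-refl) ⟩
      H * (sum (map (λ _ → 1) points) + classes * 1)     ≡⟨ cong₂ (λ s t → H * (s + t)) (trans (sum-map-const 1 points) (*-identityʳ n₁)) (*-identityʳ classes) ⟩
      H * (n₁ + classes)                                 ∎)
      where open ≤-Reasoning

    -- S meets only one of I and J, as they are completely joined. The points that it uses in X, or
    -- in Y, form an independent set, of measure at most 4H/k, and so account for at most 4N/k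
    -- vertices.
    independent-bound : ∀ S → Independent (graph types) S → k * ∣ S ∣ ≤ k * m + 8 * N + k * r
    independent-bound S independent = begin
      k * ∣ S ∣                      ≤⟨ *-monoʳ-≤ k (∣S∣≤sum g types S (λ i i∈S → ≤-reflexive (≡-sym (cong 𝟙 (hit-present i i∈S))))) ⟩
      k * sum (map g types)          ≡⟨ cong (k *_) (sum-points g) ⟩
      k * (m * g I + (m * g J + (x + (y + r * g spare)))) ≡⟨ lemma₁ k m (g I) (g J) x y r (g spare) ⟩
      k * m * (g I + g J) + (k * x + k * y) + k * r * g spare
                                     ≤⟨ +-mono-≤ (+-mono-≤ (*-monoʳ-≤ (k * m) I-or-J) (+-mono-≤ (side X X-independent) (side Y Y-independent))) (*-monoʳ-≤ (k * r) (𝟙≤1 (present spare))) ⟩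
      k * m * 1 + (4 * N + 4 * N) + k * r * 1 ≡⟨ lemma₂ (k * m) N (k * r) ⟩
      k * m + 8 * N + k * r          ∎
      where
      open ≤-Reasoning
      witness? : ∀ t → Dec (∃ λ i → i ∈ S × lookup types i ≡ t)
      witness? t = any? (λ i → (i ∈? S) ×-dec (lookup types i ≟ᵛ t))
      present : VertexType h → Bool
      present t = does (witness? t)
      g : VertexType h → ℕ
      g t = 𝟙 (present t)
      x y : ℕ
      x = sum (map (g ∘ X) points)
      y = sum (map (g ∘ Y) points)
      hit-present : ∀ i → i ∈ S → present (lookup types i) ≡ true
      hit-present i i∈S = dec-true (witness? (lookup types i)) (i , i∈S , refl)
      nonadjacent : ∀ s t → present s ≡ true → present t ≡ true → (s ~ t) ≡ false
      nonadjacent s t ps pt with witness? s | witness? t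
      ... | yes (i , i∈S , refl) | yes (j , j∈S , refl) = independent i j i∈S j∈S
      I-or-J : g I + g J ≤ 1
      I-or-J with present I in pI | present J in pJ
      ... | false | false = z≤n
      ... | false | true  = ≤-refl
      ... | true  | false = ≤-refl
      ... | true  | true  = case nonadjacent I J pI pJ of λ ()
      X-independent : ∀ x y → present (X x) ≡ true → present (X y) ≡ true → antipodal x y ≡ false
      X-independent x y = nonadjacent (X x) (X y)
      Y-independent : ∀ x y → present (Y x) ≡ true → present (Y y) ≡ true → antipodal x y ≡ false
      Y-independent x y = nonadjacent (Y x) (Y y)
      side : (Z : Vec ℤ h → VertexType h) → (∀ x y → present (Z x) ≡ true → present (Z y) ≡ true → antipodal x y ≡ false) →
        k * sum (map (g ∘ Z) points) ≤ 4 * N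
      side Z ind = *-cancelˡ-≤ H (begin
        H * (k * sum (map (g ∘ Z) points))      ≡⟨ lemma H k _ ⟩
        k * (H * sum (map (g ∘ Z) points))      ≤⟨ *-monoʳ-≤ k (sample-upper N H μ (g ∘ Z)) ⟩
        k * (N * ∫ μ (g ∘ Z))                   ≡⟨ lemma k N _ ⟩
        N * (k * ∫ μ (g ∘ Z))                   ≤⟨ *-monoʳ-≤ N (independent-measure (present ∘ Z) ind) ⟩
        N * (4 * H)                             ≡⟨ lemma₃ N H ⟩
        H * (4 * N)                             ∎)
        where
        lemma : ∀ a b c → a * (b * c) ≡ b * (a * c)
        lemma = solve-∀
        lemma₃ : ∀ N H → N * (4 * H) ≡ H * (4 * N)
        lemma₃ = solve-∀
      lemma₁ : ∀ k m a b x y r s → k * (m * a + (m * b + (x + (y + r * s)))) ≡ k * m * (a + b) + (k * x + k * y) + k * r * s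
      lemma₁ = solve-∀
      lemma₂ : ∀ a N b → a * 1 + (4 * N + 4 * N) + b * 1 ≡ a + 8 * N + b
      lemma₂ = solve-∀

    farPairs : ℕ
    farPairs = sum (map (λ x → sum (map (λ y → 𝟙 (far x y)) points)) points)

    -- `sample-lower` in y and then in x. The inner sum is at most N, so each of the two roundings
    -- costs at most `classes` · N pairs.
    farPairs-lower : N * N * ∫ μ farMass ≤ H * H * (farPairs + 2 * (classes * N))
    farPairs-lower = begin
      N * N * ∫ μ farMass                          ≡⟨ trans (*-assoc N N _) (cong (N *_) (≡-sym (∫-*ˡ μ N farMass))) ⟩
      N * ∫ μ (λ x → N * farMass x)                ≤⟨ *-monoʳ-≤ N (∫-mono μ (λ x → sample-lower N H μ (λ y → 𝟙 (far x y)) 1 (λ y → 𝟙≤1 (far x y)))) ⟩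
      N * ∫ μ (λ x → H * (φ x + classes * 1))      ≡⟨ cong (N *_) (trans (∫-*ˡ μ H _) (cong (H *_) (trans (∫-+ μ φ _) (cong (∫ μ φ +_) (∫-const μ (classes * 1)))))) ⟩
      N * (H * (∫ μ φ + classes * 1 * H))          ≡⟨ lemma₁ N H (∫ μ φ) classes ⟩
      H * (N * ∫ μ φ) + H * H * (classes * N)      ≤⟨ +-monoˡ-≤ _ (*-monoʳ-≤ H (sample-lower N H μ φ N φ≤N)) ⟩
      H * (H * (farPairs + classes * N)) + H * H * (classes * N) ≡⟨ lemma₂ H farPairs (classes * N) ⟩
      H * H * (farPairs + 2 * (classes * N))       ∎
      where
      open ≤-Reasoning
      φ : Vec ℤ h → ℕ
      φ x = sum (map (λ y → 𝟙 (far x y)) points)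
      φ≤N : ∀ x → φ x ≤ N
      φ≤N x = ≤-trans (sum-map-mono points (λ y → 𝟙≤1 (far x y))) (≤-trans (≤-reflexive (trans (sum-map-const 1 points) (*-identityʳ n₁))) n₁≤N)
      lemma₁ : ∀ N H f c → N * (H * (f + c * 1 * H)) ≡ H * (N * f) + H * H * (c * N)
      lemma₁ = solve-∀
      lemma₂ : ∀ H f c → H * (H * (f + c)) + H * H * c ≡ H * H * (f + 2 * c)
      lemma₂ = solve-∀

    edges-lower : m * m + 2 * (m * n₁) + farPairs ≤ edges (graph types)
    edges-lower = begin
      m * m + 2 * (m * n₁) + farPairs                                                         ≡⟨ lemma m n₁ farPairs ⟩
      m * (m + n₁) + (m * n₁ + (farPairs + 0))                                                ≤⟨ +-mono-≤ I-edges (+-mono-≤ J-edges (+-mono-≤ X-edges z≤n)) ⟩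
      cross (replicate m I) sideJ + (cross (replicate m J) sideXY + (cross (map X points) sideY + pairs sideY))
                                                                                              ≤⟨ +-monoʳ-≤ (cross (replicate m I) sideJ) (+-monoʳ-≤ (cross (replicate m J) sideXY) (pairs-++ (map X points) sideY)) ⟩
      cross (replicate m I) sideJ + (cross (replicate m J) sideXY + pairs sideXY)             ≤⟨ +-monoʳ-≤ (cross (replicate m I) sideJ) (pairs-++ (replicate m J) sideXY) ⟩
      cross (replicate m I) sideJ + pairs sideJ                                               ≤⟨ pairs-++ (replicate m I) sideJ ⟩
      pairs types                                                                             ≡⟨ ≡-sym (edges-graph types) ⟩
      edges (graph types)                                                                     ∎
      where
      open ≤-Reasoning
      lemma : ∀ m n f → m * m + 2 * (m * n) + f ≡ m * (m + n) + (m * n + (f + 0))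
      lemma = solve-∀
      complete : ∀ t (Z : Vec ℤ h → VertexType h) → (∀ x → (t ~ Z x) ≡ true) → n₁ ≡ degree t (map Z points)
      complete t Z full = ≡-sym (trans (cong sum (trans (≡-sym (map-∘ points)) (map-cong (λ x → cong 𝟙 (full x)) points)))
        (trans (sum-map-const 1 points) (*-identityʳ n₁)))
      I-edges : m * (m + n₁) ≤ cross (replicate m I) sideJ
      I-edges = begin
        m * (m + n₁)                                                  ≤⟨ *-monoʳ-≤ m (+-mono-≤
              (≤-reflexive (≡-sym (trans (sum-replicate (λ u → 𝟙 (I ~ u)) m J) (*-identityʳ m))))
              (≤-trans (≤-reflexive (complete I X (λ _ → refl))) (m≤m+n _ _))) ⟩
        m * (degree I (replicate m J) + (degree I (map X points) + degree I sideY)) ≡⟨ cong (λ s → m * (degree I (replicate m J) + s)) (≡-sym (degree-++ I (map X points) sideY)) ⟩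
        m * (degree I (replicate m J) + degree I sideXY)              ≡⟨ cong (m *_) (≡-sym (degree-++ I (replicate m J) sideXY)) ⟩
        m * degree I sideJ                                            ≡⟨ ≡-sym (sum-replicate (λ t → degree t sideJ) m I) ⟩
        cross (replicate m I) sideJ                                   ∎
      J-edges : m * n₁ ≤ cross (replicate m J) sideXY
      J-edges = begin
        m * n₁                                                        ≤⟨ *-monoʳ-≤ m (≤-trans (≤-reflexive (complete J Y (λ _ → refl))) (m≤m+n _ _)) ⟩
        m * (degree J (map Y points) + degree J (replicate r spare))  ≡⟨ cong (m *_) (≡-sym (degree-++ J (map Y points) _)) ⟩
        m * degree J sideY                                            ≤⟨ *-monoʳ-≤ m (m≤n+m _ (degree J (map X points))) ⟩
        m * (degree J (map X points) + degree J sideY)                ≡⟨ cong (m *_) (≡-sym (degree-++ J (map X points) _)) ⟩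
        m * degree J sideXY                                           ≡⟨ ≡-sym (sum-replicate (λ t → degree t sideXY) m J) ⟩
        cross (replicate m J) sideXY                                  ∎
      X-edges : farPairs ≤ cross (map X points) sideY
      X-edges = begin
        farPairs                                                      ≤⟨ sum-map-mono points (λ x → begin
            sum (map (λ y → 𝟙 (far x y)) points)                        ≡⟨ cong sum (map-∘ points) ⟩
            degree (X x) (map Y points)                                 ≤⟨ m≤m+n _ _ ⟩
            degree (X x) (map Y points) + degree (X x) (replicate r spare) ≡⟨ ≡-sym (degree-++ (X x) (map Y points) _) ⟩
            degree (X x) sideY                                          ∎) ⟩
        sum (map (λ x → degree (X x) sideY) points)                   ≡⟨ cong sum (map-∘ points) ⟩
        cross (map X points) sideY                                    ∎


-- Arithmetic of the parameters

-- Everything is multiplied by 24E, where 1/E is the permitted error. Five terms mn are lost: one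
-- each to η, to the strip and to the rounding of the sample, and two to the parity of n; there is
-- room for 24.
edge-count-arithmetic : ∀ {n m m′ η N n₁ Q F e E} →
  3 * m ≤ n → m′ + η ≡ m → n ≤ suc (2 * (N + m′)) → 2 * (N + m′) ≤ n → N ≤ n₁ + Q →
  m′ * m′ + 2 * (m′ * n₁) + F ≤ e → 12 * E * (N * N) ≤ 24 * E * (F + 2 * (Q * N)) + m * n →
  48 * E * Q ≤ m → 8 * E * η ≤ m → 12 * E ≤ m →
  3 * E * (n * n) + 8 * E * (m * n) ≤ 24 * E * e + 24 * (m * n)
edge-count-arithmetic {n} {m} {m′} {η} {N} {n₁} {Q} {F} {e} {E} 3m≤n m≡ n≤ ≤n N≤ e≥ N²≤ hQ hη hE = begin
  3 * E * (n * n) + 8 * E * (m * n)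
    ≡⟨ cong (λ z → 3 * E * (n * n) + 8 * E * (z * n)) (≡-sym m≡) ⟩
  3 * E * (n * n) + 8 * E * ((m′ + η) * n)
    ≡⟨ lemma₁ E n m′ η ⟩
  E * (3 * (n * n)) + (E * m′ * (8 * n) + 8 * E * η * n)
    ≤⟨ +-mono-≤ (*-monoʳ-≤ E n²≤) (+-mono-≤ (*-monoʳ-≤ (E * m′) 8n≤) (*-monoˡ-≤ n hη)) ⟩
  E * (12 * (t * t) + 6 * n) + (E * m′ * (24 * N + 12 * m′ + 12) + m * n)
    ≡⟨ lemma₂ E N m′ n (m * n) ⟩
  12 * E * (N * N) + (24 * E * (m′ * m′) + 48 * E * m′ * N) + (6 * E * n + 12 * E * m′ + m * n)
    ≤⟨ +-monoˡ-≤ _ (+-mono-≤ N²≤ (+-monoʳ-≤ (24 * E * (m′ * m′)) (*-monoʳ-≤ (48 * E * m′) N≤))) ⟩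
  24 * E * (F + 2 * (Q * N)) + m * n + (24 * E * (m′ * m′) + 48 * E * m′ * (n₁ + Q)) + (6 * E * n + 12 * E * m′ + m * n)
    ≡⟨ lemma₃ E F Q N m′ n₁ n (m * n) ⟩
  24 * E * (m′ * m′ + 2 * (m′ * n₁) + F) + (48 * E * Q * t + 6 * E * n + 12 * E * m′ + 2 * (m * n))
    ≤⟨ +-mono-≤ (*-monoʳ-≤ (24 * E) e≥) (+-monoˡ-≤ (2 * (m * n)) (+-mono-≤ (+-mono-≤
         (*-mono-≤ hQ (≤-trans (m≤n*m t 2) ≤n))
         (*-monoˡ-≤ n (≤-trans (*-monoˡ-≤ E (m≤m+n 6 6)) hE)))
         (*-mono-≤ hE (≤-trans m′≤m m≤n)))) ⟩
  24 * E * e + (m * n + m * n + m * n + 2 * (m * n))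
    ≤⟨ +-monoʳ-≤ (24 * E * e) (≤-trans (≤-reflexive (lemma₄ (m * n))) (*-monoˡ-≤ (m * n) (m≤m+n 5 19))) ⟩
  24 * E * e + 24 * (m * n) ∎
  where
  open ≤-Reasoning
  t = N + m′
  m≤n : m ≤ n
  m≤n = ≤-trans (m≤n*m m 3) 3m≤n
  m′≤m : m′ ≤ m
  m′≤m = subst (m′ ≤_) m≡ (m≤m+n m′ η)
  n²≤ : 3 * (n * n) ≤ 12 * (t * t) + 6 * n
  n²≤ = begin
    3 * (n * n)                            ≤⟨ *-monoʳ-≤ 3 (*-monoʳ-≤ n n≤) ⟩
    3 * (n * suc (2 * t))                  ≡⟨ lemma n t ⟩
    6 * t * n + 3 * n                      ≤⟨ +-monoˡ-≤ (3 * n) (*-monoʳ-≤ (6 * t) n≤) ⟩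
    6 * t * suc (2 * t) + 3 * n            ≡⟨ lemma′ n t ⟩
    12 * (t * t) + 3 * (2 * t) + 3 * n     ≤⟨ +-monoˡ-≤ (3 * n) (+-monoʳ-≤ (12 * (t * t)) (*-monoʳ-≤ 3 ≤n)) ⟩
    12 * (t * t) + 3 * n + 3 * n           ≡⟨ lemma″ n t ⟩
    12 * (t * t) + 6 * n                   ∎
    where
    lemma : ∀ n t → 3 * (n * suc (2 * t)) ≡ 6 * t * n + 3 * n
    lemma = solve-∀
    lemma′ : ∀ n t → 6 * t * suc (2 * t) + 3 * n ≡ 12 * (t * t) + 3 * (2 * t) + 3 * n
    lemma′ = solve-∀
    lemma″ : ∀ n t → 12 * (t * t) + 3 * n + 3 * n ≡ 12 * (t * t) + 6 * n
    lemma″ = solve-∀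
  -- The only use of m ≤ n/3 beyond m ≤ n: 8n = 12n - 4n, with 12n ≤ 24(N + m′) + 12 and 4n ≥ 12m′.
  8n≤ : 8 * n ≤ 24 * N + 12 * m′ + 12
  8n≤ = cancel-≤ 0 (+-mono-≤ (*-monoʳ-≤ 12 n≤) (*-monoʳ-≤ 4 (≤-trans (*-monoʳ-≤ 3 m′≤m) 3m≤n))) (lemma n N m′)
    where
    lemma : ∀ n N m′ → 8 * n + (12 * suc (2 * (N + m′)) + 4 * n) + 0 ≡ 24 * N + 12 * m′ + 12 + (12 * n + 4 * (3 * m′))
    lemma = solve-∀
  lemma₁ : ∀ E n m′ η → 3 * E * (n * n) + 8 * E * ((m′ + η) * n) ≡ E * (3 * (n * n)) + (E * m′ * (8 * n) + 8 * E * η * n)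
  lemma₁ = solve-∀
  lemma₂ : ∀ E N m′ n z → E * (12 * ((N + m′) * (N + m′)) + 6 * n) + (E * m′ * (24 * N + 12 * m′ + 12) + z)
    ≡ 12 * E * (N * N) + (24 * E * (m′ * m′) + 48 * E * m′ * N) + (6 * E * n + 12 * E * m′ + z)
  lemma₂ = solve-∀
  lemma₃ : ∀ E F Q N m′ n₁ n z → 24 * E * (F + 2 * (Q * N)) + z + (24 * E * (m′ * m′) + 48 * E * m′ * (n₁ + Q)) + (6 * E * n + 12 * E * m′ + z)
    ≡ 24 * E * (m′ * m′ + 2 * (m′ * n₁) + F) + (48 * E * Q * (N + m′) + 6 * E * n + 12 * E * m′ + 2 * z)
  lemma₃ = solve-∀
  lemma₄ : ∀ z → z + z + z + 2 * z ≡ 5 * z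
  lemma₄ = solve-∀

2^⌊log₂n⌋≤n : ∀ n .{{_ : NonZero n}} → 2 ^ ⌊log₂ n ⌋ ≤ n
2^⌊log₂n⌋≤n n = go n n ≤-refl
  where
  open ≤-Reasoning
  go : ∀ b n .{{_ : NonZero n}} → n ≤ b → 2 ^ ⌊log₂ n ⌋ ≤ n
  go b       1             _         = ≤-refl
  go (suc b) (suc (suc n)) (s≤s n<b) = begin
    2 ^ ⌊log₂ n+2 ⌋            ≡⟨ cong (2 ^_) log≡ ⟩
    2 * 2 ^ ⌊log₂ half ⌋       ≤⟨ *-monoʳ-≤ 2 (go b half (≤-trans (s≤s (⌊n/2⌋≤n n)) n<b)) ⟩
    2 * half                   ≡⟨ cong (half +_) (+-identityʳ half) ⟩
    half + half                ≤⟨ +-monoʳ-≤ half (⌊n/2⌋≤⌈n/2⌉ n+2) ⟩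
    half + ⌈ n+2 /2⌉           ≡⟨ ⌊n/2⌋+⌈n/2⌉≡n n+2 ⟩
    n+2                        ∎
    where
    n+2 half : ℕ
    n+2 = suc (suc n)
    half = suc ⌊ n /2⌋
    log≡ : ⌊log₂ n+2 ⌋ ≡ suc ⌊log₂ half ⌋
    log≡ = ≡-sym (trans (cong suc (⌊log₂⌊n/2⌋⌋≡⌊log₂n⌋∸1 n+2)) (m+[n∸m]≡n (⌊log₂⌋-mono-≤ {2} {n+2} (s≤s (s≤s z≤n)))))

n<2^1+⌊log₂n⌋ : ∀ n → n < 2 ^ suc ⌊log₂ n ⌋
n<2^1+⌊log₂n⌋ n = ≰⇒> (λ le → <⇒≱ (n<1+n ⌊log₂ n ⌋)
  (subst (_≤ ⌊log₂ n ⌋) (⌊log₂[2^n]⌋≡n (suc ⌊log₂ n ⌋)) (⌊log₂⌋-mono-≤ le)))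

exponential-beats-square : ∀ c b → 3 ≤ b → c * (b * b) ≤ 2 ^ b → ∀ {n} → b ≤ n → c * (n * n) ≤ 2 ^ n
exponential-beats-square c b 3≤b base {n} b≤n = subst (λ n → c * (n * n) ≤ 2 ^ n) (m∸n+n≡m b≤n) (go (n ∸ b))
  where
  open ≤-Reasoning
  doubling : ∀ {m} → 3 ≤ m → suc m * suc m ≤ 2 * (m * m)
  doubling {suc (suc (suc m))} (s≤s (s≤s (s≤s z≤n))) =
    ≤-trans (m≤m+n _ (m * m + 4 * m + 2)) (≤-reflexive (lemma m))
    where
    lemma : ∀ m → (4 + m) * (4 + m) + (m * m + 4 * m + 2) ≡ 2 * ((3 + m) * (3 + m))
    lemma = solve-∀
  go : ∀ j → c * ((j + b) * (j + b)) ≤ 2 ^ (j + b)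
  go zero    = base
  go (suc j) = begin
    c * (suc (j + b) * suc (j + b))      ≤⟨ *-monoʳ-≤ c (doubling (≤-trans 3≤b (m≤n+m b j))) ⟩
    c * (2 * ((j + b) * (j + b)))        ≡⟨ lemma c _ ⟩
    2 * (c * ((j + b) * (j + b)))        ≤⟨ *-monoʳ-≤ 2 (go j) ⟩
    2 * 2 ^ (j + b)                      ∎
    where
    lemma : ∀ c z → c * (2 * z) ≡ 2 * (c * z)
    lemma = solve-∀


-- Adjusting the graph to n vertices and independence number below m

module Realization (a k ℓ p q D : ℕ) .{{a≢0 : NonZero a}} .{{p≢0 : NonZero p}} .{{q≢0 : NonZero q}}
  (p≡ : p ≡ 16 * (a * a)) (q≡ : q ≡ 576 * (p * p)) (D≡ : D ≡ p * (576 * suc (ℓ + ℓ)))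
  (k+k≤p : k + k ≤ p) (k≤2^ℓ : k ≤ 2 ^ ℓ) (k-large : 20736 * suc (ℓ + ℓ) ≤ k) where

  open Construction a k ℓ p q D p≡ q≡ D≡ k+k≤p k≤2^ℓ k-large public

  k≢0 : NonZero k
  k≢0 = >-nonZero (≤-trans (s≤s z≤n) k-large)

  length-μ : length μ ≡ suc p ^ h
  length-μ = trans (length-power (binomial p) h) (cong (_^ h) (length-binomial p))

  -- For a good x the strip has relative measure at most m/(Kn). For a bad x it may be everything,
  -- but bad points have relative measure at most 3/k ≤ 3m/(Kn).
  central-total : ∀ K n m → (∀ x → isBad x ≡ false → K * n * centralMass x ≤ H * m) → K * n ≤ k * m →
    K * n * ∫ μ centralMass ≤ 4 * (H * H * m)
  central-total K n m good Kn≤km = begin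
    K * n * ∫ μ centralMass                              ≡⟨ ≡-sym (∫-*ˡ μ (K * n) centralMass) ⟩
    ∫ μ (λ x → K * n * centralMass x)                    ≤⟨ ∫-mono μ pointwise ⟩
    ∫ μ (λ x → H * m + K * n * H * 𝟙 (isBad x))          ≡⟨ trans (∫-+ μ _ _) (cong₂ _+_ (∫-const μ (H * m)) (∫-*ˡ μ (K * n * H) _)) ⟩
    H * m * H + K * n * H * β                            ≤⟨ +-monoʳ-≤ (H * m * H) (*-monoˡ-≤ β (*-monoˡ-≤ H Kn≤km)) ⟩
    H * m * H + k * m * H * β                            ≡⟨ cong (H * m * H +_) (lemma₁ k m H β) ⟩
    H * m * H + m * H * (k * β)                          ≤⟨ +-monoʳ-≤ (H * m * H) (*-monoʳ-≤ (m * H) few-bad) ⟩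
    H * m * H + m * H * (3 * H)                          ≡⟨ lemma₂ H m ⟩
    4 * (H * H * m)                                      ∎
    where
    open ≤-Reasoning
    β = ∫ μ (𝟙 ∘ isBad)
    pointwise : ∀ x → K * n * centralMass x ≤ H * m + K * n * H * 𝟙 (isBad x)
    pointwise x = split (isBad x) refl
      where
      split : ∀ b → isBad x ≡ b → K * n * centralMass x ≤ H * m + K * n * H * 𝟙 b
      split false eq = ≤-trans (good x eq) (m≤m+n (H * m) _)
      split true  _  = ≤-trans (*-monoʳ-≤ (K * n) (centralMass≤H x)) (≤-trans (≤-reflexive (≡-sym (*-identityʳ _))) (m≤n+m _ (H * m)))
    lemma₁ : ∀ k m H β → k * m * H * β ≡ m * H * (k * β)
    lemma₁ = solve-∀
    lemma₂ : ∀ H m → H * m * H + m * H * (3 * H) ≡ 4 * (H * H * m)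
    lemma₂ = solve-∀

  -- 144 = 9 · 16: an independent set exceeds m′ by at most 7m/K, of which 4 are due to X and Y and
  -- 3 to the spare vertices, while η > m/(16E) = 9m/K.
  module Count (n m E K : ℕ) .{{n≢0 : NonZero n}} .{{E≢0 : NonZero E}} (K≡ : K ≡ 144 * E)
    (3m≤n : 3 * m ≤ n) (Kn≤km : K * n ≤ k * m)
    (few-central : K * n * ∫ μ centralMass ≤ 4 * (H * H * m)) (KQ≤m : K * length μ ≤ m) where

    open ≤-Reasoning

    instance
      scale≢0 : NonZero (16 * E)
      scale≢0 = m*n≢0 16 E

      H²≢0 : NonZero (H * H)
      H²≢0 = m*n≢0 H H {{H≢0}} {{H≢0}}

    K≢0 : NonZero K
    K≢0 = subst NonZero (≡-sym K≡) (m*n≢0 144 E)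

    Q : ℕ
    Q = length μ

    1≤Q : 1 ≤ Q
    1≤Q = subst (1 ≤_) (≡-sym length-μ) (m^n>0 (suc p) h)

    K≤m : K ≤ m
    K≤m = ≤-trans (≤-trans (≤-reflexive (≡-sym (*-identityʳ K))) (*-monoʳ-≤ K 1≤Q)) KQ≤m

    ≤K : ∀ c → c ≤ 144 → c * E ≤ K
    ≤K c c≤ = ≤-trans (*-monoˡ-≤ E c≤) (≤-reflexive (≡-sym K≡))

    -- η is the part of m set aside for the independent sets inside X, Y and the spare vertices. The
    -- successor makes it exceed m/(16E) strictly; since 16E ≤ m it stays below m/(8E).
    η m′ N : ℕ
    η  = suc (m / (16 * E))
    m′ = m ∸ η
    N  = (n ∸ 2 * m′) / 2

    η-doubled : 16 * E * η ≤ 2 * m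
    η-doubled = begin
      16 * E * suc (m / (16 * E))           ≡⟨ trans (*-suc (16 * E) _) (cong (16 * E +_) (*-comm (16 * E) _)) ⟩
      16 * E + m / (16 * E) * (16 * E)      ≤⟨ +-mono-≤ (≤-trans (≤K 16 (m≤m+n 16 128)) K≤m) (m/n*n≤m m (16 * E)) ⟩
      m + m                                 ≡⟨ cong (m +_) (≡-sym (+-identityʳ m)) ⟩
      2 * m                                 ∎

    η-small : 8 * E * η ≤ m
    η-small = *-cancelˡ-≤ 2 (≤-trans (≤-reflexive (lemma E η)) η-doubled)
      where
      lemma : ∀ E η → 2 * (8 * E * η) ≡ 16 * E * η
      lemma = solve-∀

    η-large : m < 16 * E * η
    η-large = begin-strict
      m                                             ≡⟨ m≡m%n+[m/n]*n m (16 * E) ⟩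
      m % (16 * E) + m / (16 * E) * (16 * E)        <⟨ +-monoˡ-< _ (m%n<n m (16 * E)) ⟩
      16 * E + m / (16 * E) * (16 * E)              ≡⟨ ≡-sym (trans (*-suc (16 * E) _) (cong (16 * E +_) (*-comm (16 * E) _))) ⟩
      16 * E * η                                    ∎

    m′+η≡m : m′ + η ≡ m
    m′+η≡m = m∸n+n≡m (≤-trans (m≤n*m η (8 * E) {{m*n≢0 8 E}}) η-small)

    m′≤m : m′ ≤ m
    m′≤m = m∸n≤m m η

    2m′≤n : 2 * m′ ≤ n
    2m′≤n = ≤-trans (*-mono-≤ {2} {3} (m≤m+n 2 1) m′≤m) 3m≤n

    n≡ : n ≡ (n ∸ 2 * m′) % 2 + 2 * (N + m′)
    n≡ = trans (≡-sym (m∸n+n≡m 2m′≤n)) (trans (cong (_+ 2 * m′) (m≡m%n+[m/n]*n (n ∸ 2 * m′) 2)) (lemma ((n ∸ 2 * m′) % 2) N m′))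
      where
      lemma : ∀ b N m → b + N * 2 + 2 * m ≡ b + 2 * (N + m)
      lemma = solve-∀

    ≤n : 2 * (N + m′) ≤ n
    ≤n = ≤-trans (m≤n+m (2 * (N + m′)) ((n ∸ 2 * m′) % 2)) (≤-reflexive (≡-sym n≡))

    n≤ : n ≤ suc (2 * (N + m′))
    n≤ = ≤-trans (≤-reflexive n≡) (+-monoˡ-≤ (2 * (N + m′)) (s≤s⁻¹ (m%n<n (n ∸ 2 * m′) 2)))

    2N≤n : 2 * N ≤ n
    2N≤n = ≤-trans (*-monoʳ-≤ 2 (m≤m+n N m′)) ≤n

    N≤n : N ≤ n
    N≤n = ≤-trans (m≤n*m N 2) 2N≤n

    n₁ used r : ℕ
    -- The value 0 for r avoids a circularity: r is determined by n₁, which does not depend on it.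
    n₁   = Vertices.n₁ m′ 0 N
    used = 2 * (n₁ + m′)
    r    = n ∸ used

    open Vertices m′ r N hiding (n₁)

    used≤n : used ≤ n
    used≤n = ≤-trans (*-monoʳ-≤ 2 (+-monoˡ-≤ m′ n₁≤N)) ≤n

    -- Rounding costs up to Q vertices in each of X and Y, and the parity of n costs one more, which
    -- 1 ≤ Q covers.
    r≤3Q : r ≤ 3 * Q
    r≤3Q = m≤n+o⇒m∸n≤o n used (begin
      n                              ≤⟨ n≤ ⟩
      suc (2 * (N + m′))             ≤⟨ s≤s (*-monoʳ-≤ 2 (+-monoˡ-≤ m′ N≤n₁+classes)) ⟩
      suc (2 * (n₁ + Q + m′))        ≡⟨ lemma n₁ Q m′ ⟩
      used + (1 + 2 * Q)             ≤⟨ +-monoʳ-≤ used (+-monoˡ-≤ (2 * Q) 1≤Q) ⟩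
      used + 3 * Q                   ∎)
      where
      lemma : ∀ n Q m → suc (2 * (n + Q + m)) ≡ 2 * (n + m) + (1 + 2 * Q)
      lemma = solve-∀

    order : length types ≡ n
    order = trans length-types (trans (lemma m′ n₁ r) (m+[n∸m]≡n used≤n))
      where
      lemma : ∀ m n r → m + (m + (n + (n + r))) ≡ 2 * (n + m) + r
      lemma = solve-∀

    small-independent-sets : IndepLess (graph types) m
    small-independent-sets S independent = *-cancelˡ-< K ∣ S ∣ m (begin-strict
      K * ∣ S ∣                  ≤⟨ *-cancelˡ-≤ k {{k≢0}} scaled ⟩
      K * m′ + 7 * m             <⟨ +-monoʳ-< (K * m′) (≤-<-trans (*-monoˡ-≤ m (m≤m+n 7 2)) (*-monoʳ-< 9 η-large)) ⟩
      K * m′ + 9 * (16 * E * η)  ≡⟨ cong (K * m′ +_) (trans (lemma E η) (cong (_* η) (≡-sym K≡))) ⟩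
      K * m′ + K * η             ≡⟨ ≡-sym (*-distribˡ-+ K m′ η) ⟩
      K * (m′ + η)               ≡⟨ cong (K *_) m′+η≡m ⟩
      K * m                      ∎)
      where
      lemma : ∀ E η → 9 * (16 * E * η) ≡ 144 * E * η
      lemma = solve-∀
      lemma₁ : ∀ k K s → k * (K * s) ≡ K * (k * s)
      lemma₁ = solve-∀
      lemma₂ : ∀ k K m N r → K * (k * m + 8 * N + k * r) ≡ k * (K * m) + 4 * (K * (2 * N)) + k * (K * r)
      lemma₂ = solve-∀
      lemma₃ : ∀ k z m → k * z + 4 * (k * m) + k * (3 * m) ≡ k * (z + 7 * m)
      lemma₃ = solve-∀
      scaled : k * (K * ∣ S ∣) ≤ k * (K * m′ + 7 * m)
      scaled = begin
        k * (K * ∣ S ∣)                                         ≡⟨ lemma₁ k K ∣ S ∣ ⟩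
        K * (k * ∣ S ∣)                                         ≤⟨ *-monoʳ-≤ K (independent-bound S independent) ⟩
        K * (k * m′ + 8 * N + k * r)                            ≡⟨ lemma₂ k K m′ N r ⟩
        k * (K * m′) + 4 * (K * (2 * N)) + k * (K * r)          ≤⟨ +-mono-≤ (+-monoʳ-≤ (k * (K * m′)) (*-monoʳ-≤ 4 (≤-trans (*-monoʳ-≤ K 2N≤n) Kn≤km)))
                                                                     (*-monoʳ-≤ k (≤-trans (*-monoʳ-≤ K r≤3Q) (≤-trans (≤-reflexive (lemma₁ K 3 Q)) (*-monoʳ-≤ 3 KQ≤m)))) ⟩
        k * (K * m′) + 4 * (k * m) + k * (3 * m)                ≡⟨ lemma₃ k (K * m′) m ⟩
        k * (K * m′ + 7 * m)                                    ∎

    -- `H≤2far+central` integrated over x gives density 1/2 between X and Y, up to rounding and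
    -- 4N²m/(Kn) ≤ 4mn/K for the strip.
    many-far-pairs : 12 * E * (N * N) ≤ 24 * E * (farPairs + 2 * (Q * N)) + m * n
    many-far-pairs = *-cancelˡ-≤ 12 (begin
      12 * (12 * E * (N * N))                             ≡⟨ lemma₁ E (N * N) ⟩
      144 * E * (N * N)                                   ≡⟨ cong (_* (N * N)) (≡-sym K≡) ⟩
      K * (N * N)                                         ≤⟨ *-cancelˡ-≤ n (≤-trans (*-cancelˡ-≤ (H * H) scaled) (≤-trans (+-monoʳ-≤ (2 * (K * n * P)) (*-monoʳ-≤ 4 (*-monoˡ-≤ m (*-mono-≤ N≤n N≤n)))) (≤-reflexive (lemma₂ K n P m)))) ⟩
      2 * (K * P) + 4 * (m * n)                           ≤⟨ +-monoʳ-≤ (2 * (K * P)) (*-monoˡ-≤ (m * n) (m≤m+n 4 8)) ⟩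
      2 * (K * P) + 12 * (m * n)                          ≡⟨ cong (λ z → 2 * (z * P) + 12 * (m * n)) K≡ ⟩
      2 * (144 * E * P) + 12 * (m * n)                    ≡⟨ lemma₃ E P (m * n) ⟩
      12 * (24 * E * P + m * n)                           ∎)
      where
      P = farPairs + 2 * (Q * N)
      W = ∫ μ farMass
      Λ = ∫ μ centralMass
      H²≤ : H * H ≤ 2 * W + Λ
      H²≤ = begin
        H * H                                                ≡⟨ ≡-sym (∫-const μ H) ⟩
        ∫ μ (λ _ → H)                                        ≤⟨ ∫-mono μ H≤2far+central ⟩
        ∫ μ (λ x → 2 * farMass x + centralMass x)            ≡⟨ trans (∫-+ μ _ _) (cong (_+ Λ) (∫-*ˡ μ 2 farMass)) ⟩
        2 * W + Λ                                            ∎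
      scaled : H * H * (n * (K * (N * N))) ≤ H * H * (2 * (K * n * P) + 4 * (N * N * m))
      scaled = begin
        H * H * (n * (K * (N * N)))                          ≤⟨ *-monoˡ-≤ _ H²≤ ⟩
        (2 * W + Λ) * (n * (K * (N * N)))                    ≡⟨ lemma W Λ n K N ⟩
        2 * (K * n * (N * N * W)) + N * N * (K * n * Λ)      ≤⟨ +-mono-≤ (*-monoʳ-≤ 2 (*-monoʳ-≤ (K * n) farPairs-lower)) (*-monoʳ-≤ (N * N) few-central) ⟩
        2 * (K * n * (H * H * P)) + N * N * (4 * (H * H * m)) ≡⟨ lemma′ (K * n) (H * H) P (N * N) m ⟩
        H * H * (2 * (K * n * P) + 4 * (N * N * m))          ∎
        where
        lemma : ∀ W Λ n K N → (2 * W + Λ) * (n * (K * (N * N))) ≡ 2 * (K * n * (N * N * W)) + N * N * (K * n * Λ)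
        lemma = solve-∀
        lemma′ : ∀ c d P s m → 2 * (c * (d * P)) + s * (4 * (d * m)) ≡ d * (2 * (c * P) + 4 * (s * m))
        lemma′ = solve-∀
      lemma₁ : ∀ E z → 12 * (12 * E * z) ≡ 144 * E * z
      lemma₁ = solve-∀
      lemma₂ : ∀ K n P m → 2 * (K * n * P) + 4 * (n * n * m) ≡ n * (2 * (K * P) + 4 * (m * n))
      lemma₂ = solve-∀
      lemma₃ : ∀ E P z → 2 * (144 * E * P) + 12 * z ≡ 12 * (24 * E * P + z)
      lemma₃ = solve-∀

    ramsey-turán : ∃[ e ] (RT-K4-≥ n m e × 3 * E * (n * n) + 8 * E * (m * n) ≤ 24 * E * e + 24 * (m * n))
    ramsey-turán = edges (graph types) ,
      subst (λ n → RT-K4-≥ n m (edges (graph types))) order (graph types , no-K4 types , small-independent-sets , ≤-refl) ,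
      edge-count-arithmetic {n} {m} {m′} {η} {N} {n₁} {Q} {farPairs} {E = E} 3m≤n m′+η≡m n≤ ≤n N≤n₁+classes edges-lower many-far-pairs
        (≤-trans (*-monoˡ-≤ Q (≤K 48 (m≤m+n 48 96))) KQ≤m) η-small (≤-trans (≤K 12 (m≤m+n 12 132)) K≤m)


-- λₙ and ℓ stand for log n and log log n.
module Parameters {n m E ℓ λₙ a k p q D K c : ℕ} .{{E≢0 : NonZero E}}
  (a≡ : a ≡ 2 ^ ℓ) (p≡ : p ≡ 16 * (a * a)) (q≡ : q ≡ 576 * (p * p)) (D≡ : D ≡ p * (576 * suc (ℓ + ℓ)))
  (K≡ : K ≡ 144 * E) (c≡ : c ≡ 9217 * 3) (1≤ℓ : 1 ≤ ℓ)
  (k≤2^ℓ : k ≤ 2 ^ ℓ) (k-large : 20736 * suc (ℓ + ℓ) ≤ k) (32ℓk≤λ : 32 * ℓ * k ≤ λₙ) (λ≤64ℓk : λₙ ≤ 64 * ℓ * k)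
  (2^λ≤n : 2 ^ λₙ ≤ n) (3m≤n : 3 * m ≤ n)
  (ratio : 8 * (c * K) * (8 * (c * K)) * (n * n) * ℓ ^ 3 ≤ m * m * λₙ) where

  open ≤-Reasoning

  instance
    ℓ≢0 : NonZero ℓ
    ℓ≢0 = >-nonZero 1≤ℓ
    a≢0 : NonZero a
    a≢0 = subst NonZero (≡-sym a≡) (m^n≢0 2 ℓ)
    p≢0 : NonZero p
    p≢0 = subst NonZero (≡-sym p≡) (m*n≢0 16 (a * a) {{_}} {{m*n≢0 a a}})
    q≢0 : NonZero q
    q≢0 = subst NonZero (≡-sym q≡) (m*n≢0 576 (p * p) {{_}} {{m*n≢0 p p}})
    c≢0 : NonZero c
    c≢0 = subst NonZero (≡-sym c≡) _
    k≢0 : NonZero k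
    k≢0 = >-nonZero (≤-trans (s≤s z≤n) k-large)
    n≢0 : NonZero n
    n≢0 = >-nonZero (≤-trans (m^n>0 2 λₙ) 2^λ≤n)

  k≤a : k ≤ a
  k≤a = subst (k ≤_) (≡-sym a≡) k≤2^ℓ

  2a≤p : 2 * a ≤ p
  2a≤p = subst (2 * a ≤_) (≡-sym p≡) (*-mono-≤ {2} {16} (m≤m+n 2 14) (m≤m*n a a))

  k+k≤p : k + k ≤ p
  k+k≤p = ≤-trans (≤-reflexive (cong (k +_) (≡-sym (+-identityʳ k)))) (≤-trans (*-monoʳ-≤ 2 k≤a) 2a≤p)

  open Realization a k ℓ p q D p≡ q≡ D≡ k+k≤p k≤2^ℓ k-large hiding (k≢0)

  -- With λₙ ≤ 64ℓk the ratio hypothesis for the constant 8cK turns into V ≤ m √k; the 8 is √64. The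
  -- factor cℓ with c = 3 · 9217 dominates 9217u, because u = 2ℓ + 1 ≤ 3ℓ.
  V : ℕ
  V = c * ℓ * (K * n)

  V²≤m²k : V * V ≤ m * m * k
  V²≤m²k = *-cancelˡ-≤ (64 * ℓ) {{m*n≢0 64 ℓ}} (begin
    64 * ℓ * (V * V)                                            ≡⟨ lemma₁ ℓ c K n ⟩
    8 * (c * K) * (8 * (c * K)) * (n * n) * ℓ ^ 3               ≤⟨ ratio ⟩
    m * m * λₙ                                                  ≤⟨ *-monoʳ-≤ (m * m) λ≤64ℓk ⟩
    m * m * (64 * ℓ * k)                                        ≡⟨ lemma₂ m ℓ k ⟩
    64 * ℓ * (m * m * k)                                        ∎)
    where
    lemma₁ : ∀ ℓ c K n → 64 * ℓ * (c * ℓ * (K * n) * (c * ℓ * (K * n))) ≡ 8 * (c * K) * (8 * (c * K)) * (n * n) * (ℓ * (ℓ * (ℓ * 1)))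
    lemma₁ = solve-∀
    lemma₂ : ∀ m ℓ k → m * m * (64 * ℓ * k) ≡ 64 * ℓ * (m * m * k)
    lemma₂ = solve-∀

  Kn≤km : K * n ≤ k * m
  Kn≤km = sq-cancel-≤ (begin
    K * n * (K * n)      ≤⟨ *-mono-≤ Kn≤V Kn≤V ⟩
    V * V                ≤⟨ V²≤m²k ⟩
    m * m * k            ≤⟨ *-monoʳ-≤ (m * m) (m≤m*n k k) ⟩
    m * m * (k * k)      ≡⟨ lemma m k ⟩
    k * m * (k * m)      ∎)
    where
    Kn≤V : K * n ≤ V
    Kn≤V = m≤n*m (K * n) (c * ℓ) {{m*n≢0 c ℓ}}
    lemma : ∀ m k → m * m * (k * k) ≡ k * m * (k * m)
    lemma = solve-∀

  central-good : ∀ x → isBad x ≡ false → K * n * centralMass x ≤ H * m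
  central-good x good = sq-cancel-≤ (*-cancelˡ-≤ (y * y * k) {{m*n≢0 (y * y) k {{m*n≢0 y y}}}} (begin
    y * y * k * (K * n * Z * (K * n * Z))                           ≡⟨ lemma₁ y k (K * n) Z ⟩
    V * V * (Z * Z * k)                                             ≤⟨ *-mono-≤ V²≤m²k (centralMass-bound x good) ⟩
    m * m * k * (9217 * (u * H) * (9217 * (u * H)))                 ≤⟨ *-monoʳ-≤ (m * m * k) (*-mono-≤ uH≤ uH≤) ⟩
    m * m * k * (y * H * (y * H))                                   ≡⟨ lemma₂ y k m H ⟩
    y * y * k * (H * m * (H * m))                                   ∎))
    where
    Z y : ℕ
    Z = centralMass x
    y = c * ℓ
    instance
      y≢0 : NonZero y
      y≢0 = m*n≢0 c ℓ
    uH≤ : 9217 * (u * H) ≤ y * H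
    uH≤ = begin
      9217 * (u * H)           ≤⟨ *-monoʳ-≤ 9217 (*-monoˡ-≤ H (≤-trans (+-monoˡ-≤ (ℓ + ℓ) 1≤ℓ) (≤-reflexive (lemma ℓ)))) ⟩
      9217 * (3 * ℓ * H)       ≡⟨ lemma′ 9217 3 ℓ H ⟩
      9217 * 3 * ℓ * H         ≡⟨ cong (λ d → d * ℓ * H) (≡-sym c≡) ⟩
      y * H                    ∎
      where
      lemma : ∀ ℓ → ℓ + (ℓ + ℓ) ≡ 3 * ℓ
      lemma = solve-∀
      lemma′ : ∀ b d ℓ H → b * (d * ℓ * H) ≡ b * d * ℓ * H
      lemma′ = solve-∀
    lemma₁ : ∀ y k s Z → y * y * k * (s * Z * (s * Z)) ≡ y * s * (y * s) * (Z * Z * k)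
    lemma₁ = solve-∀
    lemma₂ : ∀ y k m H → m * m * k * (y * H * (y * H)) ≡ y * y * k * (H * m * (H * m))
    lemma₂ = solve-∀

  suc-p≤ : suc p ≤ 2 ^ (7 * ℓ)
  suc-p≤ = begin
    suc p                                    ≤⟨ +-monoˡ-≤ p (>-nonZero⁻¹ p) ⟩
    p + p                                    ≡⟨ cong (λ z → z + z) (trans p≡ (cong (λ z → 16 * (z * z)) a≡)) ⟩
    16 * (b * b) + 16 * (b * b)              ≡⟨ lemma b ⟩
    32 * (b * b)                             ≤⟨ *-monoˡ-≤ (b * b) (^-monoʳ-≤ 2 (*-monoʳ-≤ 5 1≤ℓ)) ⟩
    2 ^ (5 * ℓ) * (b * b)                    ≡⟨ cong (2 ^ (5 * ℓ) *_) (≡-sym (^-distribˡ-+-* 2 ℓ ℓ)) ⟩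
    2 ^ (5 * ℓ) * 2 ^ (ℓ + ℓ)                ≡⟨ ≡-sym (^-distribˡ-+-* 2 (5 * ℓ) (ℓ + ℓ)) ⟩
    2 ^ (5 * ℓ + (ℓ + ℓ))                    ≡⟨ cong (2 ^_) (lemma′ ℓ) ⟩
    2 ^ (7 * ℓ)                              ∎
    where
    b = 2 ^ ℓ
    lemma : ∀ b → 16 * (b * b) + 16 * (b * b) ≡ 32 * (b * b)
    lemma = solve-∀
    lemma′ : ∀ ℓ → 5 * ℓ + (ℓ + ℓ) ≡ 7 * ℓ
    lemma′ = solve-∀

  -- (p + 1)^(2h) ≤ 2^(7ℓ · 4k) and 28ℓk ≤ 32ℓk ≤ λₙ: this is the constraint that limits the
  -- dimension to order λₙ / ℓ.
  classes²≤n : length μ * length μ ≤ n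
  classes²≤n = begin
    length μ * length μ                          ≤⟨ *-mono-≤ ≤2^ ≤2^ ⟩
    2 ^ (7 * ℓ * h) * 2 ^ (7 * ℓ * h)            ≡⟨ ≡-sym (^-distribˡ-+-* 2 (7 * ℓ * h) (7 * ℓ * h)) ⟩
    2 ^ (7 * ℓ * h + 7 * ℓ * h)                  ≤⟨ ^-monoʳ-≤ 2 (≤-trans (≤-reflexive (lemma ℓ k)) (≤-trans (*-monoˡ-≤ k (*-monoˡ-≤ ℓ (m≤m+n 28 4))) 32ℓk≤λ)) ⟩
    2 ^ λₙ                                       ≤⟨ 2^λ≤n ⟩
    n                                            ∎
    where
    ≤2^ : length μ ≤ 2 ^ (7 * ℓ * h)
    ≤2^ = begin
      length μ              ≡⟨ length-μ ⟩
      suc p ^ h             ≤⟨ ^-monoˡ-≤ h suc-p≤ ⟩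
      (2 ^ (7 * ℓ)) ^ h     ≡⟨ ^-*-assoc 2 (7 * ℓ) h ⟩
      2 ^ (7 * ℓ * h)       ∎
    lemma : ∀ ℓ k → 7 * ℓ * (k + k) + 7 * ℓ * (k + k) ≡ 28 * ℓ * k
    lemma = solve-∀

  k≤classes : k ≤ length μ
  k≤classes = begin
    k             ≤⟨ ≤-trans (m≤m+n k k) k+k≤p ⟩
    p             ≤⟨ n≤1+n p ⟩
    suc p         ≡⟨ ≡-sym (^-identityʳ (suc p)) ⟩
    suc p ^ 1     ≤⟨ ^-monoʳ-≤ (suc p) (≤-trans (>-nonZero⁻¹ k) (m≤m+n k k)) ⟩
    suc p ^ h     ≡⟨ ≡-sym length-μ ⟩
    length μ      ∎

  KQ≤m : K * length μ ≤ m
  KQ≤m = *-cancelˡ-≤ k (begin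
    k * (K * length μ)              ≤⟨ *-monoˡ-≤ (K * length μ) k≤classes ⟩
    length μ * (K * length μ)       ≡⟨ lemma (length μ) K ⟩
    K * (length μ * length μ)       ≤⟨ *-monoʳ-≤ K classes²≤n ⟩
    K * n                           ≤⟨ Kn≤km ⟩
    k * m                           ∎)
    where
    lemma : ∀ Q K → Q * (K * Q) ≡ K * (Q * Q)
    lemma = solve-∀

  ramsey-turán-bound : ∃[ e ] (RT-K4-≥ n m e × 3 * E * (n * n) + 8 * E * (m * n) ≤ 24 * E * e + 24 * (m * n))
  ramsey-turán-bound = Count.ramsey-turán n m E K K≡ 3m≤n Kn≤km (central-total K n m central-good Kn≤km) KQ≤m

-- Choice of the dimension for large n

2^2^b≤n⇒b≤LL : ∀ b n → 2 ^ (2 ^ b) ≤ n → b ≤ LL n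
2^2^b≤n⇒b≤LL b n le = subst (_≤ LL n) (⌊log₂[2^n]⌋≡n b)
  (⌊log₂⌋-mono-≤ (subst (_≤ L n) (⌊log₂[2^n]⌋≡n (2 ^ b)) (⌊log₂⌋-mono-≤ le)))

threshold : ∀ b → ∃[ N ] ∀ n → N ≤ n → b ≤ LL n × NonZero n
threshold b = 2 ^ (2 ^ b) , λ n le → 2^2^b≤n⇒b≤LL b n le , >-nonZero (≤-trans (m^n>0 2 (2 ^ b)) le)

*-≤⇒≤-/ : ∀ x y z .{{_ : NonZero z}} → x * z ≤ y → x ≤ y / z
*-≤⇒≤-/ x y z xz≤y = subst (_≤ y / z) (m*n/n≡m x z) (/-monoˡ-≤ z xz≤y)

-- It is enough that 20736 · 96 · ℓ² ≤ 2^ℓ, which is evaluated at ℓ = 32 and propagates upwards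
-- since squares grow more slowly than powers of 2.
block-count-large : ∀ {ℓ λₙ} → 32 ≤ ℓ → 2 ^ ℓ ≤ λₙ → 20736 * suc (ℓ + ℓ) * (32 * ℓ) ≤ λₙ
block-count-large {ℓ} {λₙ} 32≤ℓ 2^ℓ≤λ = begin
  20736 * suc (ℓ + ℓ) * (32 * ℓ)     ≤⟨ *-monoˡ-≤ (32 * ℓ) (*-monoʳ-≤ 20736 (+-monoˡ-≤ (ℓ + ℓ) (≤-trans (s≤s z≤n) 32≤ℓ))) ⟩
  20736 * (ℓ + (ℓ + ℓ)) * (32 * ℓ)   ≡⟨ lemma 20736 ℓ ⟩
  20736 * 96 * (ℓ * ℓ)               ≤⟨ exponential-beats-square (20736 * 96) 32 (m≤m+n 3 29) (≤ᵇ⇒≤ (20736 * 96 * (32 * 32)) (2 ^ 32) tt) 32≤ℓ ⟩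
  2 ^ ℓ                              ≤⟨ 2^ℓ≤λ ⟩
  λₙ                                 ∎
  where
  open ≤-Reasoning
  lemma : ∀ b ℓ → b * (ℓ + (ℓ + ℓ)) * (32 * ℓ) ≡ b * 96 * (ℓ * ℓ)
  lemma = solve-∀

lower-bound : ∀ {n m E K c ℓ λₙ} .{{_ : NonZero E}} → K ≡ 144 * E → c ≡ 9217 * 3 →
  32 ≤ ℓ → 2 ^ ℓ ≤ λₙ → λₙ < 2 ^ suc ℓ → 2 ^ λₙ ≤ n → 3 * m ≤ n →
  8 * (c * K) * (8 * (c * K)) * (n * n) * ℓ ^ 3 ≤ m * m * λₙ →
  ∃[ e ] (RT-K4-≥ n m e × 3 * E * (n * n) + 8 * E * (m * n) ≤ 24 * E * e + 24 * (m * n))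
lower-bound {n} {m} {E} {K} {c} {ℓ} {λₙ} K≡ c≡ 32≤ℓ 2^ℓ≤λ λ< 2^λ≤n 3m≤n ratio =
  Parameters.ramsey-turán-bound {n} {m} {E} {ℓ} {λₙ} {2 ^ ℓ} {k} {K = K} {c = c} refl refl refl refl K≡ c≡ 1≤ℓ k≤2^ℓ k-large 32ℓk≤λ λ≤64ℓk
    2^λ≤n 3m≤n ratio
  where
  open ≤-Reasoning
  1≤ℓ : 1 ≤ ℓ
  1≤ℓ = ≤-trans (s≤s z≤n) 32≤ℓ
  instance
    32ℓ≢0 : NonZero (32 * ℓ)
    32ℓ≢0 = m*n≢0 32 ℓ {{_}} {{>-nonZero 1≤ℓ}}
  k : ℕ
  k = λₙ / (32 * ℓ)
  32ℓk≤λ : 32 * ℓ * k ≤ λₙ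
  32ℓk≤λ = ≤-trans (≤-reflexive (*-comm (32 * ℓ) k)) (m/n*n≤m λₙ (32 * ℓ))
  k-large : 20736 * suc (ℓ + ℓ) ≤ k
  k-large = *-≤⇒≤-/ (20736 * suc (ℓ + ℓ)) λₙ (32 * ℓ) (block-count-large 32≤ℓ 2^ℓ≤λ)
  1≤k : 1 ≤ k
  1≤k = ≤-trans (s≤s z≤n) k-large
  k≤2^ℓ : k ≤ 2 ^ ℓ
  k≤2^ℓ = *-cancelˡ-≤ 2 (begin
    2 * k               ≤⟨ *-monoˡ-≤ k (≤-trans (m≤m+n 2 30) (≤-trans (≤-reflexive (≡-sym (*-identityʳ 32))) (*-monoʳ-≤ 32 1≤ℓ))) ⟩
    32 * ℓ * k          ≤⟨ 32ℓk≤λ ⟩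
    λₙ                  ≤⟨ <⇒≤ λ< ⟩
    2 * 2 ^ ℓ           ∎)
  λ≤64ℓk : λₙ ≤ 64 * ℓ * k
  λ≤64ℓk = begin
    λₙ                                     ≡⟨ m≡m%n+[m/n]*n λₙ (32 * ℓ) ⟩
    λₙ % (32 * ℓ) + k * (32 * ℓ)           ≤⟨ +-monoˡ-≤ (k * (32 * ℓ)) (<⇒≤ (m%n<n λₙ (32 * ℓ))) ⟩
    32 * ℓ + k * (32 * ℓ)                  ≤⟨ +-monoˡ-≤ (k * (32 * ℓ)) (m≤n*m (32 * ℓ) k {{>-nonZero 1≤k}}) ⟩
    k * (32 * ℓ) + k * (32 * ℓ)            ≡⟨ lemma k ℓ ⟩
    64 * ℓ * k                             ∎
    where
    lemma : ∀ k ℓ → k * (32 * ℓ) + k * (32 * ℓ) ≡ 64 * ℓ * k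
    lemma = solve-∀

⌊log₂n⌋≥1⇒n≢0 : ∀ {n} → 1 ≤ ⌊log₂ n ⌋ → NonZero n
⌊log₂n⌋≥1⇒n≢0 {suc n} _ = _

-- The o(1) is replaced by 1/(k + 1) for every k, with a threshold depending on k; the inequality is
-- multiplied by 24(k + 1) and its error term moved to the right.
theorem1p7 : (m : ℕ → ℕ) → (∀ n → 3 * m n ≤ n) → RatioToInfinity m →
    ∀ k → ∃[ N ] ∀ n → N ≤ n → ∃[ e ] (RT-K4-≥ n (m n) e ×
    3 * suc k * (n * n) + 8 * suc k * (m n * n) ≤ 24 * suc k * e + 24 * (m n * n))
theorem1p7 m 3m≤n ratio k = conclude (threshold 32) refl refl
  where
  conclude : ∀ {K c} → (∃[ N ] ∀ n → N ≤ n → 32 ≤ LL n × NonZero n) → K ≡ 144 * suc k → c ≡ 9217 * 3 →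
    ∃[ N ] ∀ n → N ≤ n → ∃[ e ] (RT-K4-≥ n (m n) e ×
    3 * suc k * (n * n) + 8 * suc k * (m n * n) ≤ 24 * suc k * e + 24 * (m n * n))
  conclude {K} {c} (N , large) K≡ c≡ with ratio (8 * (c * K))
  ... | N′ , bound = N + N′ , λ n le →
    let 32≤ℓ , n≢0 = large n (≤-trans (m≤m+n N N′) le) in
    lower-bound {n} {m n} {suc k} {K} {c} {LL n} {L n} K≡ c≡ 32≤ℓ
      (2^⌊log₂n⌋≤n (L n) {{⌊log₂n⌋≥1⇒n≢0 (≤-trans (s≤s z≤n) 32≤ℓ)}}) (n<2^1+⌊log₂n⌋ (L n))
      (2^⌊log₂n⌋≤n n {{n≢0}}) (3m≤n n) (bound n (≤-trans (m≤n+m N′ N) le))
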